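{- There is a polynomial-time online algorithm for Online Stochastic Matching with Timeouts whose expected total profit is, on every instance, at least $0.245$ times the expected profit of an optimal online algorithm.
   Context: Online Stochastic Matching with Timeouts. The input consists of: - a complete bipartite graph $G=(A\cup B,A\times B)$, where $A$ is a set of items and $B$ a set of buyer types; - for each edge $ab$, a probability $p_{ab}\in(0,1]$ and a profit $w_{ab}\ge 0$; - for each buyer type $b$, a positive integer timeout $t_b$ (items have unbounded timeouts); - a number $n$ of rounds, and a probability distribution on $B$ in which every probability is an integer multiple of $1/n$. The process runs for $n$ rounds. In each round a buyer's type $b$ is sampled independently from the distribution, with repetitions allowed. The online algorithm then chooses at most $t_b$ items that are still unmatched and probes the corresponding edges one at a time, in an order it chooses. - Each probed edge $ab$ exists independently with probability $p_{ab}$. - If a probed edge exists, the item $a$ is matched to this buyer, profit $w_{ab}$ is gained, and this buyer stops probing. - Otherwise the algorithm continues with the next chosen item. Each item can be matched at most once. The goal is to maximize the expected total profit, and this is compared to an optimal online algorithm.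
   Formalization: The edge probabilities and the profits are taken to be rational numbers, as finitely encoded input of a polynomial-time algorithm, rather than arbitrary real numbers. -}

module Defs where

open import Data.Bool.Base using (Bool; true; false)
open import Data.Fin.Base using (Fin; toℕ)
open import Data.Integer.Base using (+_; ∣_∣)
open import Data.List.Base using (List; []; _∷_; length; map; concatMap; foldr; replicate; tabulate)
open import Data.List.Relation.Unary.All using (All)
open import Data.List.Relation.Unary.Unique.Propositional using (Unique)
open import Data.Maybe.Base using (Maybe; just; nothing)
open import Data.Nat.Base as ℕ using (ℕ; zero; suc; NonZero)
open import Data.Nat.Binary.Base using (ℕᵇ; zero; 2[1+_]; 1+[2_]; fromℕ)
open import Data.Product.Base using (∃-syntax; _×_; _,_)
open import Data.Rational.Base using (ℚ; 0ℚ; 1ℚ; ½; _+_; _*_; _-_; _≤_; _<_; _/_; ↥_; ↧ₙ_)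
open import Data.Vec.Base as Vec using (Vec; lookup; _[_]≔_)
open import Relation.Binary.PropositionalEquality.Core using (_≡_; _≢_)

------------------------------------------------------------------------
-- Finitely supported probability: outcomes listed with their weights

Dist : Set → Set
Dist X = List (ℚ × X)

return : ∀ {X} → X → Dist X
return x = (1ℚ , x) ∷ []

infixl 1 _>>=_
_>>=_ : ∀ {X Y} → Dist X → (X → Dist Y) → Dist Y
d >>= f = concatMap (λ (p , x) → map (λ (q , y) → (p * q , y)) (f x)) d

bernoulli : ℚ → Dist Bool
bernoulli p = (p , true) ∷ (1ℚ - p , false) ∷ []

fairCoins : ∀ m → Dist (Vec Bool m)
fairCoins zero    = return Vec.[]
fairCoins (suc m) = bernoulli ½ >>= λ c → fairCoins m >>= λ cs → return (c Vec.∷ cs)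

expectation : ∀ {X} → (X → ℚ) → Dist X → ℚ
expectation f = foldr (λ (p , x) acc → p * f x + acc) 0ℚ

------------------------------------------------------------------------
-- Online Stochastic Matching with Timeouts

-- The numerical data are rational, as they are the input of an algorithm.
record Instance : Set where
  field
    items types : ℕ

    prob    : Fin items → Fin types → ℚ
    prob>0  : ∀ a b → 0ℚ < prob a b
    prob≤1  : ∀ a b → prob a b ≤ 1ℚ

    profit   : Fin items → Fin types → ℚ
    profit≥0 : ∀ a b → 0ℚ ≤ profit a b

    timeout   : Fin types → ℕ
    timeout>0 : ∀ b → NonZero (timeout b)

    rounds : ℕ
    {{rounds>0}} : NonZero rounds

    -- type b arrives with probability multiplicity b / rounds
    multiplicity : Fin types → ℕ
    multiplicity-sum : foldr ℕ._+_ 0 (tabulate multiplicity) ≡ rounds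

  arrival : Dist (Fin types)
  arrival = tabulate λ b → ((+ multiplicity b) / rounds , b)

module _ (I : Instance) where
  open Instance I

  -- What happened in one round: the type of the buyer, the items chosen for
  -- it in probing order, and the item it was matched to, if any.
  record Event : Set where
    constructor event
    field
      buyer   : Fin types
      chosen  : List (Fin items)
      matched : Maybe (Fin items)

  -- most recent round first
  History : Set
  History = List Event

  Unmatched : History → Fin items → Set
  Unmatched h a = All (λ e → Event.matched e ≢ just a) h

  Legal : History → Fin types → List (Fin items) → Set
  Legal h b as = length as ℕ.≤ timeout b × Unique as × All (Unmatched h) as

  -- Fixing the order of all probes of a round in advance loses no generality:
  -- a later probe of the round is made only if all earlier ones failed.
  record Policy : Set where
    field
      choose : History → Fin types → List (Fin items)
      legal  : ∀ h b → Legal h b (choose h b)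

  -- The random bits are drawn at the start and remain available throughout.
  record OnlineAlgorithm : Set where
    field
      coins  : ℕ
      policy : Vec Bool coins → Policy

  probe : Fin types → List (Fin items) → Dist (Maybe (Fin items))
  probe b []       = return nothing
  probe b (a ∷ as) = bernoulli (prob a b) >>= λ
    { true  → return (just a)
    ; false → probe b as
    }

  play : Policy → ℕ → History → Dist History
  play π zero    h = return h
  play π (suc k) h =
    arrival >>= λ b →
    let as = Policy.choose π h b in
    probe b as >>= λ m →
    play π k (event b as m ∷ h)

  gain : Event → ℚ
  gain (event b _ (just a)) = profit a b
  gain (event b _ nothing)  = 0ℚ

  totalProfit : History → ℚ
  totalProfit = foldr (λ e acc → gain e + acc) 0ℚ

  expectedProfit : OnlineAlgorithm → ℚ
  expectedProfit A =
    expectation totalProfit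
      (fairCoins coins >>= λ r → play (policy r) rounds [])
    where open OnlineAlgorithm A

------------------------------------------------------------------------
-- Model of computation: the WHILE language over binary trees (N. D. Jones,
-- "Computability and Complexity", MIT Press 1997).  With trees stored as
-- pointers to shared cells every operation below takes constant time, and the
-- model defines the same polynomial-time functions as Turing machines.

data Tree : Set where
  nil  : Tree
  cons : Tree → Tree → Tree

size : Tree → ℕ
size nil        = 1
size (cons s t) = suc (size s ℕ.+ size t)

head tail : Tree → Tree
head nil        = nil
head (cons s t) = s
tail nil        = nil
tail (cons s t) = t

data Expr (k : ℕ) : Set where
  var   : Fin k → Expr k
  nilᵉ  : Expr k
  consᵉ : Expr k → Expr k → Expr k
  hdᵉ   : Expr k → Expr k
  tlᵉ   : Expr k → Expr k

infix  5 _≔_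
infixr 4 _⨟_

data Command (k : ℕ) : Set where
  _≔_           : Fin k → Expr k → Command k
  _⨟_           : Command k → Command k → Command k
  if_then_else_ : Expr k → Command k → Command k → Command k
  while_loop_   : Expr k → Command k → Command k

Store : ℕ → Set
Store = Vec Tree

eval : ∀ {k} → Expr k → Store k → Tree
eval (var x)     σ = lookup σ x
eval nilᵉ        σ = nil
eval (consᵉ e f) σ = cons (eval e σ) (eval f σ)
eval (hdᵉ e)     σ = head (eval e σ)
eval (tlᵉ e)     σ = tail (eval e σ)

cost : ∀ {k} → Expr k → ℕ
cost (var x)     = 1
cost nilᵉ        = 1
cost (consᵉ e f) = suc (cost e ℕ.+ cost f)
cost (hdᵉ e)     = suc (cost e)
cost (tlᵉ e)     = suc (cost e)

-- c ∣ σ ⇓[ t ] τ : started in the store σ, the command c halts after time t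
-- in the store τ.  In tests nil is false and every other tree is true.
infix 3 _∣_⇓[_]_

data _∣_⇓[_]_ {k : ℕ} : Command k → Store k → ℕ → Store k → Set where
  assign : ∀ {x e σ} →
    x ≔ e ∣ σ ⇓[ suc (cost e) ] σ [ x ]≔ eval e σ
  seq : ∀ {c d σ τ υ s t} →
    c ∣ σ ⇓[ s ] τ → d ∣ τ ⇓[ t ] υ →
    c ⨟ d ∣ σ ⇓[ s ℕ.+ t ] υ
  if-true : ∀ {e c d σ τ t} →
    eval e σ ≢ nil → c ∣ σ ⇓[ t ] τ →
    if e then c else d ∣ σ ⇓[ suc (cost e) ℕ.+ t ] τ
  if-false : ∀ {e c d σ τ t} →
    eval e σ ≡ nil → d ∣ σ ⇓[ t ] τ →
    if e then c else d ∣ σ ⇓[ suc (cost e) ℕ.+ t ] τ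
  while-true : ∀ {e c σ τ υ s t} →
    eval e σ ≢ nil → c ∣ σ ⇓[ s ] τ → while e loop c ∣ τ ⇓[ t ] υ →
    while e loop c ∣ σ ⇓[ suc (cost e) ℕ.+ (s ℕ.+ t) ] υ
  while-false : ∀ {e c σ} →
    eval e σ ≡ nil →
    while e loop c ∣ σ ⇓[ suc (cost e) ] σ

-- Variable zero holds the input at the start and the output at the end; all
-- other variables are initially nil.
record Program : Set where
  field
    extra : ℕ
    body  : Command (suc extra)

Computes : Program → Tree → Tree → ℕ → Set
Computes p x y t =
  ∃[ σ ] (body ∣ x Vec.∷ Vec.replicate extra nil ⇓[ t ] σ) × Vec.head σ ≡ y
  where open Program p

-- coefficients, constant term first
Polynomial : Set
Polynomial = List ℕ

⟦_⟧ : Polynomial → ℕ → ℕ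
⟦ cs ⟧ x = foldr (λ c acc → c ℕ.+ x ℕ.* acc) 0 cs

------------------------------------------------------------------------
-- Encoding of inputs and outputs

listᵗ : ∀ {X : Set} → (X → Tree) → List X → Tree
listᵗ f = foldr (λ x t → cons (f x) t) nil

tableᵗ : ∀ {X : Set} {m} → (X → Tree) → (Fin m → X) → Tree
tableᵗ f g = listᵗ f (tabulate g)

boolᵗ : Bool → Tree
boolᵗ false = nil
boolᵗ true  = cons nil nil

unaryᵗ : ℕ → Tree
unaryᵗ n = listᵗ (λ t → t) (replicate n nil)

-- Bijective base 2, least significant digit first: nil is the digit 2 and
-- cons nil nil the digit 1.
ℕᵇᵗ : ℕᵇ → Tree
ℕᵇᵗ zero     = nil
ℕᵇᵗ 2[1+ x ] = cons nil (ℕᵇᵗ x)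
ℕᵇᵗ 1+[2 x ] = cons (cons nil nil) (ℕᵇᵗ x)

binaryᵗ : ℕ → Tree
binaryᵗ n = ℕᵇᵗ (fromℕ n)

-- for nonnegative rationals, the only ones in an instance
ratᵗ : ℚ → Tree
ratᵗ q = cons (binaryᵗ ∣ ↥ q ∣) (binaryᵗ (↧ₙ q))

-- Items and types are indices into tables that are written out in full, so
-- unary notation does not increase the input size by more than a polynomial.
indexᵗ : ∀ {m} → Fin m → Tree
indexᵗ i = unaryᵗ (toℕ i)

maybeᵗ : ∀ {X : Set} → (X → Tree) → Maybe X → Tree
maybeᵗ f nothing  = nil
maybeᵗ f (just x) = cons nil (f x)

-- The number of rounds is in unary: an algorithm acts once per round, so its
-- running time is measured in terms of the number of rounds as well.
instanceᵗ : Instance → Tree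
instanceᵗ I =
  cons (tableᵗ (tableᵗ ratᵗ) prob)
  (cons (tableᵗ (tableᵗ ratᵗ) profit)
  (cons (tableᵗ binaryᵗ timeout)
  (cons (unaryᵗ rounds)
  (tableᵗ binaryᵗ multiplicity))))
  where open Instance I

module _ (I : Instance) where
  open Instance I

  itemsᵗ : List (Fin items) → Tree
  itemsᵗ = listᵗ indexᵗ

  eventᵗ : Event I → Tree
  eventᵗ (event b as m) = cons (indexᵗ b) (cons (itemsᵗ as) (maybeᵗ indexᵗ m))

  inputᵗ : ∀ {m} → Vec Bool m → History I → Fin types → Tree
  inputᵗ r h b =
    cons (instanceᵗ I)
    (cons (listᵗ boolᵗ (Vec.toList r))
    (cons (listᵗ eventᵗ h)
    (indexᵗ b)))

------------------------------------------------------------------------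
-- Polynomial-time online algorithms

-- One program, working for all instances, computes the decision of every round
-- from the instance, the random bits, the past rounds and the type of the
-- current buyer.  Histories of at most `rounds` rounds in which the algorithm
-- obeyed the rules have size polynomial in that of the instance, so the time
-- for the whole process is polynomial in the size of the instance.  The number
-- of random bits is required to be equal to a polynomial, rather than bounded
-- by one, so that it cannot serve as noncomputable advice.
record PolynomialTime (alg : (I : Instance) → OnlineAlgorithm I) : Set where
  open Instance
  open OnlineAlgorithm
  open Policy
  field
    program   : Program
    coinCount : Polynomial
    timeBound : Polynomial
    coins-poly : ∀ I → coins (alg I) ≡ ⟦ coinCount ⟧ (size (instanceᵗ I))
    computes : ∀ I (r : Vec Bool (coins (alg I))) (h : History I) (b : Fin (types I)) →
      ∃[ t ] t ℕ.≤ ⟦ timeBound ⟧ (size (inputᵗ I r h b))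
           × Computes program (inputᵗ I r h b) (itemsᵗ I (choose (policy (alg I) r) h b)) t

{-# OPTIONS --safe #-}
module Submission where

-- The algorithm puts a price on every item, the value of keeping it.  Prices
-- are 0 after the last round and are computed backwards.  In a round with
-- prices ν run through the items from the last one to the first one and set,
-- for every buyer type b,
--
--   g(a,b) = max(0, p(a,b) (w(a,b) − ν(a) − G) − G / t(b)),
--
-- where G is the sum of g over the items already visited.  The price of a for
-- the previous round is ν(a) + Σ_b Pr[b] g(a,b).  A buyer of type b is offered
-- the first t(b) unmatched items with g(a,b) > 0.
--
-- Each g(a,b) is charged three times: to the price of a, to the buyer (G) and
-- to the timeout (G / t(b)).  On the one hand, with s probes left a round gains
-- at least (s / t(b)) Σ g over the unmatched items beyond their prices, so the
-- algorithm earns at least the sum S of the initial prices.  On the other hand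
-- prices and timeouts are dual variables: whatever is probed, a round gains at
-- most 3 Σ_a g(a,b) beyond the prices, so no policy earns more than S + 3 S.
-- The ratio is thus 1/4 ≥ 0.245.
--
-- All divisions are exact in integers once amounts of money are multiplied by
-- Z ^ (1 + 2 · items · rounds), where Z is a common multiple of the
-- denominators, and such numbers have polynomially many digits.

open import Defs

-- The surcharges G and G / t(b) are opportunity costs. A match ends the round, so a probe of a
-- forfeits, with probability p(a,b), whatever the items behind a would bring; and every probe,
-- successful or not, uses up a share 1 / t(b) of the timeout. An item with g(a,b) > 0 outweighs
-- both, so probing such items greedily in a fixed order is safe. For an arbitrary policy the
-- probing order is irrelevant, because the sum over the items behind a is at most the sum T over
-- all items: p(a,b) T adds up to at most T, as a match ends the round, the share T / t(b) is
-- credited at most t(b) times, and the g(a,b) of distinct items add up to at most T. Hence the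
-- factor 3.
--
-- The prices arise from backward sweeps with explicit formulas, so that the running time can be
-- certified down to a concrete program. The danger is the growth of numbers under iteration: a
-- polynomial bound on the output of one sweep does not yield one for many sweeps. It is averted
-- since g(a,b) is at most p(a,b) w(a,b) whatever the prices are, so every sweep adds a bounded
-- amount.

module Programs where

  open import Data.Bool.Base using (Bool; true; false; not; _∧_) renaming (if_then_else_ to ifᵇ_then_else_)
  open import Data.Fin.Base using (Fin; zero; suc; toℕ)
  open import Data.List.Base using (List; []; _∷_; _++_; length; map; foldl; foldr; reverse; replicate; tabulate; allFin; zip; take; drop)
  open import Data.List.Properties using (++-assoc; ++-identityʳ; foldl-++; reverse-involutive; reverse-++; reverse-foldr; ∷-injectiveʳ; map-∘; map-cong; map-tabulate; length-map; drop-[])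
  open import Data.List.Relation.Unary.All as All using (All; []; _∷_)
  import Data.List.Relation.Unary.All.Properties as All
  open import Data.Nat.Base using (ℕ; zero; suc; pred; _+_; _*_; _∸_; _^_; _≤_; _<_; z≤n; s≤s; _≡ᵇ_)
  open import Data.Nat.Binary.Base using (ℕᵇ; zero; 2[1+_]; 1+[2_]; fromℕ) renaming (toℕ to toℕᵇ)
  open import Data.Nat.Binary.Properties using (toℕ-fromℕ; toℕ-injective)
  open import Data.Nat.Divisibility using (_∣_; ∣m+n∣m⇒∣n; n∣m*n; >⇒∤)
  open import Data.Nat.ListAction using (sum; product)
  open import Data.Nat.Properties
  open import Data.Nat.Tactic.RingSolver using (solve-∀)
  open import Data.Product.Base using (∃-syntax; _×_; _,_; proj₁; proj₂)
  open import Data.Unit.Base using (⊤; tt)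
  open import Data.Vec.Base using ([]; _∷_)
  open import Function.Base using (_∘_; id; flip)
  open import Relation.Binary.PropositionalEquality using (_≡_; _≢_; refl; sym; trans; cong; cong₂; subst; subst₂; module ≡-Reasoning)
  open import Relation.Nullary using (yes; no; contradiction)

  -- Polynomial bounds on time and size

  data Bound : Set where
    con     : ℕ → Bound
    ♯       : Bound
    _⊕_ _⊗_ : Bound → Bound → Bound

  infixl 6 _⊕_
  infixl 7 _⊗_

  val : Bound → ℕ → ℕ
  val (con c) n = c
  val ♯       n = n
  val (p ⊕ q) n = val p n + val q n
  val (p ⊗ q) n = val p n * val q n

  -- There are natural coefficients and no subtraction. Hence a bound in the size of an argument may
  -- be evaluated at any upper estimate of that size.
  val-mono : ∀ p {m n} → m ≤ n → val p m ≤ val p n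
  val-mono (con c) m≤n = ≤-refl
  val-mono ♯       m≤n = m≤n
  val-mono (p ⊕ q) m≤n = +-mono-≤ (val-mono p m≤n) (val-mono q m≤n)
  val-mono (p ⊗ q) m≤n = *-mono-≤ (val-mono p m≤n) (val-mono q m≤n)

  infix 8 _⟪_⟫
  -- Substitution, needed whenever programs are composed. It is trivial on expressions, which is why
  -- coefficient lists appear only at the very end, through `toPolynomial`.
  _⟪_⟫ : Bound → Bound → Bound
  con c   ⟪ r ⟫ = con c
  ♯       ⟪ r ⟫ = r
  (p ⊕ q) ⟪ r ⟫ = p ⟪ r ⟫ ⊕ q ⟪ r ⟫
  (p ⊗ q) ⟪ r ⟫ = p ⟪ r ⟫ ⊗ q ⟪ r ⟫

  val-⟪⟫ : ∀ p r n → val (p ⟪ r ⟫) n ≡ val p (val r n)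
  val-⟪⟫ (con c) r n = refl
  val-⟪⟫ ♯       r n = refl
  val-⟪⟫ (p ⊕ q) r n = cong₂ _+_ (val-⟪⟫ p r n) (val-⟪⟫ q r n)
  val-⟪⟫ (p ⊗ q) r n = cong₂ _*_ (val-⟪⟫ p r n) (val-⟪⟫ q r n)

  val-≤-⟪⟫ : ∀ p r n {m} → m ≤ val r n → val p m ≤ val (p ⟪ r ⟫) n
  val-≤-⟪⟫ p r n m≤ = ≤-trans (val-mono p m≤) (≤-reflexive (sym (val-⟪⟫ p r n)))

  addPoly mulPoly : Polynomial → Polynomial → Polynomial
  addPoly []       ds       = ds
  addPoly (c ∷ cs) []       = c ∷ cs
  addPoly (c ∷ cs) (d ∷ ds) = c + d ∷ addPoly cs ds
  mulPoly []       ds = []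
  mulPoly (c ∷ cs) ds = addPoly (map (c *_) ds) (0 ∷ mulPoly cs ds)

  ⟦addPoly⟧ : ∀ cs ds x → ⟦ addPoly cs ds ⟧ x ≡ ⟦ cs ⟧ x + ⟦ ds ⟧ x
  ⟦addPoly⟧ []       ds       x = refl
  ⟦addPoly⟧ (c ∷ cs) []       x = sym (+-identityʳ _)
  ⟦addPoly⟧ (c ∷ cs) (d ∷ ds) x =
    trans (cong (λ y → c + d + x * y) (⟦addPoly⟧ cs ds x))
          (rearrange c d x (⟦ cs ⟧ x) (⟦ ds ⟧ x))
    where
    rearrange : ∀ c d x y z → c + d + x * (y + z) ≡ c + x * y + (d + x * z)
    rearrange = solve-∀

  ⟦scale⟧ : ∀ c ds x → ⟦ map (c *_) ds ⟧ x ≡ c * ⟦ ds ⟧ x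
  ⟦scale⟧ c []       x = sym (*-zeroʳ c)
  ⟦scale⟧ c (d ∷ ds) x =
    trans (cong (λ y → c * d + x * y) (⟦scale⟧ c ds x)) (rearrange c d x (⟦ ds ⟧ x))
    where
    rearrange : ∀ c d x y → c * d + x * (c * y) ≡ c * (d + x * y)
    rearrange = solve-∀

  ⟦mulPoly⟧ : ∀ cs ds x → ⟦ mulPoly cs ds ⟧ x ≡ ⟦ cs ⟧ x * ⟦ ds ⟧ x
  ⟦mulPoly⟧ []       ds x = refl
  ⟦mulPoly⟧ (c ∷ cs) ds x = begin
    ⟦ addPoly (map (c *_) ds) (0 ∷ mulPoly cs ds) ⟧ x ≡⟨ ⟦addPoly⟧ (map (c *_) ds) _ x ⟩
    ⟦ map (c *_) ds ⟧ x + x * ⟦ mulPoly cs ds ⟧ x     ≡⟨ cong₂ (λ y z → y + x * z) (⟦scale⟧ c ds x) (⟦mulPoly⟧ cs ds x) ⟩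
    c * ⟦ ds ⟧ x + x * (⟦ cs ⟧ x * ⟦ ds ⟧ x)          ≡⟨ rearrange c x (⟦ cs ⟧ x) (⟦ ds ⟧ x) ⟩
    (c + x * ⟦ cs ⟧ x) * ⟦ ds ⟧ x                     ∎
    where
    open ≡-Reasoning
    rearrange : ∀ c x y z → c * z + x * (y * z) ≡ (c + x * y) * z
    rearrange = solve-∀

  toPolynomial : Bound → Polynomial
  toPolynomial (con c) = c ∷ []
  toPolynomial ♯       = 0 ∷ 1 ∷ []
  toPolynomial (p ⊕ q) = addPoly (toPolynomial p) (toPolynomial q)
  toPolynomial (p ⊗ q) = mulPoly (toPolynomial p) (toPolynomial q)

  ⟦toPolynomial⟧ : ∀ p x → ⟦ toPolynomial p ⟧ x ≡ val p x
  ⟦toPolynomial⟧ (con c) x = trans (cong (c +_) (*-zeroʳ x)) (+-identityʳ c)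
  ⟦toPolynomial⟧ ♯       x = trans (cong (λ y → x * suc y) (*-zeroʳ x)) (*-identityʳ x)
  ⟦toPolynomial⟧ (p ⊕ q) x = trans (⟦addPoly⟧ (toPolynomial p) _ x) (cong₂ _+_ (⟦toPolynomial⟧ p x) (⟦toPolynomial⟧ q x))
  ⟦toPolynomial⟧ (p ⊗ q) x = trans (⟦mulPoly⟧ (toPolynomial p) _ x) (cong₂ _*_ (⟦toPolynomial⟧ p x) (⟦toPolynomial⟧ q x))

  -- Programs with bounded running time

  Runs : ∀ {k} → Command k → Store k → Store k → ℕ → Set
  Runs c σ τ T = ∃[ t ] t ≤ T × (c ∣ σ ⇓[ t ] τ)

  run-≤ : ∀ {k} {c : Command k} {σ τ S T} → S ≤ T → Runs c σ τ S → Runs c σ τ T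
  run-≤ S≤T (t , t≤S , r) = t , ≤-trans t≤S S≤T , r

  run-assign : ∀ {k} {x : Fin k} {e σ} → Runs (x ≔ e) σ _ (suc (cost e))
  run-assign = _ , ≤-refl , assign

  infixr 4 _then_
  _then_ : ∀ {k} {c d : Command k} {σ τ υ S T} → Runs c σ τ S → Runs d τ υ T → Runs (c ⨟ d) σ υ (S + T)
  (_ , s≤ , r) then (_ , t≤ , r′) = _ , +-mono-≤ s≤ t≤ , seq r r′

  run-if-true : ∀ {k} {e} {c d : Command k} {σ τ T} → eval e σ ≢ nil → Runs c σ τ T →
    Runs (if e then c else d) σ τ (suc (cost e) + T)
  run-if-true e≢ (_ , t≤ , r) = _ , +-monoʳ-≤ _ t≤ , if-true e≢ r

  run-if-false : ∀ {k} {e} {c d : Command k} {σ τ T} → eval e σ ≡ nil → Runs d σ τ T →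
    Runs (if e then c else d) σ τ (suc (cost e) + T)
  run-if-false e≡ (_ , t≤ , r) = _ , +-monoʳ-≤ _ t≤ , if-false e≡ r

  run-while-true : ∀ {k} {e} {c : Command k} {σ τ υ S T} → eval e σ ≢ nil → Runs c σ τ S →
    Runs (while e loop c) τ υ T → Runs (while e loop c) σ υ (suc (cost e) + (S + T))
  run-while-true {e = e} e≢ (_ , s≤ , r) (_ , t≤ , r′) = _ , +-monoʳ-≤ (suc (cost e)) (+-mono-≤ s≤ t≤) , while-true e≢ r r′

  run-while-false : ∀ {k} {e} {c : Command k} {σ} → eval e σ ≡ nil → Runs (while e loop c) σ σ (suc (cost e))
  run-while-false e≡ = _ , ≤-refl , while-false e≡

  -- Encoded data and polynomial-time functions between them

  record Type : Set₁ where
    constructor type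
    field
      Val : Set
      enc : Val → Tree

  open Type public

  infixr 5 _⊠_
  _⊠_ : Type → Type → Type
  A ⊠ B = type (Val A × Val B) λ (a , b) → cons (enc A a) (enc B b)

  Listᵗ : Type → Type
  Listᵗ A = type (List (Val A)) (listᵗ (enc A))

  Boolᵗ : Type
  Boolᵗ = type Bool boolᵗ

  ∥_∥ : ∀ {A} → Val A → ℕ
  ∥_∥ {A} a = size (enc A a)

  -- The code works on two variables, the value and a stack, which it restores.
  -- The bound on the output is not implied by that on the time: cons x x
  -- doubles the size of a tree in constant time.
  record Poly (A B : Type) (f : Val A → Val B) : Set where
    field
      code  : Command 2
      time  : Bound
      out   : Bound
      runs  : ∀ a s → Runs code (enc A a ∷ s ∷ []) (enc B (f a) ∷ s ∷ []) (val time (∥_∥ {A} a))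
      small : ∀ a → ∥_∥ {B} (f a) ≤ val out (∥_∥ {A} a)

  open Poly

  pattern X = zero
  pattern S = suc zero

  x↓ s↓ : Expr 2
  x↓ = var X
  s↓ = var S

  exprₚ : ∀ {A B f} (e : Expr 2) (p : Bound) → (∀ a s → eval e (enc A a ∷ s ∷ []) ≡ enc B (f a)) →
    (∀ a → ∥_∥ {B} (f a) ≤ val p (∥_∥ {A} a)) → Poly A B f
  exprₚ {A} e p e≡ f≤ = record
    { code  = X ≔ e
    ; time  = con (suc (cost e))
    ; out   = p
    ; runs  = λ a s → subst (λ t → Runs (X ≔ e) (enc A a ∷ s ∷ []) (t ∷ s ∷ []) (suc (cost e))) (e≡ a s) run-assign
    ; small = f≤
    }

  -- The program stays the same and only its description changes, so code written as a fold can be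
  -- presented as computing its specification.
  castₚ : ∀ {A B f g} → (∀ a → f a ≡ g a) → Poly A B f → Poly A B g
  castₚ {A} {B} f≗g P = record
    { code  = code P
    ; time  = time P
    ; out   = out P
    ; runs  = λ a s → subst (λ b → Runs (code P) (enc A a ∷ s ∷ []) (enc B b ∷ s ∷ []) _) (f≗g a) (runs P a s)
    ; small = λ a → subst (λ b → ∥_∥ {B} b ≤ _) (f≗g a) (small P a)
    }

  -- If the two encodings coincide, the conversion costs a single assignment of the variable to
  -- itself.
  coerceₚ : ∀ {A B f} → (∀ a → enc A a ≡ enc B (f a)) → Poly A B f
  coerceₚ eq = exprₚ x↓ ♯ (λ a s → eq a) (λ a → ≤-reflexive (cong size (sym (eq a))))

  idₚ : ∀ {A} → Poly A A λ a → a
  idₚ = coerceₚ λ _ → refl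

  infixr 9 _∙_
  -- This is what `out` is for: the time of the second program is measured in the size of its input,
  -- the output of the first.
  _∙_ : ∀ {A B C g f} → Poly B C g → Poly A B f → Poly A C λ a → g (f a)
  _∙_ {A} Q P = record
    { code  = code P ⨟ code Q
    ; time  = time P ⊕ time Q ⟪ out P ⟫
    ; out   = out Q ⟪ out P ⟫
    ; runs  = λ a s → runs P a s then run-≤ (val-≤-⟪⟫ (time Q) (out P) _ (small P a)) (runs Q _ s)
    ; small = λ a → ≤-trans (small Q _) (val-≤-⟪⟫ (out Q) (out P) _ (small P a))
    }

  ⟨_,_⟩ : ∀ {A B C f g} → Poly A B f → Poly A C g → Poly A (B ⊠ C) λ a → f a , g a
  ⟨ P , Q ⟩ = record
    -- The input is saved on the stack. With only two variables, the result of `P` and the saved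
    -- input change places by being paired in `X`.
    { code  = S ≔ consᵉ x↓ s↓ ⨟ code P ⨟ X ≔ consᵉ x↓ (hdᵉ s↓) ⨟ S ≔ consᵉ (hdᵉ x↓) (tlᵉ s↓) ⨟ X ≔ tlᵉ x↓ ⨟
              code Q ⨟ X ≔ consᵉ (hdᵉ s↓) x↓ ⨟ S ≔ tlᵉ s↓
    ; time  = con 4 ⊕ (time P ⊕ (con 5 ⊕ (con 6 ⊕ (con 3 ⊕ (time Q ⊕ con 8)))))
    ; out   = con 1 ⊕ (out P ⊕ out Q)
    ; runs  = λ a s → run-assign then runs P a _ then run-assign then run-assign then run-assign then
                      runs Q a _ then run-assign then run-assign
    ; small = λ a → s≤s (+-mono-≤ (small P a) (small Q a))
    }

  fstₚ : ∀ {A B} → Poly (A ⊠ B) A proj₁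
  fstₚ = exprₚ (hdᵉ x↓) ♯ (λ _ _ → refl) λ _ → m≤n⇒m≤1+n (m≤m+n _ _)

  sndₚ : ∀ {A B} → Poly (A ⊠ B) B proj₂
  sndₚ = exprₚ (tlᵉ x↓) ♯ (λ _ _ → refl) λ _ → m≤n⇒m≤1+n (m≤n+m _ _)

  quoteᵉ : ∀ {k} → Tree → Expr k
  quoteᵉ nil        = nilᵉ
  quoteᵉ (cons s t) = consᵉ (quoteᵉ s) (quoteᵉ t)

  eval-quoteᵉ : ∀ {k} t (σ : Store k) → eval (quoteᵉ t) σ ≡ t
  eval-quoteᵉ nil        σ = refl
  eval-quoteᵉ (cons s t) σ = cong₂ cons (eval-quoteᵉ s σ) (eval-quoteᵉ t σ)

  constₚ : ∀ {A B} (b : Val B) → Poly A B λ _ → b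
  constₚ {B = B} b = exprₚ (quoteᵉ (enc B b)) (con (∥_∥ {B} b)) (λ _ _ → eval-quoteᵉ (enc B b) _) λ _ → ≤-refl

  ifₚ : ∀ {A B c f g} → Poly A Boolᵗ c → Poly A B f → Poly A B g → Poly A B λ a → ifᵇ c a then f a else g a
  ifₚ {A} {B} {c} {f} {g} C P Q = record
    { code  = S ≔ consᵉ x↓ s↓ ⨟ code C ⨟ X ≔ consᵉ x↓ (hdᵉ s↓) ⨟ S ≔ tlᵉ s↓ ⨟
              if hdᵉ x↓ then (X ≔ tlᵉ x↓ ⨟ code P) else (X ≔ tlᵉ x↓ ⨟ code Q)
    ; time  = con 4 ⊕ (time C ⊕ (con 5 ⊕ (con 3 ⊕ (con 3 ⊕ (con 3 ⊕ (time P ⊕ time Q))))))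
    ; out   = out P ⊕ out Q
    ; runs  = λ a s → run-assign then runs C a _ then run-assign then run-assign then branch a s (c a)
    ; small = λ a → bound a (c a)
    }
    where
    branch : ∀ a s b → Runs (if hdᵉ x↓ then (X ≔ tlᵉ x↓ ⨟ code P) else (X ≔ tlᵉ x↓ ⨟ code Q))
      (cons (boolᵗ b) (enc A a) ∷ s ∷ []) (enc B (ifᵇ b then f a else g a) ∷ s ∷ [])
      (3 + (3 + (val (time P) (∥_∥ {A} a) + val (time Q) (∥_∥ {A} a))))
    branch a s true  = run-if-true (λ ()) (run-assign then run-≤ (m≤m+n _ _) (runs P a s))
    branch a s false = run-if-false refl (run-assign then run-≤ (m≤n+m _ _) (runs Q a s))
    bound : ∀ a b → ∥_∥ {B} (ifᵇ b then f a else g a) ≤ val (out P ⊕ out Q) (∥_∥ {A} a)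
    bound a true  = ≤-trans (small P a) (m≤m+n _ _)
    bound a false = ≤-trans (small Q a) (m≤n+m _ _)

  nilₚ : ∀ {A B} → Poly A (Listᵗ B) λ _ → []
  nilₚ = constₚ []

  consₚ : ∀ {A B f g} → Poly A B f → Poly A (Listᵗ B) g → Poly A (Listᵗ B) λ a → f a ∷ g a
  consₚ {B = B} P Q = exprₚ {B ⊠ Listᵗ B} {Listᵗ B} {λ (x , xs) → x ∷ xs} x↓ ♯ (λ _ _ → refl) (λ _ → ≤-refl) ∙ ⟨ P , Q ⟩

  -- The context `z` is handed to both branches, as programs are closed and cannot refer to values
  -- outside their input.
  caseList : ∀ {X Y Z : Set} → (Z → Y) → (X × (List X × Z) → Y) → List X × Z → Y
  caseList n c ([]     , z) = n z
  caseList n c (x ∷ xs , z) = c (x , xs , z)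

  caseₚ : ∀ {A B C l n c} → Poly A (Listᵗ B) l → Poly A C n → Poly (B ⊠ (Listᵗ B ⊠ A)) C c →
    Poly A C λ a → caseList n c (l a , a)
  caseₚ {A} {B} {C} {l} {n} {c} L N K = switch ∙ ⟨ L , idₚ ⟩
    where
    switchCode : Command 2
    switchCode = if hdᵉ x↓ then (X ≔ consᵉ (hdᵉ (hdᵉ x↓)) (consᵉ (tlᵉ (hdᵉ x↓)) (tlᵉ x↓)) ⨟ code K) else (X ≔ tlᵉ x↓ ⨟ code N)
    shape : ∀ x y z → suc (suc (x + y) + z) ≡ suc (x + suc (y + z))
    shape x y z = cong suc (trans (cong suc (+-assoc x y z)) (sym (+-suc x (y + z))))
    switch : Poly (Listᵗ B ⊠ A) C (caseList n c)
    switch = record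
      { code  = switchCode
      ; time  = con 3 ⊕ (con 11 ⊕ (time N ⊕ time K))
      ; out   = out N ⊕ out K
      ; runs  = go
      ; small = bound
      }
      where
      go : ∀ a s → Runs switchCode _ _ _
      go ([] , a) s = run-if-false refl (run-≤ (+-mono-≤ {3} {11} (s≤s (s≤s (s≤s z≤n)))
        (≤-trans (val-mono (time N) (m≤n+m _ 2)) (m≤m+n _ _))) (run-assign then runs N a s))
      go (x ∷ xs , a) s = run-if-true (λ ()) (run-assign then run-≤
        (≤-trans (val-mono (time K) (≤-reflexive (sym (shape (∥_∥ {B} x) (∥_∥ {Listᵗ B} xs) (∥_∥ {A} a))))) (m≤n+m _ _))
        (runs K (x , xs , a) s))
      bound : ∀ a → ∥_∥ {C} (caseList n c a) ≤ val (out N ⊕ out K) (∥_∥ {Listᵗ B ⊠ A} a)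
      bound ([] , a)     = ≤-trans (small N a) (≤-trans (val-mono (out N) (m≤n+m _ 2)) (m≤m+n _ _))
      bound (x ∷ xs , a) = ≤-trans (small K (x , xs , a))
        (≤-trans (val-mono (out K) (≤-reflexive (sym (shape (∥_∥ {B} x) (∥_∥ {Listᵗ B} xs) (∥_∥ {A} a))))) (m≤n+m _ _))

  length≤∥∥ : ∀ {A} (xs : List (Val A)) → length xs ≤ ∥_∥ {Listᵗ A} xs
  length≤∥∥ []           = z≤n
  length≤∥∥ {A} (x ∷ xs) = s≤s (≤-trans (length≤∥∥ {A} xs) (m≤n+m _ _))

  ∥++∥ʳ : ∀ {A} (xs ys : List (Val A)) → ∥_∥ {Listᵗ A} ys ≤ ∥_∥ {Listᵗ A} (xs ++ ys)
  ∥++∥ʳ []           ys = ≤-refl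
  ∥++∥ʳ {A} (x ∷ xs) ys = m≤n⇒m≤1+n (≤-trans (∥++∥ʳ {A} xs ys) (m≤n+m _ _))

  -- `bounded` ranges over the prefixes `ys` of the list, that is, over all intermediate
  -- accumulators. A bound on a single step would not do, since its iteration can be exponential.
  module _ {A B E : Type} {i : Val A → Val B} {l : Val A → List (Val E)} {f : Val B × (Val E × Val A) → Val B}
    (I : Poly A B i) (L : Poly A (Listᵗ E) l) (F : Poly (B ⊠ (E ⊠ A)) B f)
    (p : Bound) (bounded : ∀ a ys zs → l a ≡ ys ++ zs → ∥_∥ {B} (foldl (λ b e → f (b , e , a)) (i a) ys) ≤ val p (∥_∥ {A} a)) where

    private
      -- The accumulator is in `X`; on top of the stack lies the rest of the list, paired with the
      -- context `a`.
      bodyCode loopCode : Command 2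
      bodyCode = X ≔ consᵉ x↓ (consᵉ (hdᵉ (hdᵉ (hdᵉ s↓))) (tlᵉ (hdᵉ s↓))) ⨟
                 S ≔ consᵉ (consᵉ (tlᵉ (hdᵉ (hdᵉ s↓))) (tlᵉ (hdᵉ s↓))) (tlᵉ s↓) ⨟
                 code F
      loopCode = while hdᵉ (hdᵉ s↓) loop bodyCode

      stepIn stepTime : Bound
      stepIn   = con 1 ⊕ (p ⊕ (con 1 ⊕ (out L ⊕ ♯)))
      stepTime = con 4 ⊕ (con 11 ⊕ (con 12 ⊕ time F ⟪ stepIn ⟫))

      iter : ∀ a ys zs s → l a ≡ ys ++ zs →
        Runs loopCode (enc B (foldl (λ b e → f (b , e , a)) (i a) ys) ∷ cons (cons (enc (Listᵗ E) zs) (enc A a)) s ∷ [])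
                      (enc B (foldl (λ b e → f (b , e , a)) (i a) (l a)) ∷ cons (cons nil (enc A a)) s ∷ [])
                      (length zs * val stepTime (∥_∥ {A} a) + 4)
      iter a ys []       s eq rewrite trans eq (++-identityʳ ys) = run-while-false refl
      iter a ys (z ∷ zs) s eq = run-≤ shape (run-while-true (λ ()) (run-assign then run-assign then run-≤ smallStep (runs F (b , z , a) _)) next)
        where
        b = foldl (λ b e → f (b , e , a)) (i a) ys
        n = ∥_∥ {A} a
        smallIn : ∥_∥ {B ⊠ (E ⊠ A)} (b , z , a) ≤ val stepIn n
        smallIn = s≤s (+-mono-≤ (bounded a ys (z ∷ zs) eq) (s≤s (+-monoˡ-≤ _
          (≤-trans (≤-trans (m≤n⇒m≤1+n (m≤m+n _ _)) (≤-trans (∥++∥ʳ {E} ys (z ∷ zs)) (≤-reflexive (cong (∥_∥ {Listᵗ E}) (sym eq))))) (small L a)))))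
        smallStep : val (time F) (∥_∥ {B ⊠ (E ⊠ A)} (b , z , a)) ≤ val (time F ⟪ stepIn ⟫) n
        smallStep = val-≤-⟪⟫ (time F) stepIn n smallIn
        next : Runs loopCode (enc B (f (b , z , a)) ∷ cons (cons (enc (Listᵗ E) zs) (enc A a)) s ∷ []) _ (length zs * val stepTime n + 4)
        next = subst (λ c → Runs loopCode (enc B c ∷ cons (cons (enc (Listᵗ E) zs) (enc A a)) s ∷ []) _ (length zs * val stepTime n + 4))
          (foldl-++ (λ b e → f (b , e , a)) (i a) ys (z ∷ []))
          (iter a (ys ++ z ∷ []) zs s (trans eq (sym (++-assoc ys (z ∷ []) zs))))
        rearrange : ∀ t k → 4 + (11 + (12 + t) + (k + 4)) ≡ 4 + (11 + (12 + t)) + k + 4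
        rearrange = solve-∀
        shape : 4 + (11 + (12 + val (time F ⟪ stepIn ⟫) n) + (length zs * val stepTime n + 4)) ≤ val stepTime n + length zs * val stepTime n + 4
        shape = ≤-reflexive (rearrange (val (time F ⟪ stepIn ⟫) n) (length zs * val stepTime n))

    foldlₚ : Poly A B λ a → foldl (λ b e → f (b , e , a)) (i a) (l a)
    foldlₚ = record
      { code  = S ≔ consᵉ x↓ s↓ ⨟ code L ⨟ X ≔ consᵉ x↓ (hdᵉ s↓) ⨟ S ≔ consᵉ x↓ (tlᵉ s↓) ⨟ X ≔ tlᵉ x↓ ⨟
                code I ⨟ loopCode ⨟ S ≔ tlᵉ s↓
      ; time  = con 4 ⊕ (time L ⊕ (con 5 ⊕ (con 5 ⊕ (con 3 ⊕ (time I ⊕ ((out L ⊗ stepTime ⊕ con 4) ⊕ con 3))))))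
      ; out   = p
      ; runs  = λ a s → run-assign then runs L a _ then run-assign then run-assign then run-assign then runs I a _ then
                        run-≤ (+-monoˡ-≤ 4 (*-monoˡ-≤ (val stepTime (∥_∥ {A} a)) (≤-trans (length≤∥∥ {E} (l a)) (small L a))))
                              (iter a [] (l a) s refl) then
                        run-assign
      ; small = λ a → bounded a (l a) [] (sym (++-identityʳ (l a)))
      }

  ∥++∥ˡ : ∀ {A} (xs ys : List (Val A)) → ∥_∥ {Listᵗ A} xs ≤ ∥_∥ {Listᵗ A} (xs ++ ys)
  ∥++∥ˡ []           []       = ≤-refl
  ∥++∥ˡ []           (y ∷ ys) = s≤s z≤n
  ∥++∥ˡ {A} (x ∷ xs) ys       = s≤s (+-monoʳ-≤ (∥_∥ {A} x) (∥++∥ˡ {A} xs ys))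

  ∥reverse∥ : ∀ {A} (xs ys : List (Val A)) → suc (∥_∥ {Listᵗ A} (foldl (flip _∷_) xs ys)) ≡ ∥_∥ {Listᵗ A} xs + ∥_∥ {Listᵗ A} ys
  ∥reverse∥ xs []           = sym (+-comm _ 1)
  ∥reverse∥ {A} xs (y ∷ ys) = trans (∥reverse∥ {A} (y ∷ xs) ys) (move (∥_∥ {A} y) (∥_∥ {Listᵗ A} xs) (∥_∥ {Listᵗ A} ys))
    where
    move : ∀ y m n → suc (y + m) + n ≡ m + suc (y + n)
    move y m n = trans (cong suc (trans (cong (_+ n) (+-comm y m)) (+-assoc m y n))) (sym (+-suc m (y + n)))

  reverseₚ : ∀ {A E l} → Poly A (Listᵗ E) l → Poly A (Listᵗ E) λ a → reverse (l a)
  reverseₚ {A} {E} {l} L = foldlₚ {A} {Listᵗ E} {E} {f = λ (es , e , _) → e ∷ es} nilₚ L (consₚ (fstₚ ∙ sndₚ) fstₚ) (out L) bounded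
    where
    bounded : ∀ a ys zs → l a ≡ ys ++ zs → ∥_∥ {Listᵗ E} (foldl (flip _∷_) [] ys) ≤ val (out L) (∥_∥ {A} a)
    bounded a ys zs eq = ≤-trans (≤-reflexive (suc-injective (∥reverse∥ {E} [] ys)))
      (≤-trans (∥++∥ˡ {E} ys zs) (≤-trans (≤-reflexive (cong (∥_∥ {Listᵗ E}) (sym eq))) (small L a)))

  -- A loop consumes a list from its head, so a right fold is run as a left fold over the reversed
  -- list.
  foldr-reverse : ∀ {X Y : Set} (f : X → Y → Y) y xs → foldl (flip f) y (reverse xs) ≡ foldr f y xs
  foldr-reverse f y xs = trans (sym (reverse-foldr f y (reverse xs))) (cong (foldr f y) (reverse-involutive xs))

  foldrₚ : ∀ {A B E i l f} → Poly A B i → Poly A (Listᵗ E) l → Poly (B ⊠ (E ⊠ A)) B f → (p : Bound) →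
    (∀ a ys zs → l a ≡ ys ++ zs → ∥_∥ {B} (foldr (λ e b → f (b , e , a)) (i a) zs) ≤ val p (∥_∥ {A} a)) →
    Poly A B λ a → foldr (λ e b → f (b , e , a)) (i a) (l a)
  foldrₚ {A} {B} {E} {i} {l} {f} I L F p bounded =
    castₚ (λ a → foldr-reverse _ (i a) (l a)) (foldlₚ I (reverseₚ L) F p bounded′)
    where
    bounded′ : ∀ a ys zs → reverse (l a) ≡ ys ++ zs → ∥_∥ {B} (foldl (λ b e → f (b , e , a)) (i a) ys) ≤ val p (∥_∥ {A} a)
    bounded′ a ys zs eq = subst (λ b → ∥_∥ {B} b ≤ _) (reverse-foldr _ (i a) ys)
      (bounded a (reverse zs) (reverse ys) (trans (sym (reverse-involutive (l a))) (trans (cong reverse eq) (reverse-++ ys zs))))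

  ∥map∥ : ∀ {E F K M} (f : Val E → Val F) → (∀ e → ∥_∥ {E} e ≤ K → ∥_∥ {F} (f e) ≤ M) →
    ∀ es → ∥_∥ {Listᵗ E} es ≤ K → ∥_∥ {Listᵗ F} (map f es) ≤ suc (length es * suc M)
  ∥map∥ f f≤ [] es≤ = s≤s z≤n
  ∥map∥ {E} {F} {K} {M} f f≤ (e ∷ es) es≤ = s≤s (≤-trans
    (+-mono-≤ (f≤ e (≤-trans (m≤n⇒m≤1+n (m≤m+n _ _)) es≤)) (∥map∥ {E} {F} f f≤ es (≤-trans (m≤n⇒m≤1+n (m≤n+m _ _)) es≤)))
    (≤-reflexive (+-suc M (length es * suc M))))

  map-as-foldr : ∀ {X Y : Set} (f : X → Y) xs → foldr (λ x ys → f x ∷ ys) [] xs ≡ map f xs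
  map-as-foldr f []       = refl
  map-as-foldr f (x ∷ xs) = cong (f x ∷_) (map-as-foldr f xs)

  mapₚ : ∀ {A E F l f} → Poly A (Listᵗ E) l → Poly (E ⊠ A) F f → Poly A (Listᵗ F) λ a → map (λ e → f (e , a)) (l a)
  mapₚ {A} {E} {F} {l} {f} L P = castₚ (λ a → map-as-foldr (λ e → f (e , a)) (l a))
    (foldrₚ {A} {Listᵗ F} {E} {f = λ (fs , e , a) → f (e , a) ∷ fs} nilₚ L
      (consₚ (P ∙ sndₚ) fstₚ) (con 1 ⊕ out L ⊗ (con 1 ⊕ elem)) bounded)
    where
    elem : Bound
    elem = out P ⟪ con 1 ⊕ (out L ⊕ ♯) ⟫
    bounded : ∀ a ys zs → l a ≡ ys ++ zs →
      ∥_∥ {Listᵗ F} (foldr (λ e fs → f (e , a) ∷ fs) [] zs) ≤ val (con 1 ⊕ out L ⊗ (con 1 ⊕ elem)) (∥_∥ {A} a)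
    bounded a ys zs eq = subst (λ fs → ∥_∥ {Listᵗ F} fs ≤ _) (sym (map-as-foldr (λ e → f (e , a)) zs))
      (≤-trans (∥map∥ {E} {F} (λ e → f (e , a)) elem≤ zs zs≤)
        (s≤s (*-monoˡ-≤ (suc (val elem (∥_∥ {A} a))) (≤-trans (length≤∥∥ {E} zs) zs≤))))
      where
      zs≤ : ∥_∥ {Listᵗ E} zs ≤ val (out L) (∥_∥ {A} a)
      zs≤ = ≤-trans (∥++∥ʳ {E} ys zs) (≤-trans (≤-reflexive (cong (∥_∥ {Listᵗ E}) (sym eq))) (small L a))
      elem≤ : ∀ e → ∥_∥ {E} e ≤ val (out L) (∥_∥ {A} a) → ∥_∥ {F} (f (e , a)) ≤ val elem (∥_∥ {A} a)
      elem≤ e e≤ = ≤-trans (small P (e , a)) (val-≤-⟪⟫ (out P) (con 1 ⊕ (out L ⊕ ♯)) _ (s≤s (+-monoˡ-≤ _ e≤)))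

  module _ {X Y : Set} (next : Y → Y) where

    -- Recursion on `xs` during which a second argument moves along by `next`. Recursion on two
    -- lists at once, as in `zip`, addition, subtraction and comparison, has this form, with `next`
    -- dropping a head.
    rec : ∀ {Z : Set} → (Y → Z) → ((X × Y) × Z → Z) → List X → Y → Z
    rec base step []       y = base y
    rec base step (x ∷ xs) y = step ((x , y) , rec base step xs (next y))

    trace : List X → Y → List (X × Y)
    trace []       y = []
    trace (x ∷ xs) y = (x , y) ∷ trace xs (next y)

    final : List X → Y → Y
    final []       y = y
    final (x ∷ xs) y = final xs (next y)

    push : List (X × Y) × Y → X → List (X × Y) × Y
    push (st , y) x = (x , y) ∷ st , next y

    foldl-push : ∀ st y xs → foldl push (st , y) xs ≡ (foldl (flip _∷_) st (trace xs y) , final xs y)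
    foldl-push st y []       = refl
    foldl-push st y (x ∷ xs) = foldl-push ((x , y) ∷ st) (next y) xs

    -- Once every element is paired with the value of `y` that it meets, the recursion is an
    -- ordinary right fold.
    foldr-trace : ∀ {Z : Set} (base : Y → Z) step xs y → foldr (λ xy z → step (xy , z)) (base (final xs y)) (trace xs y) ≡ rec base step xs y
    foldr-trace base step []       y = refl
    foldr-trace base step (x ∷ xs) y = cong (λ z → step ((x , y) , z)) (foldr-trace base step xs (next y))

  module _ {E S B : Type} {next : Val S → Val S} {base : Val S → Val B} {step : (Val E × Val S) × Val B → Val B}
    (Next : Poly S S next) (next≤ : ∀ s → ∥_∥ {S} (next s) ≤ ∥_∥ {S} s)
    (Base : Poly S B base) (Step : Poly ((E ⊠ S) ⊠ B) B step) (p : Bound)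
    (bounded : ∀ es s → ∥_∥ {B} (rec next base step es s) ≤ val p (∥_∥ {Listᵗ E ⊠ S} (es , s))) where

    private
      Stack : Type
      Stack = Listᵗ (E ⊠ S) ⊠ S

      -- Quadratic: the trace has at most as many entries as the input is large, and no entry is
      -- larger than the input, because `next` never enlarges the state.
      stackBound : Bound
      stackBound = con 2 ⊕ (♯ ⊗ (con 2 ⊕ ♯) ⊕ ♯)

      ∥trace∥ : ∀ n es s → ∥_∥ {Listᵗ E} es + ∥_∥ {S} s ≤ n → ∥_∥ {Listᵗ (E ⊠ S)} (trace next es s) ≤ suc (length es * (2 + n))
      ∥trace∥ n []       s es≤ = s≤s z≤n
      ∥trace∥ n (e ∷ es) s es≤ = s≤s (≤-trans
        (+-mono-≤ {suc (∥_∥ {E} e + ∥_∥ {S} s)}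
          (s≤s (≤-trans (+-monoˡ-≤ (∥_∥ {S} s) (m≤n⇒m≤1+n (m≤m+n (∥_∥ {E} e) _))) es≤))
          (∥trace∥ n es (next s) (≤-trans (+-mono-≤ (m≤n⇒m≤1+n (m≤n+m _ _)) (next≤ s)) es≤)))
        (≤-reflexive (+-suc (suc n) (length es * (2 + n)))))

      ∥final∥ : ∀ es s → ∥_∥ {S} (final {Val E} next es s) ≤ ∥_∥ {S} s
      ∥final∥ []       s = ≤-refl
      ∥final∥ (e ∷ es) s = ≤-trans (∥final∥ es (next s)) (next≤ s)

      descend : Poly (Listᵗ E ⊠ S) Stack λ (es , s) → foldl (push next) ([] , s) es
      descend = foldlₚ {Listᵗ E ⊠ S} {Stack} {E} {f = λ (st , e , _) → push next st e}
        ⟨ nilₚ , sndₚ ⟩ fstₚ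
        ⟨ consₚ ⟨ fstₚ ∙ sndₚ , sndₚ ∙ fstₚ ⟩ (fstₚ ∙ fstₚ) , Next ∙ sndₚ ∙ fstₚ ⟩
        stackBound stack≤
        where
        stack≤ : ∀ a ys zs → proj₁ a ≡ ys ++ zs → ∥_∥ {Stack} (foldl (push next) ([] , proj₂ a) ys) ≤ val stackBound (∥_∥ {Listᵗ E ⊠ S} a)
        stack≤ (es , s) ys zs refl rewrite foldl-push next [] s ys = s≤s (+-mono-≤
          (≤-trans (≤-reflexive (suc-injective (∥reverse∥ {E ⊠ S} [] (trace next ys s))))
            (≤-trans (∥trace∥ n ys s (m≤n⇒m≤1+n (+-monoˡ-≤ _ (∥++∥ˡ {E} ys zs))))
              (s≤s (*-monoˡ-≤ (2 + n) (≤-trans (length≤∥∥ {E} ys) (≤-trans (∥++∥ˡ {E} ys zs) (m≤n⇒m≤1+n (m≤m+n _ _))))))))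
          (≤-trans (∥final∥ ys s) (m≤n⇒m≤1+n (m≤n+m _ _))))
          where n = ∥_∥ {Listᵗ E ⊠ S} (ys ++ zs , s)

      -- `foldrₚ` asks for a bound on the folds over all suffixes of the trace. Each of them is
      -- again a value of `rec`, at arguments no larger than the original ones.
      suffix : ∀ es s ys zs → trace next es s ≡ ys ++ zs →
        ∃[ es′ ] ∃[ s′ ] ∥_∥ {Listᵗ E} es′ ≤ ∥_∥ {Listᵗ E} es × ∥_∥ {S} s′ ≤ ∥_∥ {S} s ×
          foldr (λ es b → step (es , b)) (base (final next es s)) zs ≡ rec next base step es′ s′
      suffix es       s []       zs refl = es , s , ≤-refl , ≤-refl , foldr-trace next base step es s
      suffix (e ∷ es) s (y ∷ ys) zs eq with suffix es (next s) ys zs (∷-injectiveʳ eq)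
      ... | es′ , s′ , es≤ , s≤ , eq′ = es′ , s′ , ≤-trans es≤ (m≤n⇒m≤1+n (m≤n+m _ _)) , ≤-trans s≤ (next≤ s) , eq′

    recₚ : Poly (Listᵗ E ⊠ S) B λ (es , s) → rec next base step es s
    recₚ = castₚ (λ (es , s) → foldr-trace next base step es s)
      (foldrₚ {Listᵗ E ⊠ S} {B} {E ⊠ S} {f = λ (b , es , _) → step (es , b)}
        (castₚ (λ (es , s) → cong (λ t → base (proj₂ t)) (foldl-push next [] s es)) (Base ∙ sndₚ ∙ descend))
        (castₚ (λ (es , s) → trans (cong (λ t → reverse (proj₁ t)) (foldl-push next [] s es)) (reverse-involutive (trace next es s))) (reverseₚ (fstₚ ∙ descend)))
        (Step ∙ ⟨ fstₚ ∙ sndₚ , fstₚ ⟩) p rec≤)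
      where
      rec≤ : ∀ a ys zs → trace next (proj₁ a) (proj₂ a) ≡ ys ++ zs →
        ∥_∥ {B} (foldr (λ es b → step (es , b)) (base (final next (proj₁ a) (proj₂ a))) zs) ≤ val p (∥_∥ {Listᵗ E ⊠ S} a)
      rec≤ (es , s) ys zs eq with suffix es s ys zs eq
      ... | es′ , s′ , es≤ , s≤ , eq′ = ≤-trans (≤-reflexive (cong (∥_∥ {B}) eq′))
        (≤-trans (bounded es′ s′) (val-mono p (s≤s (+-mono-≤ es≤ s≤))))

  dropHead : ∀ {X : Set} → List X → List X
  dropHead []       = []
  dropHead (x ∷ xs) = xs

  ∥dropHead∥ : ∀ {E} (es : List (Val E)) → ∥_∥ {Listᵗ E} (dropHead es) ≤ ∥_∥ {Listᵗ E} es
  ∥dropHead∥ []       = ≤-refl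
  ∥dropHead∥ (e ∷ es) = m≤n⇒m≤1+n (m≤n+m _ _)

  dropHeadₚ : ∀ {E} → Poly (Listᵗ E) (Listᵗ E) dropHead
  dropHeadₚ {E} = exprₚ (tlᵉ (var zero)) ♯ (λ { [] _ → refl ; (x ∷ xs) _ → refl }) (∥dropHead∥ {E})

  zipₚ : ∀ {A E F l k} → Poly A (Listᵗ E) l → Poly A (Listᵗ F) k → Poly A (Listᵗ (E ⊠ F)) λ a → zip (l a) (k a)
  zipₚ {A} {E} {F} L K = castₚ (λ _ → rec≡zip _ _)
    (recₚ {E} {Listᵗ F} {Listᵗ (E ⊠ F)} {step = step} dropHeadₚ (∥dropHead∥ {F}) nilₚ
      (caseₚ {(E ⊠ Listᵗ F) ⊠ Listᵗ (E ⊠ F)} {F} {Listᵗ (E ⊠ F)} {c = cons-step} (sndₚ ∙ fstₚ) nilₚ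
        (consₚ ⟨ fstₚ ∙ fstₚ ∙ sndₚ ∙ sndₚ , fstₚ ⟩ (sndₚ ∙ sndₚ ∙ sndₚ)))
      ♯ (λ es fs → subst (λ x → ∥_∥ {Listᵗ (E ⊠ F)} x ≤ _) (sym (rec≡zip es fs)) (m≤n⇒m≤1+n (∥zip∥ es fs))) ∙ ⟨ L , K ⟩)
    where
    Ctx : Set
    Ctx = (Val E × List (Val F)) × List (Val E × Val F)
    cons-step : Val F × (List (Val F) × Ctx) → List (Val E × Val F)
    cons-step (y , _ , (x , _) , r) = (x , y) ∷ r
    step : Ctx → List (Val E × Val F)
    step c = caseList (λ _ → []) cons-step (proj₂ (proj₁ c) , c)
    rec≡zip : ∀ es fs → rec dropHead (λ _ → []) step es fs ≡ zip es fs
    rec≡zip []       fs       = refl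
    rec≡zip (e ∷ es) []       = refl
    rec≡zip (e ∷ es) (f ∷ fs) = cong ((e , f) ∷_) (rec≡zip es fs)
    rearrange : ∀ x y m n → suc (x + y) + (m + n) ≡ x + m + suc (y + n)
    rearrange = λ x y m n → trans (cong suc (shuffle x y m n)) (sym (+-suc (x + m) (y + n)))
      where
      shuffle : ∀ x y m n → x + y + (m + n) ≡ x + m + (y + n)
      shuffle = solve-∀
    ∥zip∥ : ∀ es fs → ∥_∥ {Listᵗ (E ⊠ F)} (zip es fs) ≤ ∥_∥ {Listᵗ E} es + ∥_∥ {Listᵗ F} fs
    ∥zip∥ []       fs       = s≤s z≤n
    ∥zip∥ (e ∷ es) []       = s≤s z≤n
    ∥zip∥ (e ∷ es) (f ∷ fs) = s≤s (≤-trans (+-monoʳ-≤ _ (∥zip∥ es fs)) (≤-reflexive (rearrange (∥_∥ {E} e) (∥_∥ {F} f) _ _)))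

  -- For functions that have their own recursion equations: these are passed as `eqs`, and the bound
  -- is stated for `h` on suffixes instead of for a fold.
  listRecₚ : ∀ {A B E l} {h : List (Val E) → Val A → Val B} {st : Val B × (Val E × Val A) → Val B} → Poly A (Listᵗ E) l → Poly A B (λ a → h [] a) → Poly (B ⊠ (E ⊠ A)) B st →
    (∀ e es a → h (e ∷ es) a ≡ st (h es a , e , a)) → (p : Bound) →
    (∀ a ys zs → l a ≡ ys ++ zs → ∥_∥ {B} (h zs a) ≤ val p (∥_∥ {A} a)) →
    Poly A B λ a → h (l a) a
  listRecₚ {A} {B} {E} {l} {h} {st} L N C eqs p bounded = castₚ (λ a → h≡ a (l a))
    (foldrₚ N L C p λ a ys zs eq → subst (λ b → ∥_∥ {B} b ≤ _) (sym (h≡ a zs)) (bounded a ys zs eq))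
    where
    h≡ : ∀ a es → foldr (λ e b → st (b , e , a)) (h [] a) es ≡ h es a
    h≡ a []       = refl
    h≡ a (e ∷ es) = trans (cong (λ b → st (b , e , a)) (h≡ a es)) (sym (eqs e es a))

  -- Binary numbers as lists of digits

  ℕᵗ : Type
  ℕᵗ = type ℕ binaryᵗ

  Digitsᵗ : Type
  Digitsᵗ = Listᵗ Boolᵗ

  -- `true` is the digit 1 and `false` the digit 2 of bijective base 2. With this choice the
  -- encoding of a number is literally that of its list of digits, so passing between the two is
  -- free up to one assignment.
  undigits : List Bool → ℕ
  undigits []           = 0
  undigits (true  ∷ ds) = suc (2 * undigits ds)
  undigits (false ∷ ds) = 2 * suc (undigits ds)

  private
    fromDigits : List Bool → ℕᵇ
    fromDigits []           = zero
    fromDigits (true  ∷ ds) = 1+[2 fromDigits ds ]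
    fromDigits (false ∷ ds) = 2[1+ fromDigits ds ]

    toDigits : ℕᵇ → List Bool
    toDigits zero     = []
    toDigits 2[1+ x ] = false ∷ toDigits x
    toDigits 1+[2 x ] = true ∷ toDigits x

    toℕ-fromDigits : ∀ ds → toℕᵇ (fromDigits ds) ≡ undigits ds
    toℕ-fromDigits []           = refl
    toℕ-fromDigits (true  ∷ ds) = cong (λ n → suc (2 * n)) (toℕ-fromDigits ds)
    toℕ-fromDigits (false ∷ ds) = cong (λ n → 2 * suc n) (toℕ-fromDigits ds)

    fromDigits-toDigits : ∀ x → fromDigits (toDigits x) ≡ x
    fromDigits-toDigits zero     = refl
    fromDigits-toDigits 2[1+ x ] = cong 2[1+_] (fromDigits-toDigits x)
    fromDigits-toDigits 1+[2 x ] = cong 1+[2_] (fromDigits-toDigits x)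

    ℕᵇᵗ-fromDigits : ∀ ds → ℕᵇᵗ (fromDigits ds) ≡ listᵗ boolᵗ ds
    ℕᵇᵗ-fromDigits []           = refl
    ℕᵇᵗ-fromDigits (true  ∷ ds) = cong (cons (cons nil nil)) (ℕᵇᵗ-fromDigits ds)
    ℕᵇᵗ-fromDigits (false ∷ ds) = cong (cons nil) (ℕᵇᵗ-fromDigits ds)

  digits : ℕ → List Bool
  digits n = toDigits (fromℕ n)

  undigits-digits : ∀ n → undigits (digits n) ≡ n
  undigits-digits n = trans (sym (toℕ-fromDigits (digits n)))
    (trans (cong toℕᵇ (fromDigits-toDigits (fromℕ n))) (toℕ-fromℕ n))

  enc-undigits : ∀ ds → binaryᵗ (undigits ds) ≡ listᵗ boolᵗ ds
  enc-undigits ds = trans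
    (cong ℕᵇᵗ (toℕ-injective (trans (toℕ-fromℕ (undigits ds)) (sym (toℕ-fromDigits ds)))))
    (ℕᵇᵗ-fromDigits ds)

  enc-digits : ∀ n → binaryᵗ n ≡ listᵗ boolᵗ (digits n)
  enc-digits n = trans (cong binaryᵗ (sym (undigits-digits n))) (enc-undigits (digits n))

  digitsₚ : ∀ {A f} → Poly A ℕᵗ f → Poly A Digitsᵗ λ a → digits (f a)
  digitsₚ P = coerceₚ {ℕᵗ} {Digitsᵗ} {digits} enc-digits ∙ P

  undigitsₚ : Poly Digitsᵗ ℕᵗ undigits
  undigitsₚ = coerceₚ λ ds → sym (enc-undigits ds)

  oddₚ : ∀ {A f} → Poly A ℕᵗ f → Poly A ℕᵗ λ a → suc (2 * f a)
  oddₚ {f = f} P = castₚ (λ a → cong (λ n → suc (2 * n)) (undigits-digits (f a))) (undigitsₚ ∙ consₚ (constₚ true) (digitsₚ P))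

  evenₚ : ∀ {A f} → Poly A ℕᵗ f → Poly A ℕᵗ λ a → 2 * suc (f a)
  evenₚ {f = f} P = castₚ (λ a → cong (λ n → 2 * suc n) (undigits-digits (f a))) (undigitsₚ ∙ consₚ (constₚ false) (digitsₚ P))

  -- Size of a number versus its logarithm

  undigits-< : ∀ ds → undigits ds < 2 ^ ∥_∥ {Digitsᵗ} ds
  undigits-< []           = s≤s z≤n
  undigits-< (true ∷ ds)  = begin
    suc (suc (2 * undigits ds))     ≡⟨ sym (*-suc 2 (undigits ds)) ⟩
    2 * suc (undigits ds)           ≤⟨ *-monoʳ-≤ 2 (undigits-< ds) ⟩
    2 ^ suc (∥_∥ {Digitsᵗ} ds)      ≤⟨ ^-monoʳ-≤ 2 (m≤n+m (suc (∥_∥ {Digitsᵗ} ds)) 3) ⟩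
    2 ^ ∥_∥ {Digitsᵗ} (true ∷ ds)   ∎
    where open ≤-Reasoning
  undigits-< (false ∷ ds) = begin
    suc (2 * suc (undigits ds))                         ≤⟨ +-mono-≤ (s≤s (z≤n {undigits ds + 1 * suc (undigits ds)})) (≤-refl {2 * suc (undigits ds)}) ⟩
    2 * suc (undigits ds) + 2 * suc (undigits ds)       ≡⟨ cong (2 * suc (undigits ds) +_) (sym (+-identityʳ _)) ⟩
    2 * (2 * suc (undigits ds))                         ≤⟨ *-monoʳ-≤ 2 (*-monoʳ-≤ 2 (undigits-< ds)) ⟩
    2 ^ ∥_∥ {Digitsᵗ} (false ∷ ds)                      ∎
    where open ≤-Reasoning

  2^length≤ : ∀ ds → 2 ^ length ds ≤ suc (undigits ds)
  2^length≤ []           = ≤-refl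
  2^length≤ (true ∷ ds)  = ≤-trans (*-monoʳ-≤ 2 (2^length≤ ds)) (≤-reflexive (*-suc 2 (undigits ds)))
  2^length≤ (false ∷ ds) = m≤n⇒m≤1+n (*-monoʳ-≤ 2 (2^length≤ ds))

  ∥digits∥≤ : ∀ ds → ∥_∥ {Digitsᵗ} ds ≤ 1 + length ds * 4
  ∥digits∥≤ []           = ≤-refl
  ∥digits∥≤ (true ∷ ds)  = +-monoʳ-≤ 4 (∥digits∥≤ ds)
  ∥digits∥≤ (false ∷ ds) = ≤-trans (+-monoʳ-≤ 2 (∥digits∥≤ ds)) (m≤n+m _ 2)

  n<2^∥n∥ : ∀ n → n < 2 ^ ∥_∥ {ℕᵗ} n
  n<2^∥n∥ n = subst₂ (λ m s → m < 2 ^ s) (undigits-digits n) (cong size (sym (enc-digits n))) (undigits-< (digits n))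

  logBound : Bound → Bound
  logBound p = con 1 ⊕ p ⊗ con 4

  -- A number below `2 ^ L` has at most `L` digits, and a digit with its list cell has size at most
  -- 4. Sizes of results are bounded through estimates `< 2 ^ L`, which combine well under sums and
  -- products.
  ∥n∥≤ : ∀ {n} L → n < 2 ^ L → ∥_∥ {ℕᵗ} n ≤ 1 + L * 4
  ∥n∥≤ {n} L n<2^L = ≤-trans (≤-reflexive (cong size (enc-digits n)))
    (≤-trans (∥digits∥≤ (digits n)) (s≤s (*-monoˡ-≤ 4 length≤)))
    where
    length≤ : length (digits n) ≤ L
    length≤ = ≮⇒≥ λ L<len → <⇒≱ (^-monoʳ-< 2 (s≤s (s≤s z≤n)) L<len)
      (≤-trans (2^length≤ (digits n)) (subst (λ m → suc m ≤ 2 ^ L) (sym (undigits-digits n)) n<2^L))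

  <2^-mono : ∀ {m} K L → K ≤ L → m < 2 ^ K → m < 2 ^ L
  <2^-mono K L K≤L m< = ≤-trans m< (^-monoʳ-≤ 2 K≤L)

  *-<2^ : ∀ {m n} K L → m < 2 ^ K → n < 2 ^ L → m * n < 2 ^ (K + L)
  *-<2^ {m} {n} K L m< n< = begin-strict
    m * n         ≤⟨ *-monoˡ-≤ n (<⇒≤ m<) ⟩
    2 ^ K * n     <⟨ *-monoʳ-< (2 ^ K) {{m^n≢0 2 K}} n< ⟩
    2 ^ K * 2 ^ L ≡⟨ sym (^-distribˡ-+-* 2 K L) ⟩
    2 ^ (K + L)   ∎
    where open ≤-Reasoning

  +-<2^ : ∀ {m n} K L → m < 2 ^ K → n < 2 ^ L → m + n < 2 ^ suc (K + L)
  +-<2^ {m} {n} K L m< n< = begin-strict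
    m + n                         <⟨ +-mono-< m< n< ⟩
    2 ^ K + 2 ^ L                 ≤⟨ +-mono-≤ (^-monoʳ-≤ 2 (m≤m+n K L)) (^-monoʳ-≤ 2 (m≤n+m L K)) ⟩
    2 ^ (K + L) + 2 ^ (K + L)     ≡⟨ cong (2 ^ (K + L) +_) (sym (+-identityʳ _)) ⟩
    2 ^ suc (K + L)               ∎
    where open ≤-Reasoning

  suc-<2^ : ∀ {n} L → n < 2 ^ L → suc n < 2 ^ suc L
  suc-<2^ {n} L n< = begin-strict
    suc n             <⟨ s≤s (+-monoˡ-≤ n (m^n>0 2 L)) ⟩
    suc (2 ^ L + n)   ≡⟨ sym (+-suc (2 ^ L) n) ⟩
    2 ^ L + suc n     ≤⟨ +-monoʳ-≤ (2 ^ L) n< ⟩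
    2 ^ L + 2 ^ L     ≡⟨ cong (2 ^ L +_) (sym (+-identityʳ _)) ⟩
    2 ^ suc L         ∎
    where open ≤-Reasoning

  ∥-∥-mono : ∀ {m n} → m ≤ n → ∥_∥ {ℕᵗ} m ≤ 1 + ∥_∥ {ℕᵗ} n * 4
  ∥-∥-mono {m} {n} m≤n = ∥n∥≤ (∥_∥ {ℕᵗ} n) (≤-trans (s≤s m≤n) (n<2^∥n∥ n))

  undigits-suffix : ∀ ys zs → undigits zs ≤ undigits (ys ++ zs)
  undigits-suffix []           zs = ≤-refl
  undigits-suffix (true  ∷ ys) zs = m≤n⇒m≤1+n (≤-trans (undigits-suffix ys zs) (m≤m+n _ _))
  undigits-suffix (false ∷ ys) zs = ≤-trans (m≤n⇒m≤1+n (undigits-suffix ys zs)) (m≤m+n _ _)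

  digits-suffix : ∀ n ys zs → digits n ≡ ys ++ zs → undigits zs ≤ n
  digits-suffix n ys zs eq = ≤-trans (undigits-suffix ys zs) (≤-reflexive (trans (cong undigits (sym eq)) (undigits-digits n)))

  ∥suffix∥ : ∀ n ys zs → digits n ≡ ys ++ zs → ∥_∥ {ℕᵗ} (undigits zs) ≤ ∥_∥ {ℕᵗ} n
  ∥suffix∥ n ys zs eq = ≤-trans (≤-reflexive (cong size (enc-undigits zs)))
    (≤-trans (∥++∥ʳ {Boolᵗ} ys zs) (≤-reflexive (trans (cong (∥_∥ {Digitsᵗ}) (sym eq)) (cong size (sym (enc-digits n))))))

  -- Binary arithmetic

  private
    sucBoth : List Bool → ℕ → ℕ × ℕ
    sucBoth ds _ = undigits ds , suc (undigits ds)

    predBoth : List Bool → ℕ → ℕ × ℕ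
    predBoth ds _ = undigits ds , pred (undigits ds)

  opaque
    -- The digit 1 becomes 2 and leaves the higher digits alone; the digit 2 becomes 1 and replaces
    -- them by their successor. A fold does not see the tail it has processed, hence the pair of a
    -- number and its successor.
    sucₚ : ∀ {A f} → Poly A ℕᵗ f → Poly A ℕᵗ λ a → suc (f a)
    sucₚ {f = f} P = castₚ (λ a → cong suc (undigits-digits (f a))) (sndₚ ∙ both ∙ P)
      where
      step : (ℕ × ℕ) × (Bool × ℕ) → ℕ × ℕ
      step ((x , y) , d , _) = ifᵇ d then (suc (2 * x) , 2 * suc x) else (2 * suc x , suc (2 * y))
      both : Poly ℕᵗ (ℕᵗ ⊠ ℕᵗ) λ n → sucBoth (digits n) n
      both = listRecₚ {ℕᵗ} {ℕᵗ ⊠ ℕᵗ} {Boolᵗ} {digits} {sucBoth} {step} (digitsₚ idₚ) (constₚ (0 , 1))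
        (ifₚ (fstₚ ∙ sndₚ) ⟨ oddₚ (fstₚ ∙ fstₚ) , evenₚ (fstₚ ∙ fstₚ) ⟩ ⟨ evenₚ (fstₚ ∙ fstₚ) , oddₚ (sndₚ ∙ fstₚ) ⟩)
        (λ { true ds _ → cong (λ n → suc (2 * undigits ds) , n) (sym (*-suc 2 (undigits ds))) ; false ds _ → refl })
        (con 1 ⊕ (♯ ⊕ logBound (con 1 ⊕ ♯)))
        λ n ys zs eq → s≤s (+-mono-≤ (∥suffix∥ n ys zs eq)
          (∥n∥≤ (suc (∥_∥ {ℕᵗ} n)) (suc-<2^ (∥_∥ {ℕᵗ} n) (<2^-mono (∥_∥ {ℕᵗ} (undigits zs)) (∥_∥ {ℕᵗ} n) (∥suffix∥ n ys zs eq) (n<2^∥n∥ (undigits zs))))))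

  isZero : ℕ → Bool
  isZero zero    = true
  isZero (suc _) = false

  opaque
    isZeroₚ : ∀ {A f} → Poly A ℕᵗ f → Poly A Boolᵗ λ a → isZero (f a)
    isZeroₚ {A} {f} P = castₚ (λ a → trans (digits-isZero a (digits (f a))) (cong isZero (undigits-digits (f a))))
      (caseₚ {A} {Boolᵗ} {Boolᵗ} (digitsₚ P) (constₚ true) (constₚ false))
      where
      digits-isZero : ∀ a ds → caseList {X = Bool} {Z = Val A} (λ _ → true) (λ _ → false) (ds , a) ≡ isZero (undigits ds)
      digits-isZero a []           = refl
      digits-isZero a (true  ∷ ds) = refl
      digits-isZero a (false ∷ ds) = refl

  opaque
    predₚ : ∀ {A f} → Poly A ℕᵗ f → Poly A ℕᵗ λ a → pred (f a)
    predₚ {f = f} P = castₚ (λ a → cong pred (undigits-digits (f a))) (sndₚ ∙ both ∙ P)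
      where
      step : (ℕ × ℕ) × (Bool × ℕ) → ℕ × ℕ
      -- Lowering the digit 1 leaves `2 * x`: this has no digits at all if `x` is 0, and otherwise
      -- gets the digit 2 after borrowing from `x`.
      step ((x , y) , d , _) = ifᵇ d then (suc (2 * x) , (ifᵇ isZero x then 0 else 2 * suc y)) else (2 * suc x , suc (2 * x))
      step-odd : ∀ x → 2 * x ≡ (ifᵇ isZero x then 0 else 2 * suc (pred x))
      step-odd zero    = refl
      step-odd (suc x) = refl
      both : Poly ℕᵗ (ℕᵗ ⊠ ℕᵗ) λ n → predBoth (digits n) n
      both = listRecₚ {ℕᵗ} {ℕᵗ ⊠ ℕᵗ} {Boolᵗ} {digits} {predBoth} {step} (digitsₚ idₚ) (constₚ (0 , 0))
        (ifₚ (fstₚ ∙ sndₚ) ⟨ oddₚ (fstₚ ∙ fstₚ) , ifₚ (isZeroₚ (fstₚ ∙ fstₚ)) (constₚ 0) (evenₚ (sndₚ ∙ fstₚ)) ⟩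
                           ⟨ evenₚ (fstₚ ∙ fstₚ) , oddₚ (fstₚ ∙ fstₚ) ⟩)
        (λ { true ds _ → cong (suc (2 * undigits ds) ,_) (step-odd (undigits ds))
           ; false ds _ → cong (2 * suc (undigits ds) ,_) (+-suc (undigits ds) (undigits ds + 0)) })
        (con 1 ⊕ (♯ ⊕ logBound ♯))
        λ n ys zs eq → s≤s (+-mono-≤ (∥suffix∥ n ys zs eq) (∥-∥-mono (≤-trans pred[n]≤n (digits-suffix n ys zs eq))))

  doubleₚ : ∀ {A f} → Poly A ℕᵗ f → Poly A ℕᵗ λ a → 2 * f a
  doubleₚ P = predₚ (oddₚ P)

  private
    Row : Type
    Row = (Boolᵗ ⊠ Digitsᵗ) ⊠ ℕᵗ

    addCarry : Bool × (List Bool × Val Row) → ℕ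
    addCarry (e , _ , (d , _) , r) =
      ifᵇ d then (ifᵇ e then 2 * suc r else suc (2 * suc r)) else (ifᵇ e then suc (2 * suc r) else 2 * suc (suc r))

    addStep : Val Row → ℕ
    addStep c = caseList (λ ((d , _) , r) → ifᵇ d then suc (2 * r) else 2 * suc r) addCarry (proj₂ (proj₁ c) , c)

    addDigits : List Bool → List Bool → ℕ
    addDigits = rec dropHead undigits addStep

    addDigits≡ : ∀ xs ys → addDigits xs ys ≡ undigits xs + undigits ys
    addDigits≡ []           ys           = refl
    addDigits≡ (true ∷ xs)  []           = trans (cong (λ n → suc (2 * n)) (addDigits≡ xs [])) (shape (undigits xs))
      where
      shape : ∀ x → 1 + 2 * (x + 0) ≡ 1 + 2 * x + 0
      shape = solve-∀
    addDigits≡ (false ∷ xs) []           = trans (cong (λ n → 2 * suc n) (addDigits≡ xs [])) (shape (undigits xs))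
      where
      shape : ∀ x → 2 * (1 + (x + 0)) ≡ 2 * (1 + x) + 0
      shape = solve-∀
    addDigits≡ (true ∷ xs)  (true ∷ ys)  = trans (cong (λ n → 2 * suc n) (addDigits≡ xs ys)) (shape (undigits xs) (undigits ys))
      where
      shape : ∀ x y → 2 * (1 + (x + y)) ≡ 1 + 2 * x + (1 + 2 * y)
      shape = solve-∀
    addDigits≡ (true ∷ xs)  (false ∷ ys) = trans (cong (λ n → suc (2 * suc n)) (addDigits≡ xs ys)) (shape (undigits xs) (undigits ys))
      where
      shape : ∀ x y → 1 + 2 * (1 + (x + y)) ≡ 1 + 2 * x + 2 * (1 + y)
      shape = solve-∀
    addDigits≡ (false ∷ xs) (true ∷ ys)  = trans (cong (λ n → suc (2 * suc n)) (addDigits≡ xs ys)) (shape (undigits xs) (undigits ys))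
      where
      shape : ∀ x y → 1 + 2 * (1 + (x + y)) ≡ 2 * (1 + x) + (1 + 2 * y)
      shape = solve-∀
    addDigits≡ (false ∷ xs) (false ∷ ys) = trans (cong (λ n → 2 * suc (suc n)) (addDigits≡ xs ys)) (shape (undigits xs) (undigits ys))
      where
      shape : ∀ x y → 2 * (2 + (x + y)) ≡ 2 * (1 + x) + 2 * (1 + y)
      shape = solve-∀

    ∥digits-op∥ : ∀ xs ys {n} → n ≤ suc (undigits xs + undigits ys) →
      ∥_∥ {ℕᵗ} n ≤ val (logBound (con 2 ⊕ ♯)) (∥_∥ {Digitsᵗ ⊠ Digitsᵗ} (xs , ys))
    ∥digits-op∥ xs ys {n} n≤ = ∥n∥≤ (suc (suc (∥_∥ {Digitsᵗ ⊠ Digitsᵗ} (xs , ys)))) (≤-trans (s≤s n≤) (<2^-mono (suc (suc k)) (suc (suc (suc k))) (n≤1+n _)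
      (suc-<2^ (suc (∥_∥ {Digitsᵗ} xs + ∥_∥ {Digitsᵗ} ys)) (+-<2^ (∥_∥ {Digitsᵗ} xs) (∥_∥ {Digitsᵗ} ys) (undigits-< xs) (undigits-< ys)))))
      where k = ∥_∥ {Digitsᵗ} xs + ∥_∥ {Digitsᵗ} ys

    bitₚ : ∀ {A B C} → Poly (Boolᵗ ⊠ (C ⊠ ((Boolᵗ ⊠ A) ⊠ B))) Boolᵗ λ (_ , _ , (d , _) , _) → d
    bitₚ = fstₚ ∙ fstₚ ∙ sndₚ ∙ sndₚ

    restₚ : ∀ {A B C} → Poly (Boolᵗ ⊠ (C ⊠ ((Boolᵗ ⊠ A) ⊠ B))) B λ (_ , _ , (_ , _) , r) → r
    restₚ = sndₚ ∙ sndₚ ∙ sndₚ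

  infixl 6 _+ₚ_ _∸ₚ_
  infixl 7 _*ₚ_

  opaque
    _+ₚ_ : ∀ {A f g} → Poly A ℕᵗ f → Poly A ℕᵗ g → Poly A ℕᵗ λ a → f a + g a
    _+ₚ_ {f = f} {g} P Q = castₚ (λ a → trans (addDigits≡ (digits (f a)) (digits (g a))) (cong₂ _+_ (undigits-digits (f a)) (undigits-digits (g a))))
      (add ∙ ⟨ digitsₚ P , digitsₚ Q ⟩)
      where
      add : Poly (Digitsᵗ ⊠ Digitsᵗ) ℕᵗ λ (xs , ys) → addDigits xs ys
      add = recₚ {Boolᵗ} {Digitsᵗ} {ℕᵗ} {step = addStep} dropHeadₚ (∥dropHead∥ {Boolᵗ}) undigitsₚ
        (caseₚ {Row} {Boolᵗ} {ℕᵗ} {c = addCarry} (sndₚ ∙ fstₚ)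
          (ifₚ (fstₚ ∙ fstₚ) (oddₚ sndₚ) (evenₚ sndₚ))
          (ifₚ bitₚ (ifₚ fstₚ (evenₚ restₚ) (oddₚ (sucₚ restₚ))) (ifₚ fstₚ (oddₚ (sucₚ restₚ)) (evenₚ (sucₚ restₚ)))))
        (logBound (con 2 ⊕ ♯)) λ xs ys → ∥digits-op∥ xs ys (≤-trans (≤-reflexive (addDigits≡ xs ys)) (n≤1+n _))

  private
    subCarry : Bool × (List Bool × Val Row) → ℕ
    subCarry (e , _ , (d , _) , r) = ifᵇ isZero r then 0 else
      (ifᵇ d then (ifᵇ e then suc (2 * pred r) else 2 * pred r) else (ifᵇ e then 2 * suc (pred r) else suc (2 * pred r)))

    subStep : Val Row → ℕ
    subStep c = caseList (λ ((d , _) , r) → ifᵇ d then 2 * suc (pred r) else suc (2 * r)) subCarry (proj₂ (proj₁ c) , c)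

    subBase : List Bool → ℕ
    subBase ys = caseList {Z = List Bool} (λ _ → 1) (λ _ → 0) (ys , ys)

    -- suc x ∸ y instead of x ∸ y retains the information whether x < y.
    subDigits : List Bool → List Bool → ℕ
    subDigits = rec dropHead subBase subStep

    -- `z` appends a lowest digit to the difference of the higher parts, which is shifted by one
    -- like every difference here. `pos` covers the case without a negative higher difference; a
    -- negative one is represented by 0 and stays 0 by `zero≡`, since the digits `c` and `d` differ
    -- too little to make up for it.
    sub-step : ∀ c d x y z → (∀ k → suc (c + 2 * (y + k)) ∸ (d + 2 * y) ≡ z (suc k)) → (suc c ≤ 2 + d) → z 0 ≡ 0 →
      suc (c + 2 * x) ∸ (d + 2 * y) ≡ z (suc x ∸ y)
    sub-step c d x y z pos c≤d zero≡ with y ≤? x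
    ... | yes y≤x = trans (cong (λ x → suc (c + 2 * x) ∸ (d + 2 * y)) (sym (m+[n∸m]≡n y≤x)))
      (trans (pos (x ∸ y)) (cong z (sym (+-∸-assoc 1 y≤x))))
    ... | no y≰x = trans (m≤n⇒m∸n≡0 small≤) (trans (sym zero≡) (cong z (sym (m≤n⇒m∸n≡0 (≰⇒> y≰x)))))
      where
      small≤ : suc (c + 2 * x) ≤ d + 2 * y
      small≤ = begin
        suc c + 2 * x       ≤⟨ +-monoˡ-≤ (2 * x) c≤d ⟩
        2 + d + 2 * x       ≡⟨ shape d x ⟩
        d + 2 * (1 + x)     ≤⟨ +-monoʳ-≤ d (*-monoʳ-≤ 2 (≰⇒> y≰x)) ⟩
        d + 2 * y           ∎
        where
        open ≤-Reasoning
        shape : ∀ d x → 2 + d + 2 * x ≡ d + 2 * (1 + x)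
        shape = solve-∀

    subDigits≡ : ∀ xs ys → subDigits xs ys ≡ suc (undigits xs) ∸ undigits ys
    subDigits≡ []           []           = refl
    subDigits≡ []           (true ∷ ys)  = sym (0∸n≡0 (2 * undigits ys))
    subDigits≡ []           (false ∷ ys) = sym (0∸n≡0 (undigits ys + 1 * suc (undigits ys)))
    subDigits≡ (true ∷ xs)  []           = trans (cong (λ n → 2 * suc (pred n)) (subDigits≡ xs [])) (*-suc 2 (undigits xs))
    subDigits≡ (false ∷ xs) []           = cong (λ n → suc (2 * n)) (subDigits≡ xs [])
    subDigits≡ (true ∷ xs)  (true ∷ ys)  = trans (cong z (subDigits≡ xs ys))
      (sym (sub-step 1 1 (undigits xs) (undigits ys) z pos (s≤s (s≤s z≤n)) refl))
      where
      z : ℕ → ℕ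
      z r = ifᵇ isZero r then 0 else suc (2 * pred r)
      shape : ∀ y k → 1 + 2 * (y + k) ≡ 2 * y + (1 + 2 * k)
      shape = solve-∀
      pos : ∀ k → 1 + 2 * (undigits ys + k) ∸ 2 * undigits ys ≡ suc (2 * k)
      pos k = trans (cong (_∸ 2 * undigits ys) (shape (undigits ys) k)) (m+n∸m≡n (2 * undigits ys) _)
    subDigits≡ (true ∷ xs)  (false ∷ ys) = trans (cong z (subDigits≡ xs ys))
      (sym (trans (cong (suc (suc (2 * undigits xs)) ∸_) (*-suc 2 (undigits ys))) (sub-step 1 2 (undigits xs) (undigits ys) z pos (s≤s (s≤s z≤n)) refl)))
      where
      z : ℕ → ℕ
      z r = ifᵇ isZero r then 0 else 2 * pred r
      pos : ∀ k → 2 * (undigits ys + k) ∸ 2 * undigits ys ≡ 2 * k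
      pos k = trans (cong (_∸ 2 * undigits ys) (*-distribˡ-+ 2 (undigits ys) k)) (m+n∸m≡n (2 * undigits ys) _)
    subDigits≡ (false ∷ xs) (true ∷ ys)  = trans (cong z (subDigits≡ xs ys))
      (sym (trans (cong (λ n → suc n ∸ suc (2 * undigits ys)) (*-suc 2 (undigits xs))) (sub-step 2 1 (undigits xs) (undigits ys) z pos ≤-refl refl)))
      where
      z : ℕ → ℕ
      z r = ifᵇ isZero r then 0 else 2 * suc (pred r)
      shape : ∀ y k → 2 + 2 * (y + k) ≡ 2 * y + 2 * (1 + k)
      shape = solve-∀
      pos : ∀ k → 2 + 2 * (undigits ys + k) ∸ 2 * undigits ys ≡ 2 * suc k
      pos k = trans (cong (_∸ 2 * undigits ys) (shape (undigits ys) k)) (m+n∸m≡n (2 * undigits ys) _)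
    subDigits≡ (false ∷ xs) (false ∷ ys) = trans (cong z (subDigits≡ xs ys))
      (sym (trans (cong₂ (λ m n → suc m ∸ n) (*-suc 2 (undigits xs)) (*-suc 2 (undigits ys))) (sub-step 2 2 (undigits xs) (undigits ys) z pos (s≤s (s≤s (s≤s z≤n))) refl)))
      where
      z : ℕ → ℕ
      z r = ifᵇ isZero r then 0 else suc (2 * pred r)
      shape : ∀ y k → 1 + 2 * (y + k) ≡ 2 * y + (1 + 2 * k)
      shape = solve-∀
      pos : ∀ k → 1 + 2 * (undigits ys + k) ∸ 2 * undigits ys ≡ suc (2 * k)
      pos k = trans (cong (_∸ 2 * undigits ys) (shape (undigits ys) k)) (m+n∸m≡n (2 * undigits ys) _)

  opaque
    _∸ₚ_ : ∀ {A f g} → Poly A ℕᵗ f → Poly A ℕᵗ g → Poly A ℕᵗ λ a → f a ∸ g a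
    _∸ₚ_ {f = f} {g} P Q = castₚ
      (λ a → trans (cong pred (subDigits≡ (digits (f a)) (digits (g a))))
        (trans (cong₂ (λ x y → pred (suc x ∸ y)) (undigits-digits (f a)) (undigits-digits (g a))) (pred-∸ (f a) (g a))))
      (predₚ (sub ∙ ⟨ digitsₚ P , digitsₚ Q ⟩))
      where
      pred-∸ : ∀ x y → pred (suc x ∸ y) ≡ x ∸ y
      pred-∸ x y = pred[m∸n]≡m∸[1+n] (suc x) y
      sub : Poly (Digitsᵗ ⊠ Digitsᵗ) ℕᵗ λ (xs , ys) → subDigits xs ys
      sub = recₚ {Boolᵗ} {Digitsᵗ} {ℕᵗ} {step = subStep} dropHeadₚ (∥dropHead∥ {Boolᵗ})
        (caseₚ {Digitsᵗ} {Boolᵗ} {ℕᵗ} idₚ (constₚ 1) (constₚ 0))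
        (caseₚ {Row} {Boolᵗ} {ℕᵗ} {c = subCarry} (sndₚ ∙ fstₚ)
          (ifₚ (fstₚ ∙ fstₚ) (evenₚ (predₚ sndₚ)) (oddₚ sndₚ))
          (ifₚ (isZeroₚ restₚ) (constₚ 0)
            (ifₚ bitₚ (ifₚ fstₚ (oddₚ (predₚ restₚ)) (doubleₚ (predₚ restₚ))) (ifₚ fstₚ (evenₚ (predₚ restₚ)) (oddₚ (predₚ restₚ))))))
        (logBound (con 2 ⊕ ♯))
        λ xs ys → ∥digits-op∥ xs ys (≤-trans (≤-reflexive (subDigits≡ xs ys)) (≤-trans (m∸n≤m _ (undigits ys)) (s≤s (m≤m+n _ _))))

  opaque
    _*ₚ_ : ∀ {A f g} → Poly A ℕᵗ f → Poly A ℕᵗ g → Poly A ℕᵗ λ a → f a * g a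
    _*ₚ_ {f = f} {g} P Q = castₚ (λ a → cong (_* g a) (undigits-digits (f a))) (mul ∙ ⟨ P , Q ⟩)
      where
      h : List Bool → ℕ × ℕ → ℕ
      h ds (x , y) = undigits ds * y
      step : ℕ × (Bool × (ℕ × ℕ)) → ℕ
      step (z , d , x , y) = ifᵇ d then y + 2 * z else 2 * (y + z)
      h-step : ∀ d ds xy → h (d ∷ ds) xy ≡ step (h ds xy , d , xy)
      h-step true  ds (x , y) = cong (y +_) (*-assoc 2 (undigits ds) y)
      h-step false ds (x , y) = *-assoc 2 (suc (undigits ds)) y
      mul : Poly (ℕᵗ ⊠ ℕᵗ) ℕᵗ λ (x , y) → h (digits x) (x , y)
      mul = listRecₚ {ℕᵗ ⊠ ℕᵗ} {ℕᵗ} {Boolᵗ} {λ (x , y) → digits x} {h} {step} (digitsₚ fstₚ) (constₚ 0)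
        (ifₚ (fstₚ ∙ sndₚ) (sndₚ ∙ sndₚ ∙ sndₚ +ₚ doubleₚ fstₚ) (doubleₚ (sndₚ ∙ sndₚ ∙ sndₚ +ₚ fstₚ)))
        h-step (logBound ♯)
        λ (x , y) ys zs eq → ∥n∥≤ (∥_∥ {ℕᵗ ⊠ ℕᵗ} (x , y)) (<2^-mono (∥_∥ {ℕᵗ} x + ∥_∥ {ℕᵗ} y) _ (n≤1+n _) (*-<2^ (∥_∥ {ℕᵗ} x) (∥_∥ {ℕᵗ} y)
          (≤-trans (s≤s (digits-suffix x ys zs eq)) (n<2^∥n∥ x)) (n<2^∥n∥ y)))

  private
    carry : ℕ → ℕ × ℕ → ℕ × ℕ
    carry d (q , r) = ifᵇ isZero (d ∸ r) then (suc q , r ∸ d) else (q , r)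

    -- Long division from the highest digit on. For `r < d` the digit 1 gives a remainder below
    -- `2 * d`, so one subtraction of `d` is enough; the digit 2 can give exactly `2 * d`, which
    -- takes two.
    divStep : (ℕ × ℕ) × (Bool × (ℕ × ℕ)) → ℕ × ℕ
    divStep ((q , r) , b , x , d) = ifᵇ b then carry d (2 * q , suc (2 * r)) else carry d (carry d (2 * q , 2 * suc r))

    divide : List Bool → ℕ × ℕ → ℕ × ℕ
    divide []       xd = 0 , 0
    divide (b ∷ bs) xd = divStep (divide bs xd , b , xd)

  quot : ℕ → ℕ → ℕ
  quot x d = proj₁ (divide (digits x) (x , d))

  private
    carry-q : ∀ d q r → proj₁ (carry d (q , r)) ≤ suc q
    carry-q d q r with isZero (d ∸ r)
    ... | true  = ≤-refl
    ... | false = n≤1+n q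

    carry-r : ∀ d q r → proj₂ (carry d (q , r)) ≤ r
    carry-r d q r with isZero (d ∸ r)
    ... | true  = m∸n≤m r d
    ... | false = ≤-refl

    -- Each digit 1 or 2 raises the doubled quotient by at most 1 or 2, also for divisor 0, where
    -- every test succeeds. Sizes have to be bounded on all inputs, including meaningless ones.
    divide-≤ : ∀ bs xd → proj₁ (divide bs xd) ≤ undigits bs × proj₂ (divide bs xd) ≤ undigits bs
    divide-≤ []           xd = z≤n , z≤n
    divide-≤ (true ∷ bs)  xd@(x , d) with divide bs xd | divide-≤ bs xd
    ... | q , r | q≤ , r≤ = ≤-trans (carry-q d (2 * q) (suc (2 * r))) (s≤s (*-monoʳ-≤ 2 q≤)) , ≤-trans (carry-r d (2 * q) (suc (2 * r))) (s≤s (*-monoʳ-≤ 2 r≤))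
    divide-≤ (false ∷ bs) xd@(x , d) with divide bs xd | divide-≤ bs xd
    ... | q , r | q≤ , r≤ =
      ≤-trans (carry-q d q₁ r₁) (≤-trans (s≤s (≤-trans (carry-q d (2 * q) (2 * suc r)) (s≤s (*-monoʳ-≤ 2 q≤)))) (≤-reflexive (sym (*-suc 2 (undigits bs))))) ,
      ≤-trans (carry-r d q₁ r₁) (≤-trans (carry-r d (2 * q) (2 * suc r)) (*-monoʳ-≤ 2 (s≤s r≤)))
      where
      q₁ = proj₁ (carry d (2 * q , 2 * suc r))
      r₁ = proj₂ (carry d (2 * q , 2 * suc r))

    carry-sum : ∀ d q r → proj₁ (carry d (q , r)) * d + proj₂ (carry d (q , r)) ≡ q * d + r
    carry-sum d q r with d ∸ r in eq
    ... | suc _ = refl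
    ... | zero  = trans (shape d (q * d) (r ∸ d)) (cong (q * d +_) (m+[n∸m]≡n (m∸n≡0⇒m≤n eq)))
      where
      shape : ∀ d m n → d + m + n ≡ m + (d + n)
      shape = solve-∀

    -- The separate bound `k` serves the two subtractions after a digit 2: the first brings the
    -- remainder below `suc d`, the second below `d`.
    carry-< : ∀ d k q r → d ≤ k → r < d + k → proj₂ (carry d (q , r)) < k
    carry-< d k q r d≤k r< with d ∸ r in eq
    ... | suc _ = ≤-trans r<d d≤k
      where
      r<d : r < d
      r<d = ≰⇒> λ d≤r → 1+n≢0 (trans (sym eq) (m≤n⇒m∸n≡0 d≤r))
    ... | zero  = +-cancelˡ-< d (r ∸ d) k (subst (_< d + k) (sym (m+[n∸m]≡n (m∸n≡0⇒m≤n eq))) r<)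

    divide-correct : ∀ bs x d → 0 < d → let (q , r) = divide bs (x , d) in q * d + r ≡ undigits bs × r < d
    divide-correct []           x d d>0 = refl , d>0
    divide-correct (true ∷ bs)  x d d>0 with divide bs (x , d) | divide-correct bs x d d>0
    ... | q , r | eq , r< =
      trans (carry-sum d (2 * q) (suc (2 * r))) (trans (shape q d r) (cong (λ n → suc (2 * n)) eq)) ,
      carry-< d d (2 * q) (suc (2 * r)) ≤-refl (≤-trans (≤-reflexive (shape′ r)) (+-mono-≤ r< r<))
      where
      shape : ∀ q d r → 2 * q * d + (1 + 2 * r) ≡ 1 + 2 * (q * d + r)
      shape = solve-∀
      shape′ : ∀ r → 2 + 2 * r ≡ (1 + r) + (1 + r)
      shape′ = solve-∀
    divide-correct (false ∷ bs) x d d>0 with divide bs (x , d) | divide-correct bs x d d>0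
    ... | q , r | eq , r< =
      trans (carry-sum d q₁ r₁) (trans (carry-sum d (2 * q) (2 * suc r)) (trans (shape q d r) (cong (λ n → 2 * suc n) eq))) ,
      carry-< d d q₁ r₁ ≤-refl (≤-trans (carry-< d (suc d) (2 * q) (2 * suc r) (n≤1+n d)
        (≤-trans (s≤s (≤-trans (≤-reflexive (shape′ r)) (+-mono-≤ r< r<))) (≤-reflexive (sym (+-suc d d))))) (+-monoˡ-≤ d d>0))
      where
      q₁ = proj₁ (carry d (2 * q , 2 * suc r))
      r₁ = proj₂ (carry d (2 * q , 2 * suc r))
      shape : ∀ q d r → 2 * q * d + 2 * (1 + r) ≡ 2 * (1 + (q * d + r))
      shape = solve-∀
      shape′ : ∀ r → 2 * (1 + r) ≡ (1 + r) + (1 + r)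
      shape′ = solve-∀

  quot-exact : ∀ x d → 0 < d → d ∣ x → quot x d * d ≡ x
  quot-exact x d d>0 d∣x with divide (digits x) (x , d) | divide-correct (digits x) x d d>0
  ... | q , zero  | eq , r< = trans (sym (+-identityʳ (q * d))) (trans eq (undigits-digits x))
  ... | q , suc r | eq , r< = contradiction
    (∣m+n∣m⇒∣n (subst (d ∣_) (sym (trans eq (undigits-digits x))) d∣x) (n∣m*n q)) (>⇒∤ r<)

  quot-≤ : ∀ x d → quot x d ≤ x
  quot-≤ x d = ≤-trans (proj₁ (divide-≤ (digits x) (x , d))) (≤-reflexive (undigits-digits x))

  opaque
    quotₚ : ∀ {A f g} → Poly A ℕᵗ f → Poly A ℕᵗ g → Poly A ℕᵗ λ a → quot (f a) (g a)
    quotₚ P Q = fstₚ ∙ div ∙ ⟨ P , Q ⟩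
      where
      carryₚ : ∀ {A d q r} → Poly A ℕᵗ d → Poly A ℕᵗ q → Poly A ℕᵗ r → Poly A (ℕᵗ ⊠ ℕᵗ) λ a → carry (d a) (q a , r a)
      carryₚ D Q R = ifₚ (isZeroₚ (D ∸ₚ R)) ⟨ sucₚ Q , R ∸ₚ D ⟩ ⟨ Q , R ⟩
      div : Poly (ℕᵗ ⊠ ℕᵗ) (ℕᵗ ⊠ ℕᵗ) λ (x , d) → divide (digits x) (x , d)
      div = listRecₚ {ℕᵗ ⊠ ℕᵗ} {ℕᵗ ⊠ ℕᵗ} {Boolᵗ} {λ (x , y) → digits x} {divide} {divStep} (digitsₚ fstₚ) (constₚ (0 , 0))
        (ifₚ (fstₚ ∙ sndₚ) (carryₚ dₚ (doubleₚ qₚ) (oddₚ rₚ)) (again ∙ ⟨ dₚ , carryₚ dₚ (doubleₚ qₚ) (evenₚ rₚ) ⟩))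
        (λ _ _ _ → refl) (con 1 ⊕ (logBound ♯ ⊕ logBound ♯))
        λ (x , d) ys zs eq → s≤s (+-mono-≤ (digit≤ x d _ (≤-trans (proj₁ (divide-≤ zs (x , d))) (digits-suffix x ys zs eq)))
                                           (digit≤ x d _ (≤-trans (proj₂ (divide-≤ zs (x , d))) (digits-suffix x ys zs eq))))
        where
        dₚ : Poly ((ℕᵗ ⊠ ℕᵗ) ⊠ (Boolᵗ ⊠ (ℕᵗ ⊠ ℕᵗ))) ℕᵗ λ (_ , _ , _ , d) → d
        dₚ = sndₚ ∙ sndₚ ∙ sndₚ
        qₚ : Poly ((ℕᵗ ⊠ ℕᵗ) ⊠ (Boolᵗ ⊠ (ℕᵗ ⊠ ℕᵗ))) ℕᵗ λ ((q , _) , _) → q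
        qₚ = fstₚ ∙ fstₚ
        rₚ : Poly ((ℕᵗ ⊠ ℕᵗ) ⊠ (Boolᵗ ⊠ (ℕᵗ ⊠ ℕᵗ))) ℕᵗ λ ((_ , r) , _) → r
        rₚ = sndₚ ∙ fstₚ
        again : Poly (ℕᵗ ⊠ (ℕᵗ ⊠ ℕᵗ)) (ℕᵗ ⊠ ℕᵗ) λ (d , qr) → carry d qr
        again = carryₚ fstₚ (fstₚ ∙ sndₚ) (sndₚ ∙ sndₚ)
        digit≤ : ∀ x d n → n ≤ x → ∥_∥ {ℕᵗ} n ≤ val (logBound ♯) (∥_∥ {ℕᵗ ⊠ ℕᵗ} (x , d))
        digit≤ x d n n≤x = ≤-trans (∥-∥-mono n≤x) (s≤s (*-monoˡ-≤ 4 (m≤n⇒m≤1+n (m≤m+n (∥_∥ {ℕᵗ} x) (∥_∥ {ℕᵗ} d)))))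

  module _ {X Y Z : Set} where

    zip-map : (f : X → Y) (g : X → Z) (xs : List X) → zip (map f xs) (map g xs) ≡ map (λ x → f x , g x) xs
    zip-map f g []       = refl
    zip-map f g (x ∷ xs) = cong (_ ∷_) (zip-map f g xs)

  module _ {A E F : Type} {X : Val A → Set} {xs : ∀ a → List (X a)} where

    mapOverₚ : {g : ∀ a → X a → Val E} {f : Val E × Val A → Val F} {k : ∀ a → X a → Val F} →
      Poly A (Listᵗ E) (λ a → map (g a) (xs a)) → Poly (E ⊠ A) F f → (∀ a x → f (g a x , a) ≡ k a x) →
      Poly A (Listᵗ F) λ a → map (k a) (xs a)
    mapOverₚ L P eq = castₚ (λ a → trans (sym (map-∘ (xs a))) (map-cong (eq a) (xs a))) (mapₚ L P)

    zipOverₚ : {g : ∀ a → X a → Val E} {h : ∀ a → X a → Val F} →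
      Poly A (Listᵗ E) (λ a → map (g a) (xs a)) → Poly A (Listᵗ F) (λ a → map (h a) (xs a)) →
      Poly A (Listᵗ (E ⊠ F)) λ a → map (λ x → g a x , h a x) (xs a)
    zipOverₚ L K = castₚ (λ a → zip-map _ _ (xs a)) (zipₚ L K)

  productₚ : ∀ {A l} → Poly A (Listᵗ ℕᵗ) l → Poly A ℕᵗ λ a → product (l a)
  productₚ {A} {l} L = foldrₚ {A} {ℕᵗ} {ℕᵗ} {f = λ (z , n , _) → n * z} (constₚ 1) L (fstₚ ∙ sndₚ *ₚ fstₚ) (logBound (out L))
    λ a ys zs eq → ∥n∥≤ (val (out L) (∥_∥ {A} a)) (<2^-mono _ _ (≤-trans (∥++∥ʳ {ℕᵗ} ys zs) (≤-trans (≤-reflexive (cong (∥_∥ {Listᵗ ℕᵗ}) (sym eq))) (small L a))) (product< zs))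
    where
    product< : ∀ ns → product ns < 2 ^ ∥_∥ {Listᵗ ℕᵗ} ns
    product< []       = s≤s (s≤s z≤n)
    product< (n ∷ ns) = <2^-mono (∥_∥ {ℕᵗ} n + ∥_∥ {Listᵗ ℕᵗ} ns) _ (n≤1+n _) (*-<2^ (∥_∥ {ℕᵗ} n) (∥_∥ {Listᵗ ℕᵗ} ns) (n<2^∥n∥ n) (product< ns))

  sumₚ : ∀ {A l} → Poly A (Listᵗ ℕᵗ) l → Poly A ℕᵗ λ a → sum (l a)
  sumₚ {A} {l} L = foldrₚ {A} {ℕᵗ} {ℕᵗ} {f = λ (z , n , _) → n + z} (constₚ 0) L (fstₚ ∙ sndₚ +ₚ fstₚ) (logBound (out L))
    λ a ys zs eq → ∥n∥≤ (val (out L) (∥_∥ {A} a)) (<2^-mono _ _ (≤-trans (∥++∥ʳ {ℕᵗ} ys zs) (≤-trans (≤-reflexive (cong (∥_∥ {Listᵗ ℕᵗ}) (sym eq))) (small L a))) (sum< zs))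
    where
    sum< : ∀ ns → sum ns < 2 ^ ∥_∥ {Listᵗ ℕᵗ} ns
    sum< []       = s≤s z≤n
    sum< (n ∷ ns) = +-<2^ (∥_∥ {ℕᵗ} n) (∥_∥ {Listᵗ ℕᵗ} ns) (n<2^∥n∥ n) (sum< ns)

  -- The exponent is the length of a list, hence unary; with a binary exponent the power could have
  -- exponentially many digits.
  powₚ : ∀ {A E z l} → Poly A ℕᵗ z → Poly A (Listᵗ E) l → Poly A ℕᵗ λ a → z a ^ length (l a)
  powₚ {A} {E} {z} {l} P L = listRecₚ {A} {ℕᵗ} {E} {l} {λ es a → z a ^ length es} {λ (x , _ , a) → z a * x} L (constₚ 1) (P ∙ sndₚ ∙ sndₚ *ₚ fstₚ)
    (λ _ _ _ → refl) (logBound (con 1 ⊕ out L ⊗ out P))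
    λ a ys zs eq → ∥n∥≤ (suc (val (out L) (∥_∥ {A} a) * val (out P) (∥_∥ {A} a))) (<2^-mono _ _ (s≤s (*-monoˡ-≤ _ (≤-trans (length≤∥∥ {E} zs) (≤-trans (∥++∥ʳ {E} ys zs)
      (≤-trans (≤-reflexive (cong (∥_∥ {Listᵗ E}) (sym eq))) (small L a)))))) (pow< a (length zs)))
    where
    pow< : ∀ a k → z a ^ k < 2 ^ suc (k * val (out P) (∥_∥ {A} a))
    pow< a zero    = s≤s (s≤s z≤n)
    pow< a (suc k) = subst (λ e → z a * z a ^ k < 2 ^ e) (+-suc m (k * m))
      (*-<2^ m (suc (k * m)) (<2^-mono (∥_∥ {ℕᵗ} (z a)) m (small P a) (n<2^∥n∥ (z a))) (pow< a k))
      where m = val (out P) (∥_∥ {A} a)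

  -- Unary numbers

  Unitᵗ : Type
  Unitᵗ = type ⊤ λ _ → nil

  Unaryᵗ : Type
  Unaryᵗ = type ℕ unaryᵗ

  ticksₚ : ∀ {A f} → Poly A Unaryᵗ f → Poly A (Listᵗ Unitᵗ) λ a → replicate (f a) tt
  ticksₚ P = coerceₚ {Unaryᵗ} {Listᵗ Unitᵗ} {λ n → replicate n tt} ticks ∙ P
    where
    ticks : ∀ n → unaryᵗ n ≡ listᵗ (λ _ → nil) (replicate n tt)
    ticks zero    = refl
    ticks (suc n) = cong (cons nil) (ticks n)

  sucᵘₚ : ∀ {A f} → Poly A Unaryᵗ f → Poly A Unaryᵗ λ a → suc (f a)
  sucᵘₚ P = exprₚ {Unaryᵗ} {Unaryᵗ} {suc} (consᵉ nilᵉ (var zero)) (con 2 ⊕ ♯) (λ _ _ → refl) (λ _ → ≤-refl) ∙ P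

  ∥bool∥≤3 : ∀ b → ∥_∥ {Boolᵗ} b ≤ 3
  ∥bool∥≤3 true  = ≤-refl
  ∥bool∥≤3 false = s≤s z≤n

  equalᵘₚ : ∀ {A f g} → Poly A Unaryᵗ f → Poly A Unaryᵗ g → Poly A Boolᵗ λ a → f a ≡ᵇ g a
  equalᵘₚ {f = f} {g} P Q = castₚ (λ a → rec≡ (f a) (g a))
    (recₚ {Unitᵗ} {Listᵗ Unitᵗ} {Boolᵗ} {step = step} dropHeadₚ (∥dropHead∥ {Unitᵗ})
      (caseₚ {Listᵗ Unitᵗ} {Unitᵗ} {Boolᵗ} idₚ (constₚ true) (constₚ false))
      (caseₚ {(Unitᵗ ⊠ Listᵗ Unitᵗ) ⊠ Boolᵗ} {Unitᵗ} {Boolᵗ} (sndₚ ∙ fstₚ) (constₚ false) (sndₚ ∙ sndₚ ∙ sndₚ))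
      (con 3) (λ es s → ∥bool∥≤3 (rec dropHead base step es s)) ∙ ⟨ ticksₚ P , ticksₚ Q ⟩)
    where
    base : List ⊤ → Bool
    base s = caseList {Z = List ⊤} (λ _ → true) (λ _ → false) (s , s)
    step : (⊤ × List ⊤) × Bool → Bool
    step c = caseList (λ _ → false) (λ (_ , _ , _ , r) → r) (proj₂ (proj₁ c) , c)
    rec≡ : ∀ m n → rec dropHead base step (replicate m tt) (replicate n tt) ≡ (m ≡ᵇ n)
    rec≡ zero    zero    = refl
    rec≡ zero    (suc n) = refl
    rec≡ (suc m) zero    = refl
    rec≡ (suc m) (suc n) = rec≡ m n

  notₚ : ∀ {A f} → Poly A Boolᵗ f → Poly A Boolᵗ λ a → not (f a)
  notₚ {f = f} P = castₚ (λ a → eq (f a)) (ifₚ P (constₚ false) (constₚ true))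
    where
    eq : ∀ b → (ifᵇ b then false else true) ≡ not b
    eq true  = refl
    eq false = refl

  infixr 6 _∧ₚ_
  _∧ₚ_ : ∀ {A f g} → Poly A Boolᵗ f → Poly A Boolᵗ g → Poly A Boolᵗ λ a → f a ∧ g a
  _∧ₚ_ {f = f} {g} P Q = castₚ (λ a → eq (f a) (g a)) (ifₚ P Q (constₚ false))
    where
    eq : ∀ b c → (ifᵇ b then c else false) ≡ b ∧ c
    eq true  c = refl
    eq false c = refl

  -- `n` is in binary and may be exponentially larger than its notation, so it is counted down along
  -- the list and never expanded.
  takeₚ : ∀ {A E n l} → Poly A ℕᵗ n → Poly A (Listᵗ E) l → Poly A (Listᵗ E) λ a → take (n a) (l a)
  takeₚ {A} {E} {n} {l} P L = castₚ (λ a → trans (cong (reverse ∘ proj₂) (moves (n a) [] (l a))) (reverse-involutive (take (n a) (l a))))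
    (reverseₚ (sndₚ ∙ foldlₚ {A} {ℕᵗ ⊠ Listᵗ E} {E} {f = λ (s , e , _) → move s e} ⟨ P , nilₚ ⟩ L
      (ifₚ (isZeroₚ (fstₚ ∙ fstₚ)) fstₚ ⟨ predₚ (fstₚ ∙ fstₚ) , consₚ (fstₚ ∙ sndₚ) (sndₚ ∙ fstₚ) ⟩)
      (con 1 ⊕ (logBound (out P) ⊕ out L)) bounded))
    where
    move : ℕ × List (Val E) → Val E → ℕ × List (Val E)
    move s e = ifᵇ isZero (proj₁ s) then s else (pred (proj₁ s) , e ∷ proj₂ s)
    moves : ∀ k es ys → foldl move (k , es) ys ≡ (k ∸ length ys , foldl (λ es e → e ∷ es) es (take k ys))
    moves zero    es []       = refl
    moves (suc k) es []       = refl
    moves zero    es (y ∷ ys) = trans (moves zero es ys) (cong₂ _,_ (0∸n≡0 (length ys)) (cong (foldl (λ es e → e ∷ es) es) (take-0 ys)))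
      where
      take-0 : ∀ ys → take {A = Val E} 0 ys ≡ []
      take-0 []       = refl
      take-0 (y ∷ ys) = refl
    moves (suc k) es (y ∷ ys) = moves k (y ∷ es) ys
    take≤ : ∀ k es → ∥_∥ {Listᵗ E} (take k es) ≤ ∥_∥ {Listᵗ E} es
    take≤ zero    []       = ≤-refl
    take≤ zero    (e ∷ es) = s≤s z≤n
    take≤ (suc k) []       = ≤-refl
    take≤ (suc k) (e ∷ es) = s≤s (+-monoʳ-≤ (∥_∥ {E} e) (take≤ k es))
    bounded : ∀ a ys zs → l a ≡ ys ++ zs → ∥_∥ {ℕᵗ ⊠ Listᵗ E} (foldl move (n a , []) ys) ≤ val (con 1 ⊕ (logBound (out P) ⊕ out L)) (∥_∥ {A} a)
    bounded a ys zs eq = ≤-trans (≤-reflexive (cong (∥_∥ {ℕᵗ ⊠ Listᵗ E}) (moves (n a) [] ys))) (s≤s (+-mono-≤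
      (≤-trans (∥-∥-mono (m∸n≤m (n a) (length ys))) (s≤s (*-monoˡ-≤ 4 (small P a))))
      (≤-trans (≤-reflexive (suc-injective (∥reverse∥ {E} [] (take (n a) ys)))) (≤-trans (take≤ (n a) ys)
        (≤-trans (∥++∥ˡ {E} ys zs) (≤-trans (≤-reflexive (cong (∥_∥ {Listᵗ E}) (sym eq))) (small L a)))))))

  dropsₚ : ∀ {A E F l m} → Poly A (Listᵗ E) l → Poly A (Listᵗ F) m → Poly A (Listᵗ E) λ a → drop (length (m a)) (l a)
  dropsₚ {A} {E} {F} {l} {m} L M = castₚ (λ a → drops (m a) (l a))
    (foldlₚ {A} {Listᵗ E} {F} {f = λ (es , _) → dropHead es} L M (dropHeadₚ ∙ fstₚ) (out L)
      λ a ys zs eq → ≤-trans (drops≤ ys (l a)) (small L a))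
    where
    drops : ∀ fs es → foldl (λ es _ → dropHead es) es fs ≡ drop (length fs) es
    drops []       es       = refl
    drops (f ∷ fs) []       = trans (drops fs []) (drop-[] (length fs))
    drops (f ∷ fs) (e ∷ es) = drops fs es
    drops≤ : ∀ fs es → ∥_∥ {Listᵗ E} (foldl {B = Val F} (λ es _ → dropHead es) es fs) ≤ ∥_∥ {Listᵗ E} es
    drops≤ []       es = ≤-refl
    drops≤ (f ∷ fs) es = ≤-trans (drops≤ fs (dropHead es)) (∥dropHead∥ {E} es)

  headOr : ∀ {X : Set} → X → List X → X
  headOr d []      = d
  headOr d (x ∷ _) = x

  headOrₚ : ∀ {A E l} d → Poly A (Listᵗ E) l → Poly A E λ a → headOr d (l a)
  headOrₚ {A} {E} {l} d L = castₚ (λ a → eq a (l a)) (caseₚ {A} {E} {E} {c = proj₁} L (constₚ d) fstₚ)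
    where
    eq : ∀ a es → caseList (λ _ → d) proj₁ (es , a) ≡ headOr d es
    eq a []       = refl
    eq a (e ∷ es) = refl

  indices : ∀ {X : Set} → List X → List ℕ
  indices []       = []
  indices (x ∷ xs) = 0 ∷ map suc (indices xs)

  indicesₚ : ∀ {A E l} → Poly A (Listᵗ E) l → Poly A (Listᵗ Unaryᵗ) λ a → indices (l a)
  indicesₚ {A} {E} {l} L = listRecₚ {A} {Listᵗ Unaryᵗ} {E} {l} {λ es _ → indices es} {λ (is , _) → 0 ∷ map suc is} L nilₚ
    (consₚ (constₚ 0) (mapₚ fstₚ (sucᵘₚ fstₚ))) (λ _ _ _ → refl) (con 1 ⊕ out L ⊗ (con 2 ⊕ out L ⊗ con 2))
    λ a ys zs eq → let zs≤ = ≤-trans (length≤∥∥ {E} zs) (≤-trans (∥++∥ʳ {E} ys zs) (≤-trans (≤-reflexive (cong (∥_∥ {Listᵗ E}) (sym eq))) (small L a))) in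
      ≤-trans (∥unary∥ (indices zs) (indices< zs)) (s≤s (≤-trans (≤-reflexive (cong (_* suc (suc (length zs * 2))) (length-indices zs)))
        (*-mono-≤ zs≤ (s≤s (s≤s (*-monoˡ-≤ 2 zs≤))))))
    where
    indices< : ∀ {X : Set} (xs : List X) → All (_≤ length xs) (indices xs)
    indices< []       = []
    indices< (x ∷ xs) = z≤n ∷ All.map⁺ (All.map s≤s (indices< xs))
    length-indices : ∀ {X : Set} (xs : List X) → length (indices xs) ≡ length xs
    length-indices []       = refl
    length-indices (x ∷ xs) = cong suc (trans (length-map suc (indices xs)) (length-indices xs))
    ∥unaryᵗ∥ : ∀ n → ∥_∥ {Unaryᵗ} n ≡ suc (n * 2)
    ∥unaryᵗ∥ zero    = refl
    ∥unaryᵗ∥ (suc n) = cong (λ k → suc (suc k)) (∥unaryᵗ∥ n)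
    ∥unary∥ : ∀ {K} is → All (_≤ K) is → ∥_∥ {Listᵗ Unaryᵗ} is ≤ suc (length is * suc (suc (K * 2)))
    ∥unary∥ []       []            = s≤s z≤n
    ∥unary∥ {K} (i ∷ is) (i≤ ∷ is≤) = s≤s (≤-trans (+-mono-≤ (≤-trans (≤-reflexive (∥unaryᵗ∥ i)) (s≤s (*-monoˡ-≤ 2 i≤))) (∥unary∥ is is≤))
      (≤-reflexive (+-suc (suc (K * 2)) _)))

  indices-tabulate : ∀ {X : Set} m (f : Fin m → X) → indices (tabulate f) ≡ map toℕ (allFin m)
  indices-tabulate zero    f = refl
  indices-tabulate (suc m) f = cong (0 ∷_) (trans (cong (map suc) (indices-tabulate m (f ∘ suc)))
    (trans (cong (map suc) (map-tabulate id toℕ)) (trans (map-tabulate toℕ suc) (sym (map-tabulate suc toℕ)))))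

-- Rational sums, expectations and the competitive analysis

module Competitiveness where

  open import Data.Bool.Base using (Bool; true; false; not; _∧_; T) renaming (if_then_else_ to ifᵇ_then_else_)
  open import Data.Bool.Properties using (T?; T-∧)
  open import Data.Fin.Base using (Fin; zero; suc)
  open import Data.Fin.Properties using (_≟_)
  import Data.Integer.Base as ℤ
  import Data.Integer.Properties as ℤ
  open import Data.List.Base using (List; []; _∷_; _++_; length; map; foldr; tabulate; allFin; filter; take)
  open import Data.List.Properties using (++-assoc; length-take)
  open import Data.List.Membership.Propositional using (_∈_)
  open import Data.List.Membership.Propositional.Properties using (∈-allFin)
  open import Data.List.Relation.Unary.All as All using (All; []; _∷_)
  open import Data.List.Relation.Unary.All.Properties using (all-filter) renaming (take⁺ to All-take⁺)
  open import Data.List.Relation.Unary.Any using (here; there)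
  open import Data.List.Relation.Unary.AllPairs using ([]; _∷_)
  open import Data.List.Relation.Unary.Unique.Propositional using (Unique)
  open import Data.List.Relation.Unary.Unique.Propositional.Properties using (allFin⁺) renaming (filter⁺ to Unique-filter⁺; take⁺ to Unique-take⁺)
  open import Data.Maybe.Base using (Maybe; just; nothing)
  open import Data.Nat.Base as ℕ using (ℕ; zero; suc; NonZero; z≤n)
  import Data.Nat.Properties as ℕ
  open import Data.Product.Base using (∃-syntax; _×_; _,_; proj₁; proj₂)
  open import Data.Rational.Base using (ℚ; 0ℚ; 1ℚ; ½; _+_; _*_; _-_; -_; _≤_; _<_; _/_; ↥_; ↧ₙ_; nonNegative; toℚᵘ; mkℚ)
  open import Data.Rational.Properties hiding (_≟_)
  open import Data.Rational.Solver using (module +-*-Solver)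
  import Data.Rational.Unnormalised.Base as ℚᵘ
  import Data.Rational.Unnormalised.Properties as ℚᵘ
  open import Data.Vec.Base as Vec using (Vec)
  open import Function.Base using (_∘_; id)
  open import Function.Bundles using (Equivalence)
  open import Relation.Binary.PropositionalEquality using (_≡_; _≢_; refl; sym; trans; cong; cong₂; subst; subst₂; module ≡-Reasoning)
  open import Relation.Nullary using (yes; no; does; contradiction)

  -- Inequalities between rationals are proved by exhibiting the difference as a
  -- sum of products of nonnegative terms.
  0≤+ : ∀ {x y} → 0ℚ ≤ x → 0ℚ ≤ y → 0ℚ ≤ x + y
  0≤+ {x} {y} 0≤x 0≤y = subst (_≤ x + y) (+-identityˡ 0ℚ) (+-mono-≤ 0≤x 0≤y)

  0≤* : ∀ {x y} → 0ℚ ≤ x → 0ℚ ≤ y → 0ℚ ≤ x * y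
  0≤* {x} {y} 0≤x 0≤y = nonNegative⁻¹ (x * y) {{nonNeg*nonNeg⇒nonNeg x {{nonNegative 0≤x}} y {{nonNegative 0≤y}}}}

  0≤- : ∀ {x y} → x ≤ y → 0ℚ ≤ y - x
  0≤- {x} {y} x≤y = subst (_≤ y - x) (+-inverseʳ x) (+-monoˡ-≤ (- x) x≤y)

  ≤-by : ∀ {x y d} → y - x ≡ d → 0ℚ ≤ d → x ≤ y
  ≤-by {x} {y} {d} eq 0≤d = subst₂ _≤_ (+-identityˡ x) (cancel x y) (+-monoˡ-≤ x (subst (0ℚ ≤_) (sym eq) 0≤d))
    where
    open +-*-Solver
    cancel : ∀ x y → y - x + x ≡ y
    cancel = solve 2 (λ x y → y :- x :+ x := y) refl

  *-monoˡ : ∀ {x y} r → 0ℚ ≤ r → x ≤ y → r * x ≤ r * y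
  *-monoˡ r 0≤r = *-monoˡ-≤-nonNeg r {{nonNegative 0≤r}}

  module _ where
    open +-*-Solver

    -- One more probe in the upper bound. The expected gain beyond the price, `p * (w - ν)`, is at
    -- most `g + p * G + λ′ * G`. Here `g` joins the sum, `λ′ * G` is one more share of the timeout,
    -- and `p * G` combines with `(1 - p) * G` from the failing branch to a single `G`, since a
    -- match ends the round.
    probe-≤ : ∀ {p w ν g H G λ′ C n s Fa Fs} → 0ℚ ≤ p → p ≤ 1ℚ → 0ℚ ≤ λ′ → 0ℚ ≤ G → 0ℚ ≤ n → 0ℚ ≤ s → H ≤ G →
      Fa ≤ C + (w - ν) → Fs ≤ C + (G + n * (λ′ * G) + s) → p * w ≤ g + p * (ν + H) + λ′ * H →
      p * Fa + (1ℚ - p) * Fs ≤ C + (G + (1ℚ + n) * (λ′ * G) + (g + s))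
    probe-≤ {p} {w} {ν} {g} {H} {G} {λ′} {C} {n} {s} {Fa} {Fs} 0≤p p≤1 0≤λ 0≤G 0≤n 0≤s H≤G Fa≤ Fs≤ pw≤ =
      ≤-by (solve 12 (λ p w ν g H G l C n s Fa Fs →
          C :+ (G :+ (con 1ℚ :+ n) :* (l :* G) :+ (g :+ s)) :- (p :* Fa :+ (con 1ℚ :- p) :* Fs) :=
          p :* (C :+ (w :- ν) :- Fa) :+ (con 1ℚ :- p) :* (C :+ (G :+ n :* (l :* G) :+ s) :- Fs)
            :+ (g :+ p :* (ν :+ H) :+ l :* H :- p :* w) :+ p :* (G :- H) :+ l :* (G :- H) :+ p :* (n :* (l :* G) :+ s))
          refl p w ν g H G λ′ C n s Fa Fs)
        (0≤+ (0≤+ (0≤+ (0≤+ (0≤+ (0≤* 0≤p (0≤- Fa≤)) (0≤* (0≤- p≤1) (0≤- Fs≤))) (0≤- pw≤)) (0≤* 0≤p (0≤- H≤G))) (0≤* 0≤λ (0≤- H≤G)))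
          (0≤* 0≤p (0≤+ (0≤* 0≤n (0≤* 0≤λ 0≤G)) 0≤s)))

    -- One more probe in the lower bound. The surcharges pay for what the probe destroys: `p * H`
    -- for the loss of `K` in case of a match, `λ′ * H` for the decrease from `1 + n` to `n`
    -- remaining probes. In the application `K` sums over the unmatched items behind the probed one,
    -- `H` over all items behind it.
    ≤-probe : ∀ {p w ν g H K λ′ C n Fa Fs} → 0ℚ ≤ p → p ≤ 1ℚ → 0ℚ ≤ λ′ → 0ℚ ≤ g → 0ℚ ≤ K → K ≤ H → (1ℚ + n) * λ′ ≤ 1ℚ →
      C + (w - ν) ≤ Fa → C + n * λ′ * K ≤ Fs → g + p * (ν + H) + λ′ * H ≤ p * w →
      C + (1ℚ + n) * λ′ * (g + K) ≤ p * Fa + (1ℚ - p) * Fs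
    ≤-probe {p} {w} {ν} {g} {H} {K} {λ′} {C} {n} {Fa} {Fs} 0≤p p≤1 0≤λ 0≤g 0≤K K≤H n≤ ≤Fa ≤Fs ≤pw =
      ≤-by (solve 11 (λ p w ν g H K l C n Fa Fs →
          p :* Fa :+ (con 1ℚ :- p) :* Fs :- (C :+ (con 1ℚ :+ n) :* l :* (g :+ K)) :=
          p :* (Fa :- (C :+ (w :- ν))) :+ (con 1ℚ :- p) :* (Fs :- (C :+ n :* l :* K))
            :+ (p :* w :- (g :+ p :* (ν :+ H) :+ l :* H)) :+ (con 1ℚ :- (con 1ℚ :+ n) :* l) :* g
            :+ l :* (H :- K) :+ p :* (H :- K) :+ p :* (K :* (con 1ℚ :- (con 1ℚ :+ n) :* l :+ l)))
          refl p w ν g H K λ′ C n Fa Fs)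
        (0≤+ (0≤+ (0≤+ (0≤+ (0≤+ (0≤+ (0≤* 0≤p (0≤- ≤Fa)) (0≤* (0≤- p≤1) (0≤- ≤Fs))) (0≤- ≤pw)) (0≤* (0≤- n≤) 0≤g))
          (0≤* 0≤λ (0≤- K≤H))) (0≤* 0≤p (0≤- K≤H))) (0≤* 0≤p (0≤* 0≤K (0≤+ (0≤- n≤) 0≤λ))))

  ι : ℕ → ℚ
  ι n = ℤ.+ n / 1

  private
    toℚᵘ-/1 : ∀ n → toℚᵘ (ℤ.+ n / 1) ℚᵘ.≃ ℚᵘ.mkℚᵘ (ℤ.+ n) 0
    toℚᵘ-/1 n = toℚᵘ-fromℚᵘ (ℚᵘ.mkℚᵘ (ℤ.+ n) 0)

  ι-+ : ∀ m n → ι (m ℕ.+ n) ≡ ι m + ι n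
  ι-+ m n = toℚᵘ-injective (ℚᵘ.≃-trans (toℚᵘ-/1 (m ℕ.+ n)) (ℚᵘ.≃-trans (ℚᵘ.*≡* eq)
    (ℚᵘ.≃-sym (ℚᵘ.≃-trans (toℚᵘ-homo-+ (ι m) (ι n)) (ℚᵘ.+-cong (toℚᵘ-/1 m) (toℚᵘ-/1 n))))))
    where
    eq : ℤ.+ (m ℕ.+ n) ℤ.* ℤ.+ 1 ≡ (ℤ.+ m ℤ.* ℤ.+ 1 ℤ.+ ℤ.+ n ℤ.* ℤ.+ 1) ℤ.* ℤ.+ 1
    eq = cong (ℤ._* ℤ.+ 1) (cong₂ ℤ._+_ (sym (ℤ.*-identityʳ (ℤ.+ m))) (sym (ℤ.*-identityʳ (ℤ.+ n))))

  ι-* : ∀ m n → ι (m ℕ.* n) ≡ ι m * ι n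
  ι-* m n = toℚᵘ-injective (ℚᵘ.≃-trans (toℚᵘ-/1 (m ℕ.* n)) (ℚᵘ.≃-trans (ℚᵘ.*≡* eq)
    (ℚᵘ.≃-sym (ℚᵘ.≃-trans (toℚᵘ-homo-* (ι m) (ι n)) (ℚᵘ.*-cong (toℚᵘ-/1 m) (toℚᵘ-/1 n))))))
    where
    eq : ℤ.+ (m ℕ.* n) ℤ.* ℤ.+ 1 ≡ (ℤ.+ m ℤ.* ℤ.+ n) ℤ.* ℤ.+ 1
    eq = cong (ℤ._* ℤ.+ 1) (ℤ.pos-* m n)

  0≤/ : ∀ n d .{{_ : NonZero d}} → 0ℚ ≤ ℤ.+ n / d
  0≤/ n d = nonNegative⁻¹ (ℤ.+ n / d) {{normalize-nonNeg n d}}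

  0≤ι : ∀ n → 0ℚ ≤ ι n
  0≤ι n = 0≤/ n 1

  ι-mono : ∀ {m n} → m ℕ.≤ n → ι m ≤ ι n
  ι-mono {m} {n} m≤n = subst₂ _≤_ (+-identityʳ (ι m)) (trans (sym (ι-+ m (n ℕ.∸ m))) (cong ι (ℕ.m+[n∸m]≡n m≤n)))
    (+-monoʳ-≤ (ι m) (0≤ι (n ℕ.∸ m)))

  /-*ι : ∀ n d .{{_ : NonZero d}} → (ℤ.+ n / d) * ι d ≡ ι n
  /-*ι n d@(suc d-1) = toℚᵘ-injective (ℚᵘ.≃-trans (toℚᵘ-homo-* (ℤ.+ n / d) (ι d))
    (ℚᵘ.≃-trans (ℚᵘ.*-cong (toℚᵘ-fromℚᵘ (ℚᵘ.mkℚᵘ (ℤ.+ n) d-1)) (toℚᵘ-/1 d))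
      (ℚᵘ.≃-trans (ℚᵘ.*≡* eq) (ℚᵘ.≃-sym (toℚᵘ-/1 n)))))
    where
    eq : (ℤ.+ n ℤ.* ℤ.+ d) ℤ.* ℤ.+ 1 ≡ ℤ.+ n ℤ.* ℤ.+ (d ℕ.* 1)
    eq = trans (ℤ.*-identityʳ (ℤ.+ n ℤ.* ℤ.+ d)) (cong (λ m → ℤ.+ n ℤ.* ℤ.+ m) (sym (ℕ.*-identityʳ d)))

  ℚ-*↧ : ∀ p → 0ℚ ≤ p → p * ι (↧ₙ p) ≡ ι ℤ.∣ ↥ p ∣
  ℚ-*↧ p@(mkℚ n d-1 _) 0≤p = begin
    p * ι (↧ₙ p)                               ≡⟨ cong (_* ι (↧ₙ p)) (sym (↥p/↧p≡p p)) ⟩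
    (↥ p / ↧ₙ p) * ι (↧ₙ p)                    ≡⟨ cong (λ m → (m / ↧ₙ p) * ι (↧ₙ p)) (sym (ℤ.0≤i⇒+∣i∣≡i (nonneg 0≤p))) ⟩
    (ℤ.+ ℤ.∣ ↥ p ∣ / ↧ₙ p) * ι (↧ₙ p)            ≡⟨ /-*ι ℤ.∣ ↥ p ∣ (↧ₙ p) ⟩
    ι ℤ.∣ ↥ p ∣                                ∎
    where
    open ≡-Reasoning
    nonneg : 0ℚ ≤ p → ℤ.+ 0 ℤ.≤ ↥ p
    nonneg (_≤_.*≤* 0≤) = subst (ℤ.+ 0 ℤ.≤_) (ℤ.*-identityʳ n) 0≤

  *ι-cancel-≤ : ∀ n .{{_ : NonZero n}} {x y} → x * ι n ≤ y * ι n → x ≤ y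
  *ι-cancel-≤ (suc n) = *-cancelʳ-≤-pos (ι (suc n)) {{normalize-pos (suc n) 1}}

  *ι-cancel : ∀ n .{{_ : NonZero n}} {x y} → x * ι n ≡ y * ι n → x ≡ y
  *ι-cancel n eq = ≤-antisym (*ι-cancel-≤ n (≤-reflexive eq)) (*ι-cancel-≤ n (≤-reflexive (sym eq)))

  ∑ : ∀ {X : Set} → (X → ℚ) → List X → ℚ
  ∑ f []       = 0ℚ
  ∑ f (x ∷ xs) = f x + ∑ f xs

  module _ {X : Set} where

    ∑-cong : {f g : X → ℚ} → (∀ x → f x ≡ g x) → ∀ xs → ∑ f xs ≡ ∑ g xs
    ∑-cong f≗g []       = refl
    ∑-cong f≗g (x ∷ xs) = cong₂ _+_ (f≗g x) (∑-cong f≗g xs)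

    ∑-mono : {f g : X → ℚ} → (∀ x → f x ≤ g x) → ∀ xs → ∑ f xs ≤ ∑ g xs
    ∑-mono f≤g []       = ≤-refl
    ∑-mono f≤g (x ∷ xs) = +-mono-≤ (f≤g x) (∑-mono f≤g xs)

    ∑-0 : ∀ xs → ∑ (λ (_ : X) → 0ℚ) xs ≡ 0ℚ
    ∑-0 []       = refl
    ∑-0 (x ∷ xs) = trans (+-identityˡ _) (∑-0 xs)

    0≤∑ : {f : X → ℚ} → (∀ x → 0ℚ ≤ f x) → ∀ xs → 0ℚ ≤ ∑ f xs
    0≤∑ 0≤f xs = subst (_≤ ∑ _ xs) (∑-0 xs) (∑-mono 0≤f xs)

    ∑-+ : ∀ (f g : X → ℚ) xs → ∑ (λ x → f x + g x) xs ≡ ∑ f xs + ∑ g xs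
    ∑-+ f g []       = refl
    ∑-+ f g (x ∷ xs) = trans (cong ((f x + g x) +_) (∑-+ f g xs)) (swap (f x) (g x) (∑ f xs) (∑ g xs))
      where
      open +-*-Solver
      swap : ∀ a b c d → a + b + (c + d) ≡ a + c + (b + d)
      swap = solve 4 (λ a b c d → a :+ b :+ (c :+ d) := a :+ c :+ (b :+ d)) refl

    ∑-*ˡ : ∀ c (f : X → ℚ) xs → ∑ (λ x → c * f x) xs ≡ c * ∑ f xs
    ∑-*ˡ c f []       = sym (*-zeroʳ c)
    ∑-*ˡ c f (x ∷ xs) = trans (cong (c * f x +_) (∑-*ˡ c f xs)) (sym (*-distribˡ-+ c (f x) (∑ f xs)))

    ∑-*ʳ : ∀ c (f : X → ℚ) xs → ∑ (λ x → f x * c) xs ≡ ∑ f xs * c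
    ∑-*ʳ c f xs = trans (∑-cong (λ x → *-comm (f x) c) xs) (trans (∑-*ˡ c f xs) (*-comm c (∑ f xs)))

    ∑-++ : ∀ (f : X → ℚ) xs ys → ∑ f (xs ++ ys) ≡ ∑ f xs + ∑ f ys
    ∑-++ f []       ys = sym (+-identityˡ _)
    ∑-++ f (x ∷ xs) ys = trans (cong (f x +_) (∑-++ f xs ys)) (sym (+-assoc (f x) (∑ f xs) (∑ f ys)))

  ∑-swap : ∀ {X Y : Set} (f : X → Y → ℚ) xs ys → ∑ (λ x → ∑ (f x) ys) xs ≡ ∑ (λ y → ∑ (λ x → f x y) xs) ys
  ∑-swap f []       ys = sym (∑-0 ys)
  ∑-swap f (x ∷ xs) ys = trans (cong (∑ (f x) ys +_) (∑-swap f xs ys)) (sym (∑-+ (f x) (λ y → ∑ (λ x → f x y) xs) ys))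

  ∑-agree : ∀ {X : Set} {f g : X → ℚ} {x} → (∀ y → x ≢ y → g y ≡ f y) → ∀ {ys} → All (x ≢_) ys → ∑ g ys ≡ ∑ f ys
  ∑-agree g≡f []           = refl
  ∑-agree g≡f (x≢y ∷ x∉ys) = cong₂ _+_ (g≡f _ x≢y) (∑-agree g≡f x∉ys)

  ∑-remove : ∀ {X : Set} (f g : X → ℚ) x → g x ≡ 0ℚ → (∀ y → x ≢ y → g y ≡ f y) → ∀ {xs} → Unique xs → x ∈ xs →
    ∑ g xs + f x ≡ ∑ f xs
  ∑-remove f g x gx≡0 g≡f {_ ∷ xs} (x∉xs ∷ _) (here refl) =
    trans (cong₂ (λ a b → a + b + f x) gx≡0 (∑-agree g≡f x∉xs)) (trans (cong (_+ f x) (+-identityˡ (∑ f xs))) (+-comm (∑ f xs) (f x)))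
  ∑-remove f g x gx≡0 g≡f {y ∷ xs} (y∉xs ∷ u) (there x∈xs) =
    trans (+-assoc (g y) (∑ g xs) (f x)) (cong₂ _+_ (g≡f y (λ { refl → All.lookup y∉xs x∈xs refl })) (∑-remove f g x gx≡0 g≡f u x∈xs))

  -- The induction sets `f` to 0 at `x`: this does not affect the tail, which avoids `x`, and lowers
  -- the full sum by `f x`.
  ∑-sublist : ∀ {n} (f : Fin n → ℚ) → (∀ x → 0ℚ ≤ f x) → ∀ {xs} → Unique xs → ∑ f xs ≤ ∑ f (allFin n)
  ∑-sublist {n} f 0≤f []                = 0≤∑ 0≤f (allFin n)
  ∑-sublist {n} f 0≤f {x ∷ xs} (x∉xs ∷ u) = subst₂ _≤_ (trans (+-comm _ (f x)) (cong (f x +_) (∑-agree g≡f x∉xs)))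
    (∑-remove f g x gx≡0 g≡f (allFin⁺ n) (∈-allFin x)) (+-monoˡ-≤ (f x) (∑-sublist g 0≤g u))
    where
    g : Fin n → ℚ
    g y = ifᵇ does (x ≟ y) then 0ℚ else f y
    gx≡0 : g x ≡ 0ℚ
    gx≡0 with x ≟ x
    ... | yes _  = refl
    ... | no x≢x = contradiction refl x≢x
    g≡f : ∀ y → x ≢ y → g y ≡ f y
    g≡f y x≢y with x ≟ y
    ... | yes x≡y = contradiction x≡y x≢y
    ... | no _    = refl
    0≤g : ∀ y → 0ℚ ≤ g y
    0≤g y with x ≟ y
    ... | yes _ = ≤-refl
    ... | no _  = 0≤f y

  module _ {X : Set} (f : X → ℚ) where

    expectation-++ : ∀ d e → expectation f (d ++ e) ≡ expectation f d + expectation f e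
    expectation-++ []            e = sym (+-identityˡ _)
    expectation-++ ((p , x) ∷ d) e = trans (cong (p * f x +_) (expectation-++ d e)) (sym (+-assoc (p * f x) _ _))

    expectation-scale : ∀ p d → expectation f (map (λ (q , y) → (p * q , y)) d) ≡ p * expectation f d
    expectation-scale p []            = sym (*-zeroʳ p)
    expectation-scale p ((q , x) ∷ d) = trans (cong₂ _+_ (*-assoc p q (f x)) (expectation-scale p d)) (sym (*-distribˡ-+ p (q * f x) _))

    expectation->>= : ∀ {Y : Set} (d : Dist Y) k → expectation f (d >>= k) ≡ expectation (λ y → expectation f (k y)) d
    expectation->>= []            k = refl
    expectation->>= ((p , y) ∷ d) k = trans (expectation-++ (map (λ (q , y) → (p * q , y)) (k y)) _)
      (cong₂ _+_ (expectation-scale p (k y)) (expectation->>= d k))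

    expectation-return : ∀ x → expectation f (return x) ≡ f x
    expectation-return x = trans (+-identityʳ (1ℚ * f x)) (*-identityˡ (f x))

    expectation-tabulate : ∀ {m n} (d : Fin n → ℚ × X) (i : Fin m → Fin n) →
      expectation f (tabulate (λ j → d (i j))) ≡ ∑ (λ j → proj₁ (d j) * f (proj₂ (d j))) (tabulate i)
    expectation-tabulate {zero}  d i = refl
    expectation-tabulate {suc m} d i = cong (proj₁ (d (i zero)) * f (proj₂ (d (i zero))) +_) (expectation-tabulate d (i ∘ suc))

  expectation-bernoulli : ∀ f p → expectation f (bernoulli p) ≡ p * f true + (1ℚ - p) * f false
  expectation-bernoulli f p = cong (p * f true +_) (+-identityʳ _)

  -- An average is at most a common bound of its terms. This reduces randomized opponents to
  -- deterministic policies.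
  expectation-coins-≤ : ∀ {c} m (f : Vec Bool m → ℚ) → (∀ r → f r ≤ c) → expectation f (fairCoins m) ≤ c
  expectation-coins-≤ zero    f f≤ = subst (_≤ _) (sym (expectation-return f Vec.[])) (f≤ Vec.[])
  expectation-coins-≤ {c} (suc m) f f≤ = begin
    expectation f (fairCoins (suc m))       ≡⟨ expectation->>= f (bernoulli ½) flips ⟩
    expectation (λ b → expectation f (flips b)) (bernoulli ½) ≡⟨ expectation-bernoulli (λ b → expectation f (flips b)) ½ ⟩
    ½ * expectation f (flips true) + (1ℚ - ½) * expectation f (flips false)
      ≤⟨ +-mono-≤ (*-monoˡ ½ (nonNegative⁻¹ ½) (tail≤ true)) (*-monoˡ ½ (nonNegative⁻¹ ½) (tail≤ false)) ⟩
    ½ * c + ½ * c                           ≡⟨ average c ⟩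
    c                                       ∎
    where
    open ≤-Reasoning
    flips : Bool → Dist (Vec Bool (suc m))
    flips b = fairCoins m >>= λ cs → return (b Vec.∷ cs)
    average : ∀ c → ½ * c + ½ * c ≡ c
    average = solve 1 (λ c → con ½ :* c :+ con ½ :* c := c) refl
      where open +-*-Solver
    tail≤ : ∀ b → expectation f (flips b) ≤ c
    tail≤ b = subst (_≤ c) (sym (expectation->>= f (fairCoins m) (λ cs → return (b Vec.∷ cs))))
      (expectation-coins-≤ m _ λ cs → subst (_≤ c) (sym (expectation-return f (b Vec.∷ cs))) (f≤ (b Vec.∷ cs)))

  split : ∀ {X : Set} {x : X} {xs} → x ∈ xs → ∃[ ys ] ∃[ zs ] xs ≡ ys ++ x ∷ zs
  split (here refl) = [] , _ , refl
  split (there x∈xs) with split x∈xs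
  ... | ys , zs , eq = _ ∷ ys , zs , cong (_ ∷_) eq

  -- Price policies against arbitrary policies

  module Analysis (I : Instance) where
    open Instance I

    isItem : Maybe (Fin items) → Fin items → Bool
    isItem nothing  a = false
    isItem (just x) a = does (x ≟ a)

    free : History I → Fin items → Bool
    free []      a = true
    free (e ∷ h) a = not (isItem (Event.matched e) a) ∧ free h a

    free⇒Unmatched : ∀ h a → T (free h a) → Unmatched I h a
    free⇒Unmatched [] a _ = []
    free⇒Unmatched (event b as nothing ∷ h) a f = (λ ()) ∷ free⇒Unmatched h a f
    free⇒Unmatched (event b as (just x) ∷ h) a f with x ≟ a
    ... | no x≢a = (λ { refl → x≢a refl }) ∷ free⇒Unmatched h a f

    Unmatched⇒free : ∀ h a → Unmatched I h a → free h a ≡ true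
    Unmatched⇒free [] a _ = refl
    Unmatched⇒free (event b as nothing ∷ h) a (_ ∷ u) = Unmatched⇒free h a u
    Unmatched⇒free (event b as (just x) ∷ h) a (x≢ ∷ u) with x ≟ a
    ... | yes refl = contradiction refl x≢
    ... | no _     = Unmatched⇒free h a u

    p w : Fin items → Fin types → ℚ
    p = prob
    w = profit

    q : Fin types → ℚ
    q b = ℤ.+ multiplicity b / rounds

    τ : Fin types → ℚ
    τ b = _/_ (ℤ.+ 1) (timeout b) {{timeout>0 b}}

    itemsL : List (Fin items)
    itemsL = allFin items

    typesL : List (Fin types)
    typesL = allFin types

    0≤p : ∀ a b → 0ℚ ≤ p a b
    0≤p a b = <⇒≤ (prob>0 a b)

    0≤q : ∀ b → 0ℚ ≤ q b
    0≤q b = 0≤/ (multiplicity b) rounds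

    0≤τ : ∀ b → 0ℚ ≤ τ b
    0≤τ b = 0≤/ 1 (timeout b) {{timeout>0 b}}

    timeout*τ : ∀ b → ι (timeout b) * τ b ≡ 1ℚ
    timeout*τ b = trans (*-comm (ι (timeout b)) (τ b)) (/-*ι 1 (timeout b) {{timeout>0 b}})

    ≤timeout*τ : ∀ n b → n ℕ.≤ timeout b → ι n * τ b ≤ 1ℚ
    ≤timeout*τ n b n≤t = subst (ι n * τ b ≤_) (timeout*τ b) (*-monoʳ-≤-nonNeg (τ b) {{nonNegative (0≤τ b)}} (ι-mono n≤t))

    ∑q≡1 : ∑ q typesL ≡ 1ℚ
    ∑q≡1 = *ι-cancel rounds (begin
      ∑ q typesL * ι rounds                      ≡⟨ sym (∑-*ʳ (ι rounds) q typesL) ⟩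
      ∑ (λ b → q b * ι rounds) typesL            ≡⟨ ∑-cong (λ b → /-*ι (multiplicity b) rounds) typesL ⟩
      ∑ (λ b → ι (multiplicity b)) typesL        ≡⟨ ∑ι id ⟩
      ι (foldr ℕ._+_ 0 (tabulate multiplicity))  ≡⟨ cong ι multiplicity-sum ⟩
      ι rounds                                   ≡⟨ sym (*-identityˡ (ι rounds)) ⟩
      1ℚ * ι rounds                              ∎)
      where
      open ≡-Reasoning
      ∑ι : ∀ {m} (i : Fin m → Fin types) →
        ∑ (λ b → ι (multiplicity b)) (tabulate i) ≡ ι (foldr ℕ._+_ 0 (tabulate (λ j → multiplicity (i j))))
      ∑ι {zero}  i = refl
      ∑ι {suc m} i = trans (cong (ι (multiplicity (i zero)) +_) (∑ι (λ j → i (suc j)))) (sym (ι-+ (multiplicity (i zero)) _))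

    average : (Fin types → ℚ) → ℚ
    average f = ∑ (λ b → q b * f b) typesL

    average-mono : ∀ {f g} → (∀ b → f b ≤ g b) → average f ≤ average g
    average-mono f≤g = ∑-mono (λ b → *-monoˡ (q b) (0≤q b) (f≤g b)) typesL

    average-shift : ∀ c f → average (λ b → c + f b) ≡ c + average f
    average-shift c f = begin
      ∑ (λ b → q b * (c + f b)) typesL                  ≡⟨ ∑-cong (λ b → *-distribˡ-+ (q b) c (f b)) typesL ⟩
      ∑ (λ b → q b * c + q b * f b) typesL              ≡⟨ ∑-+ (λ b → q b * c) (λ b → q b * f b) typesL ⟩
      ∑ (λ b → q b * c) typesL + average f              ≡⟨ cong (_+ average f) (trans (∑-*ʳ c q typesL) (trans (cong (_* c) ∑q≡1) (*-identityˡ c))) ⟩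
      c + average f                                     ∎
      where open ≡-Reasoning

    average-∑ : ∀ {X : Set} (f : X → Fin types → ℚ) xs → average (λ b → ∑ (λ x → f x b) xs) ≡ ∑ (λ x → average (f x)) xs
    average-∑ f xs = trans (∑-cong (λ b → sym (∑-*ˡ (q b) (λ x → f x b) xs)) typesL) (∑-swap (λ b x → q b * f x b) typesL xs)

    average-* : ∀ c f → average (λ b → c * f b) ≡ c * average f
    average-* c f = trans (∑-cong (λ b → swap (q b) c (f b)) typesL) (∑-*ˡ c (λ b → q b * f b) typesL)
      where
      open +-*-Solver
      swap : ∀ q c x → q * (c * x) ≡ c * (q * x)
      swap = solve 3 (λ q c x → q :* (c :* x) := c :* (q :* x)) refl

    value : Policy I → ℕ → History I → ℚ
    value π k h = expectation (totalProfit I) (play I π k h)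

    afterProbe : Policy I → ℕ → History I → Fin types → Maybe (Fin items) → ℚ
    afterProbe π k h b m = value π k (event b (Policy.choose π h b) m ∷ h)

    value-suc : ∀ π k h → value π (suc k) h ≡ average (λ b → expectation (afterProbe π k h b) (probe I b (Policy.choose π h b)))
    value-suc π k h = trans (expectation->>= (totalProfit I) arrival _)
      (trans (expectation-tabulate _ (λ b → q b , b) id)
        (∑-cong (λ b → cong (q b *_) (expectation->>= (totalProfit I) (probe I b (Policy.choose π h b)) _)) typesL))

    expectation-probe-∷ : ∀ F b a as →
      expectation F (probe I b (a ∷ as)) ≡ p a b * F (just a) + (1ℚ - p a b) * expectation F (probe I b as)
    expectation-probe-∷ F b a as = cong₂ _+_ (cong (_* F (just a)) (*-identityʳ (p a b)))
      (trans (expectation-++ F (map (λ (x , m) → (1ℚ - p a b) * x , m) (probe I b as)) [])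
        (trans (+-identityʳ _) (expectation-scale F (1ℚ - p a b) (probe I b as))))

    -- An item a is probed for a buyer of type b with k further rounds to come
    -- only if it is worth its price ν, the expected gain from the items zs that
    -- could be probed later in the round, and one unit of the timeout.
    record Prices : Set where
      field
        ν      : ℕ → Fin items → ℚ
        g      : ℕ → Fin items → Fin types → ℚ
        accept : ℕ → Fin items → Fin types → Bool
        ν-zero : ∀ a → ν 0 a ≡ 0ℚ
        ν-suc  : ∀ {k} → k ℕ.< rounds → ∀ a → ν (suc k) a ≡ ν k a + average (g k a)
        0≤g    : ∀ k a b → 0ℚ ≤ g k a b
        g-max  : ∀ {k} → k ℕ.< rounds → ∀ ys a zs b → itemsL ≡ ys ++ a ∷ zs →
          let H = ∑ (λ x → g k x b) zs in p a b * w a b ≤ g k a b + p a b * (ν k a + H) + τ b * H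
        g-accept : ∀ {k} → k ℕ.< rounds → ∀ ys a zs b → itemsL ≡ ys ++ a ∷ zs → accept k a b ≡ true →
          let H = ∑ (λ x → g k x b) zs in g k a b + p a b * (ν k a + H) + τ b * H ≤ p a b * w a b
        g-reject : ∀ {k} → k ℕ.< rounds → ∀ a b → accept k a b ≡ false → g k a b ≡ 0ℚ

    module _ (P : Prices) where
      open Prices P

      wanted : ℕ → History I → Fin types → Fin items → Bool
      wanted k h b a = accept k a b ∧ free h a

      selection : ℕ → History I → Fin types → List (Fin items) → List (Fin items)
      selection k h b = filter (λ a → T? (wanted k h b a))

      pricePolicy : Policy I
      pricePolicy = record
        -- The number of rounds after the current one. Truncated subtraction gives a legal choice
        -- also on histories that are too long to occur.
        { choose = λ h b → take (timeout b) (selection (rounds ℕ.∸ suc (length h)) h b itemsL)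
        ; legal  = λ h b → let k = rounds ℕ.∸ suc (length h) in
            subst (ℕ._≤ timeout b) (sym (length-take (timeout b) (selection k h b itemsL))) (ℕ.m⊓n≤m _ _) ,
            Unique-take⁺ (timeout b) (Unique-filter⁺ (λ a → T? (wanted k h b a)) (allFin⁺ items)) ,
            All-take⁺ (timeout b) (All.map (λ {a} wa → free⇒Unmatched h a (proj₂ (Equivalence.to T-∧ wa)))
              (all-filter (λ a → T? (wanted k h b a)) itemsL))
        }

      whenFree : History I → (Fin items → ℚ) → Fin items → ℚ
      whenFree h f a = ifᵇ free h a then f a else 0ℚ

      freeSum : History I → (Fin items → ℚ) → ℚ
      freeSum h f = ∑ (whenFree h f) itemsL

      -- A match trades the price of `a` for its profit: the profit so far plus the prices of the
      -- unmatched items changes by `w - ν`. Both bounds follow this quantity through the process.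
      freeSum-match : ∀ h b as a f → free h a ≡ true → freeSum (event b as (just a) ∷ h) f ≡ freeSum h f - f a
      freeSum-match h b as a f free-a = begin
        freeSum h′ f                        ≡⟨ sym (cancel (freeSum h′ f) (f a)) ⟩
        freeSum h′ f + f a - f a            ≡⟨ cong (λ x → freeSum h′ f + x - f a) (sym (cong (λ c → ifᵇ c then f a else 0ℚ) free-a)) ⟩
        freeSum h′ f + whenFree h f a - f a ≡⟨ cong (_- f a) (∑-remove (whenFree h f) (whenFree h′ f) a at-a elsewhere (allFin⁺ items) (∈-allFin a)) ⟩
        freeSum h f - f a                   ∎
        where
        open ≡-Reasoning
        h′ = event b as (just a) ∷ h
        cancel : ∀ x y → x + y - y ≡ x
        cancel = solve 2 (λ x y → x :+ y :- y := x) refl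
          where open +-*-Solver
        at-a : whenFree h′ f a ≡ 0ℚ
        at-a with a ≟ a
        ... | yes _  = refl
        ... | no a≢a = contradiction refl a≢a
        elsewhere : ∀ x → a ≢ x → whenFree h′ f x ≡ whenFree h f x
        elsewhere x a≢x with a ≟ x
        ... | yes a≡x = contradiction a≡x a≢x
        ... | no _    = refl

      0≤ν : ∀ k → k ℕ.≤ rounds → ∀ a → 0ℚ ≤ ν k a
      0≤average-g : ∀ k a → 0ℚ ≤ average (g k a)
      0≤average-g k a = 0≤∑ (λ b → 0≤* (0≤q b) (0≤g k a b)) typesL
      0≤ν zero    k≤n a = ≤-reflexive (sym (ν-zero a))
      0≤ν (suc k) k<n a = subst (0ℚ ≤_) (sym (ν-suc k<n a)) (0≤+ (0≤ν k (ℕ.<⇒≤ k<n) a) (0≤average-g k a))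

      whenFree-mono : ∀ h {f f′ : Fin items → ℚ} → (∀ a → f a ≤ f′ a) → ∀ a → whenFree h f a ≤ whenFree h f′ a
      whenFree-mono h f≤f′ a with free h a
      ... | true  = f≤f′ a
      ... | false = ≤-refl

      -- The lower bound

      selection-≤ : ∀ {k} → k ℕ.< rounds → ∀ h b F C → C ≤ F nothing →
        (∀ a → free h a ≡ true → C + (w a b - ν k a) ≤ F (just a)) →
        ∀ ys zs → itemsL ≡ ys ++ zs → ∀ n → n ℕ.≤ timeout b →
        C + ι n * τ b * ∑ (whenFree h (λ a → g k a b)) zs ≤ expectation F (probe I b (take n (selection k h b zs)))
      selection-≤ {k} k<n h b F C none some = go
        where
        nothing-left : ∀ {x} → x ≡ 0ℚ → C + x ≤ expectation F (probe I b [])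
        nothing-left refl = subst₂ _≤_ (sym (+-identityʳ C)) (sym (expectation-return F nothing)) none
        gᶠ : Fin items → ℚ
        gᶠ = whenFree h (λ a → g k a b)
        0≤gᶠ : ∀ a → 0ℚ ≤ gᶠ a
        0≤gᶠ a with free h a
        ... | true  = 0≤g k a b
        ... | false = ≤-refl
        gᶠ≤g : ∀ a → gᶠ a ≤ g k a b
        gᶠ≤g a with free h a
        ... | true  = ≤-refl
        ... | false = 0≤g k a b
        -- Induction along the fixed order with `n` probes left. A skipped item contributes 0 and
        -- leaves `n` as it is; a probed item pays for itself and for the lost probe by `≤-probe`.
        go : ∀ ys zs → itemsL ≡ ys ++ zs → ∀ n → n ℕ.≤ timeout b →
          C + ι n * τ b * ∑ gᶠ zs ≤ expectation F (probe I b (take n (selection k h b zs)))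
        go ys []       eq zero    n≤t = nothing-left (*-zeroʳ (ι zero * τ b))
        go ys []       eq (suc n) n≤t = nothing-left (*-zeroʳ (ι (suc n) * τ b))
        go ys (a ∷ zs) eq zero    n≤t = nothing-left (trans (cong (_* ∑ gᶠ (a ∷ zs)) (*-zeroˡ (τ b))) (*-zeroˡ (∑ gᶠ (a ∷ zs))))
        go ys (a ∷ zs) eq (suc n) n≤t = step
          where
          skip : ∀ {x} → x ≡ 0ℚ → C + ι (suc n) * τ b * (x + ∑ gᶠ zs) ≤ expectation F (probe I b (take (suc n) (selection k h b zs)))
          skip refl = subst (λ x → C + ι (suc n) * τ b * x ≤ expectation F (probe I b (take (suc n) (selection k h b zs))))
            (sym (+-identityˡ (∑ gᶠ zs))) (go (ys ++ a ∷ []) zs (trans eq (sym (++-assoc ys (a ∷ []) zs))) (suc n) n≤t)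
          step : C + ι (suc n) * τ b * ∑ gᶠ (a ∷ zs) ≤ expectation F (probe I b (take (suc n) (selection k h b (a ∷ zs))))
          step with accept k a b in acc | free h a in fr
          ... | false | true  = skip (g-reject k<n a b acc)
          ... | false | false = skip refl
          ... | true  | false = skip refl
          ... | true  | true  = subst₂ (λ s e → C + s * τ b * (g k a b + ∑ gᶠ zs) ≤ e)
            (sym (ι-+ 1 n)) (sym (expectation-probe-∷ F b a (take n (selection k h b zs))))
            (≤-probe {w = w a b} {ν k a} {C = C} {ι n} (0≤p a b) (prob≤1 a b) (0≤τ b) (0≤g k a b) (0≤∑ 0≤gᶠ zs) (∑-mono gᶠ≤g zs)
              (subst (λ s → s * τ b ≤ 1ℚ) (ι-+ 1 n) (≤timeout*τ (suc n) b n≤t))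
              (some a fr) (go (ys ++ a ∷ []) zs (trans eq (sym (++-assoc ys (a ∷ []) zs))) n (ℕ.<⇒≤ n≤t))
              (g-accept k<n ys a zs b eq acc))

      freeSum-suc : ∀ {k} → k ℕ.< rounds → ∀ h → freeSum h (ν (suc k)) ≡ freeSum h (ν k) + average (λ b → freeSum h (λ a → g k a b))
      freeSum-suc {k} k<n h = begin
        ∑ (whenFree h (ν (suc k))) itemsL ≡⟨ ∑-cong pointwise itemsL ⟩
        ∑ (λ a → whenFree h (ν k) a + average (λ b → whenFree h (λ a → g k a b) a)) itemsL ≡⟨ ∑-+ (whenFree h (ν k)) _ itemsL ⟩
        freeSum h (ν k) + ∑ (λ a → average (λ b → whenFree h (λ a → g k a b) a)) itemsL
          ≡⟨ cong (freeSum h (ν k) +_) (sym (average-∑ (λ a b → whenFree h (λ a → g k a b) a) itemsL)) ⟩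
        freeSum h (ν k) + average (λ b → freeSum h (λ a → g k a b)) ∎
        where
        open ≡-Reasoning
        pointwise : ∀ a → whenFree h (ν (suc k)) a ≡ whenFree h (ν k) a + average (λ b → whenFree h (λ a → g k a b) a)
        pointwise a with free h a
        ... | true  = ν-suc k<n a
        ... | false = sym (trans (+-identityˡ _) (trans (∑-cong (λ b → *-zeroʳ (q b)) typesL) (∑-0 typesL)))

      -- Under the price policy the profit so far plus the prices of the unmatched items is a
      -- submartingale. Passing from `ν (suc k)` to `ν k` lowers it by the average of the sums of
      -- `g`, and the round earns this back by `selection-≤`, where the full timeout makes
      -- `ι n * τ b` equal to 1.
      price-lower : ∀ k h → k ℕ.+ length h ≡ rounds → totalProfit I h + freeSum h (ν k) ≤ value pricePolicy k h
      price-lower zero    h eq = ≤-reflexive (trans (cong (totalProfit I h +_) free-0)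
        (trans (+-identityʳ (totalProfit I h)) (sym (expectation-return (totalProfit I) h))))
        where
        zero-free : ∀ a → whenFree h (ν 0) a ≡ 0ℚ
        zero-free a with free h a
        ... | true  = ν-zero a
        ... | false = refl
        free-0 : freeSum h (ν 0) ≡ 0ℚ
        free-0 = trans (∑-cong zero-free itemsL) (∑-0 itemsL)
      price-lower (suc k) h eq = begin
        totalProfit I h + freeSum h (ν (suc k))           ≡⟨ cong (totalProfit I h +_) (freeSum-suc k<n h) ⟩
        totalProfit I h + (freeSum h (ν k) + average G)   ≡⟨ sym (+-assoc (totalProfit I h) _ _) ⟩
        C + average G                                     ≡⟨ sym (average-shift C G) ⟩
        average (λ b → C + G b)                           ≤⟨ average-mono round ⟩
        average (λ b → expectation (afterProbe pricePolicy k h b) (probe I b (Policy.choose pricePolicy h b)))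
                                                          ≡⟨ sym (value-suc pricePolicy k h) ⟩
        value pricePolicy (suc k) h                       ∎
        where
        open ≤-Reasoning
        k<n : k ℕ.< rounds
        k<n = subst (suc k ℕ.≤_) eq (ℕ.m≤m+n (suc k) (length h))
        C : ℚ
        C = totalProfit I h + freeSum h (ν k)
        G : Fin types → ℚ
        G b = freeSum h (λ a → g k a b)
        k≡ : rounds ℕ.∸ suc (length h) ≡ k
        k≡ = trans (cong (ℕ._∸ suc (length h)) (trans (sym eq) (sym (ℕ.+-suc k (length h))))) (ℕ.m+n∸n≡m k (suc (length h)))
        later : ∀ b as m → totalProfit I (event b as m ∷ h) + freeSum (event b as m ∷ h) (ν k) ≤ value pricePolicy k (event b as m ∷ h)
        later b as m = price-lower k (event b as m ∷ h) (trans (ℕ.+-suc k (length h)) eq)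
        round : ∀ b → C + G b ≤ expectation (afterProbe pricePolicy k h b) (probe I b (Policy.choose pricePolicy h b))
        round b = subst₂ (λ x s → C + x ≤ expectation F (probe I b (take (timeout b) (selection s h b itemsL))))
          (trans (cong (_* G b) (timeout*τ b)) (*-identityˡ (G b))) (sym k≡)
          (selection-≤ k<n h b F C
            (subst (_≤ F nothing) (cong (_+ freeSum h (ν k)) (+-identityˡ (totalProfit I h))) (later b as nothing))
            (λ a fr → subst (_≤ F (just a)) (trans (cong (w a b + totalProfit I h +_) (freeSum-match h b as a (ν k) fr))
              (rearrange (w a b) (totalProfit I h) (freeSum h (ν k)) (ν k a))) (later b as (just a)))
            [] itemsL refl (timeout b) ℕ.≤-refl)
          where
          as = Policy.choose pricePolicy h b
          F = afterProbe pricePolicy k h b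
          rearrange : ∀ w t s v → w + t + (s - v) ≡ t + s + (w - v)
          rearrange = solve 4 (λ w t s v → w :+ t :+ (s :- v) := t :+ s :+ (w :- v)) refl
            where open +-*-Solver

      -- The upper bound

      totalGain : ℕ → Fin types → ℚ
      totalGain k b = ∑ (λ a → g k a b) itemsL

      3ℚ : ℚ
      3ℚ = ι 3

      -- The price condition speaks of the items behind `a` in the fixed order, whereas `as` comes
      -- in the order of the policy. Enlarging `H` to the sum over all items makes the condition
      -- independent of the order.
      probe-any-≤ : ∀ {k} → k ℕ.< rounds → ∀ b F C → F nothing ≤ C → ∀ as → All (λ a → F (just a) ≤ C + (w a b - ν k a)) as →
        expectation F (probe I b as) ≤ C + (totalGain k b + ι (length as) * (τ b * totalGain k b) + ∑ (λ a → g k a b) as)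
      probe-any-≤ {k} k<n b F C none = go
        where
        G = totalGain k b
        0≤G : 0ℚ ≤ G
        0≤G = 0≤∑ (λ a → 0≤g k a b) itemsL
        go : ∀ as → All (λ a → F (just a) ≤ C + (w a b - ν k a)) as →
          expectation F (probe I b as) ≤ C + (G + ι (length as) * (τ b * G) + ∑ (λ a → g k a b) as)
        go []       []          = subst (_≤ C + (G + ι 0 * (τ b * G) + 0ℚ)) (sym (expectation-return F nothing))
          (≤-trans none (≤-by (difference C G (τ b)) 0≤G))
          where
          open +-*-Solver
          difference : ∀ C G t → C + (G + 0ℚ * (t * G) + 0ℚ) - C ≡ G
          difference = solve 3 (λ C G t → C :+ (G :+ con 0ℚ :* (t :* G) :+ con 0ℚ) :- C := G) refl
        go (a ∷ as) (some ∷ somes) = subst₂ (λ e n → e ≤ C + (G + n * (τ b * G) + (g k a b + ∑ (λ a → g k a b) as)))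
          (sym (expectation-probe-∷ F b a as)) (sym (ι-+ 1 (length as))) (bound (split (∈-allFin a)))
          where
          bound : ∃[ ys ] ∃[ zs ] itemsL ≡ ys ++ a ∷ zs →
            p a b * F (just a) + (1ℚ - p a b) * expectation F (probe I b as) ≤ C + (G + (1ℚ + ι (length as)) * (τ b * G) + (g k a b + ∑ (λ a → g k a b) as))
          bound (ys , zs , eq) = probe-≤ {w = w a b} {ν k a} {g k a b} {C = C} (0≤p a b) (prob≤1 a b) (0≤τ b) 0≤G (0≤ι (length as)) (0≤∑ (λ a → 0≤g k a b) as)
            later≤G some (go as somes) (g-max k<n ys a zs b eq)
            where
            f : Fin items → ℚ
            f x = g k x b
            later≤G : ∑ f zs ≤ G
            later≤G = subst (∑ f zs ≤_) (trans (sym (∑-++ f ys (a ∷ zs))) (cong (∑ f) (sym eq)))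
              (≤-by (difference (∑ f ys) (f a) (∑ f zs)) (0≤+ (0≤∑ (λ a → 0≤g k a b) ys) (0≤g k a b)))
              where
              open +-*-Solver
              difference : ∀ x y z → x + (y + z) - z ≡ x + y
              difference = solve 3 (λ x y z → x :+ (y :+ z) :- z := x :+ y) refl

      -- The three summands of the previous bound are at most one `totalGain` each: the single one
      -- for a match, the shares `τ b` of at most `timeout b` probes, and the `g` of distinct items.
      legal-probe-≤ : ∀ {k} → k ℕ.< rounds → ∀ b F C → F nothing ≤ C → ∀ as → length as ℕ.≤ timeout b → Unique as →
        All (λ a → F (just a) ≤ C + (w a b - ν k a)) as → expectation F (probe I b as) ≤ C + 3ℚ * totalGain k b
      legal-probe-≤ {k} k<n b F C none as as≤t unique some = ≤-trans (probe-any-≤ k<n b F C none as some)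
        (≤-by (difference C G (ι (length as)) (τ b) (∑ (λ a → g k a b) as))
          (0≤+ (0≤* (0≤- (≤timeout*τ (length as) b as≤t)) 0≤G) (0≤- (∑-sublist (λ a → g k a b) (λ a → 0≤g k a b) unique))))
        where
        open +-*-Solver
        G = totalGain k b
        0≤G : 0ℚ ≤ G
        0≤G = 0≤∑ (λ a → 0≤g k a b) itemsL
        difference : ∀ C G n t s → C + 3ℚ * G - (C + (G + n * (t * G) + s)) ≡ (1ℚ - n * t) * G + (G - s)
        difference = solve 5 (λ C G n t s → C :+ con 3ℚ :* G :- (C :+ (G :+ n :* (t :* G) :+ s)) := (con 1ℚ :- n :* t) :* G :+ (G :- s)) refl

      priceSum : ℕ → ℚ
      priceSum k = ∑ (ν k) itemsL

      priceSum-suc : ∀ {k} → k ℕ.< rounds → priceSum (suc k) ≡ priceSum k + average (totalGain k)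
      priceSum-suc {k} k<n = trans (∑-cong (ν-suc k<n) itemsL)
        (trans (∑-+ (ν k) (λ a → average (g k a)) itemsL) (cong (priceSum k +_) (sym (average-∑ (g k) itemsL))))

      -- The reserve `3ℚ * priceSum k` covers all later rounds, as `priceSum` grows from `k` to
      -- `suc k` by the average of `totalGain k`. It extends over matched items too, because the
      -- sums `H` in the price condition do.
      policy-upper : ∀ π k → k ℕ.≤ rounds → ∀ h → value π k h ≤ totalProfit I h + (freeSum h (ν k) + 3ℚ * priceSum k)
      policy-upper π zero    k≤n h = subst (_≤ totalProfit I h + (freeSum h (ν 0) + 3ℚ * priceSum 0)) (sym (expectation-return (totalProfit I) h))
        (≤-by (difference (totalProfit I h) _) (0≤+ (0≤∑ 0≤free itemsL) (0≤* (0≤ι 3) (0≤∑ (0≤ν 0 z≤n) itemsL))))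
        where
        open +-*-Solver
        difference : ∀ x y → x + y - x ≡ y
        difference = solve 2 (λ x y → x :+ y :- x := y) refl
        0≤free : ∀ a → 0ℚ ≤ whenFree h (ν 0) a
        0≤free a with free h a
        ... | true  = 0≤ν 0 z≤n a
        ... | false = ≤-refl
      policy-upper π (suc k) k<n h = begin
        value π (suc k) h                                ≡⟨ value-suc π k h ⟩
        average (λ b → expectation (afterProbe π k h b) (probe I b (Policy.choose π h b))) ≤⟨ average-mono round ⟩
        average (λ b → C + 3ℚ * totalGain k b)           ≡⟨ trans (average-shift C (λ b → 3ℚ * totalGain k b)) (cong (C +_) (average-* 3ℚ (totalGain k))) ⟩
        C + 3ℚ * average (totalGain k)                   ≡⟨ collect (totalProfit I h) (freeSum h (ν k)) (priceSum k) (average (totalGain k)) ⟩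
        totalProfit I h + (freeSum h (ν k) + 3ℚ * (priceSum k + average (totalGain k)))
          ≤⟨ +-monoʳ-≤ (totalProfit I h) (+-mono-≤ (∑-mono (whenFree-mono h ν-mono) itemsL) (≤-reflexive (cong (3ℚ *_) (sym (priceSum-suc k<n))))) ⟩
        totalProfit I h + (freeSum h (ν (suc k)) + 3ℚ * priceSum (suc k)) ∎
        where
        open ≤-Reasoning
        C : ℚ
        C = totalProfit I h + (freeSum h (ν k) + 3ℚ * priceSum k)
        collect : ∀ t s x y → t + (s + 3ℚ * x) + 3ℚ * y ≡ t + (s + 3ℚ * (x + y))
        collect = solve 4 (λ t s x y → t :+ (s :+ con 3ℚ :* x) :+ con 3ℚ :* y := t :+ (s :+ con 3ℚ :* (x :+ y))) refl
          where open +-*-Solver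
        ν-mono : ∀ a → ν k a ≤ ν (suc k) a
        ν-mono a = subst₂ _≤_ (+-identityʳ (ν k a)) (sym (ν-suc k<n a)) (+-monoʳ-≤ (ν k a) (0≤average-g k a))
        later : ∀ b as m → value π k (event b as m ∷ h) ≤ totalProfit I (event b as m ∷ h) + (freeSum (event b as m ∷ h) (ν k) + 3ℚ * priceSum k)
        later b as m = policy-upper π k (ℕ.<⇒≤ k<n) (event b as m ∷ h)
        rearrange : ∀ w t s v x → w + t + (s - v + x) ≡ t + (s + x) + (w - v)
        rearrange = solve 5 (λ w t s v x → w :+ t :+ (s :- v :+ x) := t :+ (s :+ x) :+ (w :- v)) refl
          where open +-*-Solver
        round : ∀ b → expectation (afterProbe π k h b) (probe I b (Policy.choose π h b)) ≤ C + 3ℚ * totalGain k b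
        round b = legal-probe-≤ k<n b (afterProbe π k h b) C
          (subst (value π k (event b as nothing ∷ h) ≤_) (cong (_+ (freeSum h (ν k) + 3ℚ * priceSum k)) (+-identityˡ (totalProfit I h))) (later b as nothing))
          as (proj₁ legal) (proj₁ (proj₂ legal))
          (All.map (λ {a} u → subst (value π k (event b as (just a) ∷ h) ≤_)
            (trans (cong (λ s → w a b + totalProfit I h + (s + 3ℚ * priceSum k)) (freeSum-match h b as a (ν k) (Unmatched⇒free h a u)))
              (rearrange (w a b) (totalProfit I h) (freeSum h (ν k)) (ν k a) (3ℚ * priceSum k)))
            (later b as (just a))) (proj₂ (proj₂ legal)))
          where
          as = Policy.choose π h b
          legal = Policy.legal π h b

      priceAlgorithm : OnlineAlgorithm I
      priceAlgorithm = record { coins = 0 ; policy = λ _ → pricePolicy }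

      price-competitive : ∀ opt → (ℤ.+ 245 / 1000) * expectedProfit I opt ≤ expectedProfit I priceAlgorithm
      price-competitive opt = begin
        c * expectedProfit I opt          ≤⟨ *-monoˡ c (nonNegative⁻¹ c) opt≤ ⟩
        c * (0ℚ + (S + 3ℚ * S))           ≤⟨ ≤-by (difference S) (0≤* (nonNegative⁻¹ (ℤ.+ 1 / 50)) 0≤S) ⟩
        0ℚ + S                            ≤⟨ price-lower rounds [] (ℕ.+-identityʳ rounds) ⟩
        value pricePolicy rounds []       ≡⟨ sym (trans (expectation->>= (totalProfit I) (fairCoins 0) (λ _ → play I pricePolicy rounds []))
                                            (expectation-return {Vec Bool 0} (λ _ → value pricePolicy rounds []) Vec.[])) ⟩
        expectedProfit I priceAlgorithm   ∎
        where
        open ≤-Reasoning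
        c : ℚ
        c = ℤ.+ 245 / 1000
        S : ℚ
        S = priceSum rounds
        0≤S : 0ℚ ≤ S
        0≤S = 0≤∑ (0≤ν rounds ℕ.≤-refl) itemsL
        -- The upper bound is four times `S`, and 1 - 4 * 0.245 = 0.02 = 1 / 50.
        difference : ∀ S → 0ℚ + S - c * (0ℚ + (S + 3ℚ * S)) ≡ (ℤ.+ 1 / 50) * S
        difference = solve 1 (λ S → con 0ℚ :+ S :- con c :* (con 0ℚ :+ (S :+ con 3ℚ :* S)) := con (ℤ.+ 1 / 50) :* S) refl
          where open +-*-Solver
        opt≤ : expectedProfit I opt ≤ 0ℚ + (S + 3ℚ * S)
        opt≤ = subst (_≤ 0ℚ + (S + 3ℚ * S)) (sym (expectation->>= (totalProfit I) (fairCoins (OnlineAlgorithm.coins opt)) _))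
          (expectation-coins-≤ (OnlineAlgorithm.coins opt) _ λ r → policy-upper (OnlineAlgorithm.policy opt r) rounds ℕ.≤-refl [])

-- Integer prices and exact divisions

module Pricing where

  open Programs using (quot; quot-exact; isZero)
  open Competitiveness
  open import Data.Bool.Base using (true; false; not) renaming (if_then_else_ to ifᵇ_then_else_)
  open import Data.Fin.Base using (Fin)
  open import Data.Fin.Properties using (_≟_)
  import Data.Integer.Base as ℤ
  open import Data.List.Base using (List; []; _∷_; _++_; length; map)
  open import Data.List.Properties using (++-assoc; length-++; length-tabulate)
  open import Data.List.Membership.Propositional.Properties using (∈-allFin; ∈-map⁺)
  open import Data.List.Relation.Unary.All using (All; []; _∷_)
  open import Data.List.Relation.Unary.AllPairs using ([]; _∷_)
  open import Data.List.Relation.Unary.Unique.Propositional using (Unique)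
  open import Data.List.Relation.Unary.Unique.Propositional.Properties using (allFin⁺)
  open import Data.Nat.Base using (ℕ; zero; suc; NonZero; _+_; _*_; _∸_; _^_; _≤_; _<_; z≤n; s≤s; >-nonZero; >-nonZero⁻¹; ≢-nonZero⁻¹)
  open import Data.Nat.Divisibility
  open import Data.Nat.ListAction using (sum; product)
  open import Data.Nat.ListAction.Properties using (∈⇒∣product)
  open import Data.Nat.Properties hiding (_≟_)
  open import Data.Product.Base using (_×_; _,_; proj₁; proj₂)
  import Data.Rational.Base as ℚ
  open ℚ using (ℚ; 1ℚ; ↥_; ↧ₙ_)
  import Data.Rational.Properties as ℚ
  open import Data.Rational.Solver using (module +-*-Solver)
  open import Relation.Binary.PropositionalEquality using (_≡_; _≢_; refl; sym; trans; cong; cong₂; subst; subst₂; module ≡-Reasoning)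
  open import Relation.Nullary using (yes; no; does; contradiction)

  ∣m∣n⇒∣m∸n : ∀ {c m n} → c ∣ m → c ∣ n → c ∣ m ∸ n
  ∣m∣n⇒∣m∸n {c} (divides x refl) (divides y refl) = divides (x ∸ y) (sym (*-distribʳ-∸ c x y))

  ∣sum : ∀ {X : Set} {c} (f : X → ℕ) → (∀ x → c ∣ f x) → ∀ xs → c ∣ sum (map f xs)
  ∣sum f c∣f []       = _ ∣0
  ∣sum f c∣f (x ∷ xs) = ∣m∣n⇒∣m+n (c∣f x) (∣sum f c∣f xs)

  ^-∣ : ∀ b {m n} → m ≤ n → b ^ m ∣ b ^ n
  ^-∣ b {m} {n} m≤n = divides (b ^ (n ∸ m)) (trans (cong (b ^_) (sym (m∸n+n≡m m≤n))) (^-distribˡ-+-* b (n ∸ m) m))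

  quot-∣ : ∀ x z c → 0 < z → z * c ∣ x → c ∣ quot x z
  quot-∣ x z c z>0 zc∣x = *-cancelʳ-∣ z {{>-nonZero z>0}} (subst₂ _∣_ (*-comm z c) (sym (quot-exact x z z>0 (∣-trans (m∣m*n c) zc∣x))) zc∣x)

  -- (p (w − ν − G) − G / t)⁺, for α = p z and β = z / t
  surplus : ℕ → ℕ → ℕ → ℕ → ℕ → ℕ → ℕ
  surplus z α ω β ν G = quot (α * ω ∸ (α * (ν + G) + β * G)) z

  ι-sum : ∀ {X : Set} (f : X → ℕ) xs → ι (sum (map f xs)) ≡ ∑ (λ x → ι (f x)) xs
  ι-sum f []       = refl
  ι-sum f (x ∷ xs) = trans (ι-+ (f x) _) (cong (ι (f x) ℚ.+_) (ι-sum f xs))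

  module IntegerPrices (I : Instance) where
    open Instance I
    open Analysis I

    num den : ℚ → ℕ
    num x = ℤ.∣ ↥ x ∣
    den x = ↧ₙ x

    denominators : (Fin items → Fin types → ℚ) → ℕ
    denominators x = product (map (λ a → product (map (λ b → den (x a b)) typesL)) itemsL)

    timeouts : ℕ
    timeouts = product (map timeout typesL)

    Z : ℕ
    Z = denominators p * (denominators w * (timeouts * rounds))

    -- The divisions by `Z` within a round are nested: every `surplus` rests on those of the items
    -- behind, and `raise` divides once more. Two factors `Z` per item and round cover all of them.
    Q : ℕ
    Q = ((Z * Z) ^ items) ^ rounds

    α ω : Fin items → Fin types → ℕ
    α a b = num (p a b) * quot Z (den (p a b))
    ω a b = num (w a b) * quot Z (den (w a b)) * Q

    β μ : Fin types → ℕ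
    β b = quot Z (timeout b)
    μ b = multiplicity b * quot Z rounds

    excess : (Fin items → ℕ) → Fin items → Fin types → ℕ → ℕ
    excess ν a b G = surplus Z (α a b) (ω a b) (β b) (ν a) G

    G : (Fin items → ℕ) → List (Fin items) → Fin types → ℕ
    G ν []       b = 0
    G ν (a ∷ as) b = excess ν a b (G ν as b) + G ν as b

    -- The excess of an item depends on the items behind it. It is found by searching for `a`, since
    -- the tail at the place found is what `G` has to be taken over.
    excessIn : (Fin items → ℕ) → List (Fin items) → Fin items → Fin types → ℕ
    excessIn ν []       a b = 0
    excessIn ν (x ∷ as) a b = ifᵇ does (x ≟ a) then excess ν x b (G ν as b) else excessIn ν as a b

    raise : (Fin items → ℕ) → Fin items → ℕ
    raise ν a = ν a + quot (sum (map (λ b → μ b * excessIn ν itemsL a b) typesL)) Z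

    prices : ℕ → Fin items → ℕ
    prices zero    a = 0
    prices (suc k) a = raise (prices k) a

    excessIn-++ : ∀ ν ys a zs b → Unique (ys ++ a ∷ zs) → excessIn ν (ys ++ a ∷ zs) a b ≡ excess ν a b (G ν zs b)
    excessIn-++ ν [] a zs b _ with a ≟ a
    ... | yes _  = refl
    ... | no a≢a = contradiction refl a≢a
    excessIn-++ ν (y ∷ ys) a zs b (y∉ ∷ u) with y ≟ a
    ... | yes y≡a = contradiction y≡a (notIn ys y∉)
      where
      notIn : ∀ ys → All (y ≢_) (ys ++ a ∷ zs) → y ≢ a
      notIn []       (y≢a ∷ _) = y≢a
      notIn (_ ∷ ys) (_ ∷ y∉)  = notIn ys y∉
    ... | no _    = excessIn-++ ν ys a zs b u

    excessIn-items : ∀ ν ys a zs b → itemsL ≡ ys ++ a ∷ zs → excessIn ν itemsL a b ≡ excess ν a b (G ν zs b)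
    excessIn-items ν ys a zs b eq = trans (cong (λ as → excessIn ν as a b) eq)
      (excessIn-++ ν ys a zs b (subst Unique eq (allFin⁺ items)))

    G-sum : ∀ ν ys zs b → itemsL ≡ ys ++ zs → sum (map (λ a → excessIn ν itemsL a b) zs) ≡ G ν zs b
    G-sum ν ys []       b eq = refl
    G-sum ν ys (a ∷ zs) b eq = cong₂ _+_ (excessIn-items ν ys a zs b eq)
      (G-sum ν (ys ++ a ∷ []) zs b (trans eq (sym (++-assoc ys (a ∷ []) zs))))

    -- Exactness of the divisions

    private
      product>0 : ∀ {X : Set} (f : X → ℕ) → (∀ x → NonZero (f x)) → ∀ xs → NonZero (product (map f xs))
      product>0 f f>0 []       = _
      product>0 f f>0 (x ∷ xs) = m*n≢0 (f x) _ {{f>0 x}} {{product>0 f f>0 xs}}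

      denominators>0 : ∀ x → NonZero (denominators x)
      denominators>0 x = product>0 (λ a → product (map (λ b → den (x a b)) typesL)) (λ a → product>0 (λ b → den (x a b)) (λ b → _) typesL) itemsL

      den-∣ : ∀ x a b → den (x a b) ∣ denominators x
      den-∣ x a b = ∣-trans (∈⇒∣product (∈-map⁺ (λ b → den (x a b)) (∈-allFin b)))
        (∈⇒∣product (∈-map⁺ (λ a → product (map (λ b → den (x a b)) typesL)) (∈-allFin a)))

    instance
      Z≢0 : NonZero Z
      Z≢0 = m*n≢0 (denominators p) _ {{denominators>0 p}} {{m*n≢0 (denominators w) _ {{denominators>0 w}}
        {{m*n≢0 timeouts rounds {{product>0 timeout timeout>0 typesL}}}}}}

      Q≢0 : NonZero Q
      Q≢0 = m^n≢0 ((Z * Z) ^ items) rounds {{m^n≢0 (Z * Z) items {{m*n≢0 Z Z}}}}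

    Z>0 : 0 < Z
    Z>0 = >-nonZero⁻¹ Z

    den-p∣Z : ∀ a b → den (p a b) ∣ Z
    den-p∣Z a b = ∣m⇒∣m*n (denominators w * (timeouts * rounds)) (den-∣ p a b)

    den-w∣Z : ∀ a b → den (w a b) ∣ Z
    den-w∣Z a b = ∣n⇒∣m*n (denominators p) (∣m⇒∣m*n (timeouts * rounds) (den-∣ w a b))

    timeout∣Z : ∀ b → timeout b ∣ Z
    timeout∣Z b = ∣n⇒∣m*n (denominators p) (∣n⇒∣m*n (denominators w) (∣m⇒∣m*n rounds (∈⇒∣product (∈-map⁺ timeout (∈-allFin b)))))

    rounds∣Z : rounds ∣ Z
    rounds∣Z = ∣n⇒∣m*n (denominators p) (∣n⇒∣m*n (denominators w) (n∣m*n timeouts))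

    -- Only amounts of money have to be divisible: each term of a bid is an integer multiplier, `α`
    -- or `β`, times such an amount.
    Exact : (Fin items → ℕ) → ℕ → Set
    Exact ν c = (∀ a → c ∣ ν a) × (∀ a b → c ∣ ω a b)

    bid-∣ : ∀ {c} ν a b H → Exact ν c → c ∣ H → c ∣ α a b * ω a b ∸ (α a b * (ν a + H) + β b * H)
    bid-∣ ν a b H (c∣ν , c∣ω) c∣H =
      ∣m∣n⇒∣m∸n (∣n⇒∣m*n (α a b) (c∣ω a b)) (∣m∣n⇒∣m+n (∣n⇒∣m*n (α a b) (∣m∣n⇒∣m+n (c∣ν a) c∣H)) (∣n⇒∣m*n (β b) c∣H))

    Exact-weaken : ∀ {ν c d} → d ∣ c → Exact ν c → Exact ν d
    Exact-weaken d∣c (c∣ν , c∣ω) = (λ a → ∣-trans d∣c (c∣ν a)) , λ a b → ∣-trans d∣c (c∣ω a b)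

    -- Each item uses up one pair `Z * Z`: if the sum over the tail is divisible by `Z * Z * c`, so
    -- is the bid, and after the division by `Z` there remains `Z * c`.
    G-∣ : ∀ ν zs c b → Exact ν ((Z * Z) ^ length zs * c) → c ∣ G ν zs b
    G-∣ ν []       c b ex = c ∣0
    G-∣ ν (a ∷ zs) c b ex = ∣m∣n⇒∣m+n
      (∣-trans (n∣m*n Z) (quot-∣ _ Z (Z * c) Z>0 (∣-trans (≡⇒∣ (sym (*-assoc Z Z c)))
        (bid-∣ ν a b (G ν zs b) (Exact-weaken (∣-trans (n∣m*n ((Z * Z) ^ length zs)) (≡⇒∣ (sym shape))) ex) ZZc∣G))))
      (∣-trans (n∣m*n (Z * Z)) ZZc∣G)
      where
      ≡⇒∣ : ∀ {m n} → m ≡ n → m ∣ n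
      ≡⇒∣ refl = ∣-refl
      shape : Z * Z * (Z * Z) ^ length zs * c ≡ (Z * Z) ^ length zs * (Z * Z * c)
      shape = trans (cong (_* c) (*-comm (Z * Z) _)) (*-assoc ((Z * Z) ^ length zs) (Z * Z) c)
      ZZc∣G : Z * Z * c ∣ G ν zs b
      ZZc∣G = G-∣ ν zs (Z * Z * c) b (subst (Exact ν) shape ex)

    module _ {ν : Fin items → ℕ} {c : ℕ} (ex : Exact ν ((Z * Z) ^ items * c)) where

      private
        bid : Fin items → Fin types → ℕ → ℕ
        bid a b H = α a b * ω a b ∸ (α a b * (ν a + H) + β b * H)

        -- The items behind `a` leave the pair of factors that belongs to `a` itself: one is spent
        -- on its excess, the other on its new price.
        suffix-∣ : ∀ ys a zs b → itemsL ≡ ys ++ a ∷ zs → Z * (Z * c) ∣ bid a b (G ν zs b)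
        suffix-∣ ys a zs b eq = subst (_∣ bid a b (G ν zs b)) (*-assoc Z Z c)
          (bid-∣ ν a b (G ν zs b) (Exact-weaken (n∣m*n ((Z * Z) ^ length zs)) ex′) (G-∣ ν zs (Z * Z * c) b ex′))
          where
          length≡ : items ≡ length ys + suc (length zs)
          length≡ = trans (sym (length-tabulate (λ i → i))) (trans (cong length eq) (length-++ ys))
          ex′ : Exact ν ((Z * Z) ^ length zs * (Z * Z * c))
          ex′ = Exact-weaken (subst (_∣ (Z * Z) ^ items * c)
            (trans (cong (_* c) (*-comm (Z * Z) ((Z * Z) ^ length zs))) (*-assoc ((Z * Z) ^ length zs) (Z * Z) c))
            (*-monoˡ-∣ c (^-∣ (Z * Z) (subst (suc (length zs) ≤_) (sym length≡) (m≤n+m (suc (length zs)) (length ys)))))) ex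

        excess-∣ : ∀ a b → Z * c ∣ excessIn ν itemsL a b
        excess-∣ a b with split (∈-allFin a)
        ... | ys , zs , eq = subst (Z * c ∣_) (sym (excessIn-items ν ys a zs b eq)) (quot-∣ _ Z (Z * c) Z>0 (suffix-∣ ys a zs b eq))

        sum-∣ : ∀ a → Z * c ∣ sum (map (λ b → μ b * excessIn ν itemsL a b) typesL)
        sum-∣ a = ∣sum _ (λ b → ∣n⇒∣m*n (μ b) (excess-∣ a b)) typesL

      excess-exact : ∀ ys a zs b → itemsL ≡ ys ++ a ∷ zs → let H = G ν zs b in
        excessIn ν itemsL a b * Z ≡ α a b * ω a b ∸ (α a b * (ν a + H) + β b * H)
      excess-exact ys a zs b eq = trans (cong (_* Z) (excessIn-items ν ys a zs b eq))
        (quot-exact _ Z Z>0 (∣-trans (m∣m*n (Z * c)) (suffix-∣ ys a zs b eq)))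

      raise-exact : ∀ a → raise ν a * Z ≡ ν a * Z + sum (map (λ b → μ b * excessIn ν itemsL a b) typesL)
      raise-exact a = trans (*-distribʳ-+ Z (ν a) _) (cong (ν a * Z +_) (quot-exact _ Z Z>0 (∣-trans (m∣m*n c) (sum-∣ a))))

      raise-∣ : Exact (raise ν) c
      raise-∣ = (λ a → ∣m∣n⇒∣m+n (proj₁ ex′ a) (quot-∣ _ Z c Z>0 (sum-∣ a))) , proj₂ ex′
        where ex′ = Exact-weaken (n∣m*n ((Z * Z) ^ items)) ex

    -- Every round consumes one factor `(Z * Z) ^ items`, so the `rounds` factors in `Q` last
    -- exactly for the whole backward computation.
    prices-Exact : ∀ k → k ≤ rounds → Exact (prices k) (((Z * Z) ^ items) ^ (rounds ∸ k))
    prices-Exact-suc : ∀ k → k < rounds → Exact (prices k) ((Z * Z) ^ items * ((Z * Z) ^ items) ^ (rounds ∸ suc k))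
    prices-Exact zero    k≤n = (λ a → _ ∣0) , λ a b → n∣m*n (num (w a b) * quot Z (den (w a b)))
    prices-Exact (suc k) k<n = raise-∣ (prices-Exact-suc k k<n)
    prices-Exact-suc k k<n = subst (λ e → Exact (prices k) (((Z * Z) ^ items) ^ e)) (sym (∸-suc′ k<n)) (prices-Exact k (<⇒≤ k<n))
      where
      ∸-suc′ : ∀ {k n} → k < n → suc (n ∸ suc k) ≡ n ∸ k
      ∸-suc′ {k} {n} k<n = sym (+-∸-assoc 1 k<n)

    -- The integers above count multiples of 1 / unit.
    unit : ℕ
    unit = Z * Q

    instance
      unit≢0 : NonZero unit
      unit≢0 = m*n≢0 Z Q

    u : ℚ
    u = ℚ._/_ (ℤ.+ 1) unit

    u-unit : u ℚ.* ι unit ≡ 1ℚ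
    u-unit = /-*ι 1 unit

    private
      ι-quot : ∀ d → 0 < d → d ∣ Z → ∀ x n → x ℚ.* ι d ≡ ι n → ι (n * quot Z d) ≡ x ℚ.* ι Z
      ι-quot d d>0 d∣Z x n eq = begin
        ι (n * quot Z d)                ≡⟨ ι-* n (quot Z d) ⟩
        ι n ℚ.* ι (quot Z d)            ≡⟨ cong (ℚ._* ι (quot Z d)) (sym eq) ⟩
        x ℚ.* ι d ℚ.* ι (quot Z d)      ≡⟨ ℚ.*-assoc x (ι d) (ι (quot Z d)) ⟩
        x ℚ.* (ι d ℚ.* ι (quot Z d))    ≡⟨ cong (x ℚ.*_) (trans (sym (ι-* d (quot Z d))) (cong ι (trans (*-comm d (quot Z d)) (quot-exact Z d d>0 d∣Z)))) ⟩
        x ℚ.* ι Z                       ∎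
        where open ≡-Reasoning

    ι-α : ∀ a b → ι (α a b) ≡ p a b ℚ.* ι Z
    ι-α a b = ι-quot (den (p a b)) (s≤s z≤n) (den-p∣Z a b) (p a b) (num (p a b)) (ℚ-*↧ (p a b) (0≤p a b))

    ι-β : ∀ b → ι (β b) ≡ τ b ℚ.* ι Z
    ι-β b = trans (cong ι (sym (*-identityˡ (β b))))
      (ι-quot (timeout b) (>-nonZero⁻¹ (timeout b) {{timeout>0 b}}) (timeout∣Z b) (τ b) 1 (/-*ι 1 (timeout b) {{timeout>0 b}}))

    ι-μ : ∀ b → ι (μ b) ≡ q b ℚ.* ι Z
    ι-μ b = ι-quot rounds (>-nonZero⁻¹ rounds) rounds∣Z (q b) (multiplicity b) (/-*ι (multiplicity b) rounds)

    ι-ω : ∀ a b → ι (ω a b) ≡ w a b ℚ.* ι unit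
    ι-ω a b = trans (ι-* (num (w a b) * quot Z (den (w a b))) Q) (trans (cong (ℚ._* ι Q) (ι-quot (den (w a b)) (s≤s z≤n) (den-w∣Z a b) (w a b) (num (w a b)) (ℚ-*↧ (w a b) (profit≥0 a b))))
      (trans (ℚ.*-assoc (w a b) (ι Z) (ι Q)) (cong (w a b ℚ.*_) (sym (ι-* Z Q)))))

    module _ (k : ℕ) (k<n : k < rounds) (ys : List (Fin items)) (a : Fin items) (zs : List (Fin items)) (b : Fin types)
      (eq : itemsL ≡ ys ++ a ∷ zs) where

      private
        H e m : ℕ
        H = G (prices k) zs b
        e = excessIn (prices k) itemsL a b
        m = α a b * (prices k a + H) + β b * H

        price-of : ℚ → ℚ
        price-of h = ι e ℚ.* u ℚ.+ p a b ℚ.* (ι (prices k a) ℚ.* u ℚ.+ h) ℚ.+ τ b ℚ.* h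

        open +-*-Solver

        worth : p a b ℚ.* w a b ℚ.* ι (unit * Z) ≡ ι (α a b * ω a b)
        worth = begin
          p a b ℚ.* w a b ℚ.* ι (unit * Z)              ≡⟨ cong (p a b ℚ.* w a b ℚ.*_) (ι-* unit Z) ⟩
          p a b ℚ.* w a b ℚ.* (ι unit ℚ.* ι Z)          ≡⟨ solve 4 (λ p w u z → p :* w :* (u :* z) := p :* z :* (w :* u)) refl (p a b) (w a b) (ι unit) (ι Z) ⟩
          p a b ℚ.* ι Z ℚ.* (w a b ℚ.* ι unit)          ≡⟨ sym (cong₂ ℚ._*_ (ι-α a b) (ι-ω a b)) ⟩
          ι (α a b) ℚ.* ι (ω a b)                       ≡⟨ sym (ι-* (α a b) (ω a b)) ⟩
          ι (α a b * ω a b)                             ∎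
          where open ≡-Reasoning

        needed : price-of (ι H ℚ.* u) ℚ.* ι (unit * Z) ≡ ι (e * Z + m)
        needed = begin
          (ι e ℚ.* u ℚ.+ p a b ℚ.* (ι v ℚ.* u ℚ.+ ι H ℚ.* u) ℚ.+ τ b ℚ.* (ι H ℚ.* u)) ℚ.* ι (unit * Z)
            ≡⟨ cong (price-of (ι H ℚ.* u) ℚ.*_) (ι-* unit Z) ⟩
          (ι e ℚ.* u ℚ.+ p a b ℚ.* (ι v ℚ.* u ℚ.+ ι H ℚ.* u) ℚ.+ τ b ℚ.* (ι H ℚ.* u)) ℚ.* (ι unit ℚ.* ι Z)
            ≡⟨ solve 8 (λ e u p v h t U z → (e :* u :+ p :* (v :* u :+ h :* u) :+ t :* (h :* u)) :* (U :* z) :=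
                  (e :* z :+ (p :* z :* (v :+ h) :+ t :* z :* h)) :* (u :* U)) refl (ι e) u (p a b) (ι v) (ι H) (τ b) (ι unit) (ι Z) ⟩
          (ι e ℚ.* ι Z ℚ.+ (p a b ℚ.* ι Z ℚ.* (ι v ℚ.+ ι H) ℚ.+ τ b ℚ.* ι Z ℚ.* ι H)) ℚ.* (u ℚ.* ι unit)
            ≡⟨ trans (cong (scaled ℚ.*_) u-unit) (ℚ.*-identityʳ scaled) ⟩
          ι e ℚ.* ι Z ℚ.+ (p a b ℚ.* ι Z ℚ.* (ι v ℚ.+ ι H) ℚ.+ τ b ℚ.* ι Z ℚ.* ι H)
            ≡⟨ sym (cong₂ ℚ._+_ (ι-* e Z) (trans (ι-+ (α a b * (v + H)) (β b * H)) (cong₂ ℚ._+_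
                 (trans (ι-* (α a b) (v + H)) (cong₂ ℚ._*_ (ι-α a b) (ι-+ v H)))
                 (trans (ι-* (β b) H) (cong (ℚ._* ι H) (ι-β b)))))) ⟩
          ι (e * Z) ℚ.+ ι m                             ≡⟨ sym (ι-+ (e * Z) m) ⟩
          ι (e * Z + m)                                 ∎
          where
          open ≡-Reasoning
          v = prices k a
          scaled : ℚ
          scaled = ι e ℚ.* ι Z ℚ.+ (p a b ℚ.* ι Z ℚ.* (ι v ℚ.+ ι H) ℚ.+ τ b ℚ.* ι Z ℚ.* ι H)

        exact : e * Z ≡ α a b * ω a b ∸ m
        exact = excess-exact (prices-Exact-suc k k<n) ys a zs b eq

        ∑H : ∑ (λ x → ι (excessIn (prices k) itemsL x b) ℚ.* u) zs ≡ ι H ℚ.* u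
        ∑H = trans (∑-*ʳ u _ zs) (cong (ℚ._* u) (trans (sym (ι-sum _ zs))
          (cong ι (G-sum (prices k) (ys ++ a ∷ []) zs b (trans eq (sym (++-assoc ys (a ∷ []) zs)))))))

      -- In units of `1 / (unit * Z)` this reads `x ≤ (x ∸ m) + m`, which holds whether or not the
      -- subtraction is truncated.
      worth≤needed : p a b ℚ.* w a b ℚ.≤ price-of (∑ (λ x → ι (excessIn (prices k) itemsL x b) ℚ.* u) zs)
      worth≤needed = subst (λ h → p a b ℚ.* w a b ℚ.≤ price-of h) (sym ∑H)
        (*ι-cancel-≤ (unit * Z) {{m*n≢0 unit Z}} (subst₂ ℚ._≤_ (sym worth) (sym needed) (ι-mono {α a b * ω a b} {e * Z + m}
          (subst (λ x → α a b * ω a b ≤ x + m) (sym exact) (≤-trans (m≤n+m∸n (α a b * ω a b) m) (≤-reflexive (+-comm m _)))))))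

      -- A nonzero excess certifies that the subtraction was not truncated, and then the two sides
      -- are equal.
      needed≤worth : isZero e ≡ false → price-of (∑ (λ x → ι (excessIn (prices k) itemsL x b) ℚ.* u) zs) ℚ.≤ p a b ℚ.* w a b
      needed≤worth e≢0 = subst (λ h → price-of h ℚ.≤ p a b ℚ.* w a b) (sym ∑H)
        (*ι-cancel-≤ (unit * Z) {{m*n≢0 unit Z}} (subst₂ ℚ._≤_ (sym needed) (sym worth) (ι-mono {e * Z + m} {α a b * ω a b}
          (≤-reflexive (trans (cong (_+ m) exact) (m∸n+n≡m {α a b * ω a b} {m} (<⇒≤ (m∸n≢0⇒n<m {α a b * ω a b} {m} positive))))))))
        where
        isZero-false : ∀ n → isZero n ≡ false → NonZero n
        isZero-false (suc n) _ = _
        positive : α a b * ω a b ∸ m ≢ 0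
        positive z = ≢-nonZero⁻¹ (e * Z) {{m*n≢0 e Z {{isZero-false e e≢0}}}} (trans exact z)

    integerPrices : Prices
    integerPrices = record
      { ν        = λ k a → ι (prices k a) ℚ.* u
      ; g        = λ k a b → ι (excessIn (prices k) itemsL a b) ℚ.* u
      ; accept   = λ k a b → not (isZero (excessIn (prices k) itemsL a b))
      ; ν-zero   = λ a → ℚ.*-zeroˡ u
      ; ν-suc    = ν-suc
      ; 0≤g      = λ k a b → 0≤* (0≤ι (excessIn (prices k) itemsL a b)) (0≤/ 1 unit)
      ; g-max    = λ {k} k<n ys a zs b eq → worth≤needed k k<n ys a zs b eq
      ; g-accept = λ {k} k<n ys a zs b eq acc → needed≤worth k k<n ys a zs b eq (not-true acc)
      ; g-reject = λ {k} _ a b rej → trans (cong (λ n → ι n ℚ.* u) (isZero-true (excessIn (prices k) itemsL a b) rej)) (ℚ.*-zeroˡ u)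
      }
      where
      not-true : ∀ {x} → not x ≡ true → x ≡ false
      not-true {false} _ = refl
      isZero-true : ∀ n → not (isZero n) ≡ false → n ≡ 0
      isZero-true zero _ = refl
      ν-suc : ∀ {k} → k < rounds → ∀ a →
        ι (prices (suc k) a) ℚ.* u ≡ ι (prices k a) ℚ.* u ℚ.+ average (λ b → ι (excessIn (prices k) itemsL a b) ℚ.* u)
      ν-suc {k} k<n a = *ι-cancel Z (begin
        ι (prices (suc k) a) ℚ.* u ℚ.* ι Z            ≡⟨ swap (ι (prices (suc k) a)) u (ι Z) ⟩
        ι (prices (suc k) a) ℚ.* ι Z ℚ.* u            ≡⟨ cong (ℚ._* u) (trans (sym (ι-* (prices (suc k) a) Z)) (cong ι (raise-exact (prices-Exact-suc k k<n) a))) ⟩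
        ι (v * Z + sum (map (λ b → μ b * e b) typesL)) ℚ.* u
          ≡⟨ cong (ℚ._* u) (trans (ι-+ (v * Z) _) (cong₂ ℚ._+_ (ι-* v Z) (trans (ι-sum (λ b → μ b * e b) typesL)
               (∑-cong (λ b → trans (ι-* (μ b) (e b)) (cong (ℚ._* ι (e b)) (ι-μ b))) typesL)))) ⟩
        (ι v ℚ.* ι Z ℚ.+ ∑ (λ b → q b ℚ.* ι Z ℚ.* ι (e b)) typesL) ℚ.* u
          ≡⟨ ℚ.*-distribʳ-+ u (ι v ℚ.* ι Z) _ ⟩
        ι v ℚ.* ι Z ℚ.* u ℚ.+ ∑ (λ b → q b ℚ.* ι Z ℚ.* ι (e b)) typesL ℚ.* u
          ≡⟨ cong₂ ℚ._+_ (swap (ι v) (ι Z) u) (sym (∑-*ʳ u (λ b → q b ℚ.* ι Z ℚ.* ι (e b)) typesL)) ⟩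
        ι v ℚ.* u ℚ.* ι Z ℚ.+ ∑ (λ b → q b ℚ.* ι Z ℚ.* ι (e b) ℚ.* u) typesL
          ≡⟨ cong (ι v ℚ.* u ℚ.* ι Z ℚ.+_) (trans (∑-cong (λ b → regroup (q b) (ι Z) (ι (e b)) u) typesL) (∑-*ʳ (ι Z) (λ b → q b ℚ.* (ι (e b) ℚ.* u)) typesL)) ⟩
        ι v ℚ.* u ℚ.* ι Z ℚ.+ average (λ b → ι (e b) ℚ.* u) ℚ.* ι Z
          ≡⟨ sym (ℚ.*-distribʳ-+ (ι Z) (ι v ℚ.* u) _) ⟩
        (ι v ℚ.* u ℚ.+ average (λ b → ι (e b) ℚ.* u)) ℚ.* ι Z ∎)
        where
        open ≡-Reasoning
        v = prices k a
        e : Fin types → ℕ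
        e = excessIn (prices k) itemsL a
        open +-*-Solver
        swap : ∀ x y z → x ℚ.* y ℚ.* z ≡ x ℚ.* z ℚ.* y
        swap = solve 3 (λ x y z → x :* y :* z := x :* z :* y) refl
        regroup : ∀ q z e u → q ℚ.* z ℚ.* e ℚ.* u ≡ q ℚ.* (e ℚ.* u) ℚ.* z
        regroup = solve 4 (λ q z e u → q :* z :* e :* u := q :* (e :* u) :* z) refl

-- The algorithm as a polynomial-time program

module Implementation where

  open Programs
  open Competitiveness using (module Analysis)
  open Pricing
  open import Data.Bool.Base using (Bool; true; false; not; _∧_) renaming (if_then_else_ to ifᵇ_then_else_)
  open import Data.Bool.Properties using (T?)
  open import Data.Fin.Base using (Fin; zero; suc; toℕ)
  import Data.Fin.Properties as Fin
  import Data.Integer.Base as ℤ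
  open import Data.List.Base using (List; []; _∷_; _++_; length; map; foldl; replicate; tabulate; allFin; zip; filter; take; drop)
  open import Data.List.Properties using (map-∘; map-cong; map-tabulate; ++-assoc; length-map; length-tabulate; length-replicate; take-map; drop-[])
  open import Data.List.Membership.Propositional.Properties using (∈-allFin; ∈-map⁺)
  open import Data.List.Relation.Unary.All as All using (All; []; _∷_)
  import Data.List.Relation.Unary.All.Properties as All
  open import Data.Maybe.Base using (Maybe; just; nothing)
  open import Data.Nat.Base using (ℕ; zero; suc; _+_; _*_; _∸_; _^_; _≤_; _<_; z≤n; s≤s; _≡ᵇ_)
  open import Data.Nat.ListAction using (sum; product)
  open import Data.Nat.Properties hiding (_≟_)
  open import Data.Product.Base using (Σ-syntax; _×_; _,_; proj₁; proj₂)
  open import Data.Rational.Base using (ℚ; ↥_; ↧ₙ_)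
  open import Data.Unit.Base using (⊤; tt)
  open import Data.Vec.Base as Vec using (Vec)
  open import Function.Base using (_∘_; id)
  open import Relation.Binary.PropositionalEquality using (_≡_; refl; sym; trans; cong; cong₂; subst)
  open import Relation.Nullary using (yes; no; does)
  open Poly

  -- Tables of integers

  Entryᵗ Rowᵗ Itemᵗ : Type
  Entryᵗ = ℕᵗ ⊠ (ℕᵗ ⊠ (ℕᵗ ⊠ ℕᵗ))
  Rowᵗ   = Listᵗ Entryᵗ
  Itemᵗ  = ℕᵗ ⊠ Rowᵗ

  entrySurplus : ℕ → ℕ → Val Entryᵗ × ℕ → ℕ
  entrySurplus z ν ((α , ω , β , μ) , G) = surplus z α ω β ν G

  surpluses : ℕ → Val Itemᵗ → List ℕ → List ℕ
  surpluses z (ν , row) Gs = map (entrySurplus z ν) (zip row Gs)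

  addAll : List ℕ → List ℕ → List ℕ
  addAll gs Gs = map (λ (g , G) → g + G) (zip gs Gs)

  weighted : Val Entryᵗ × ℕ → ℕ
  weighted ((α , ω , β , μ) , g) = μ * g

  raiseItem : ℕ → Val Itemᵗ → List ℕ → Val Itemᵗ
  raiseItem z (ν , row) gs = ν + quot (sum (map weighted (zip row gs))) z , row

  passStep : ℕ → (List ℕ × List (Val Itemᵗ)) → Val Itemᵗ → List ℕ × List (Val Itemᵗ)
  passStep z (Gs , out) it = addAll (surpluses z it Gs) Gs , raiseItem z it (surpluses z it Gs) ∷ out

  -- The integer computation of one round: `Gs` carries the sum `G` for all types at once, and the
  -- recursion treats the last item first.
  pass : List (Val Itemᵗ) → ℕ × List ℕ → List ℕ × List (Val Itemᵗ)
  pass []         (z , Gs) = Gs , []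
  pass (it ∷ its) (z , Gs) = passStep z (pass its (z , Gs)) it

  surplusₚ : ∀ {A z e ν G} → Poly A ℕᵗ z → Poly A ℕᵗ ν → Poly A Entryᵗ e → Poly A ℕᵗ G →
    Poly A ℕᵗ λ a → entrySurplus (z a) (ν a) (e a , G a)
  surplusₚ Z V E G = quotₚ (α *ₚ (fstₚ ∙ sndₚ ∙ E) ∸ₚ (α *ₚ (V +ₚ G) +ₚ fstₚ ∙ sndₚ ∙ sndₚ ∙ E *ₚ G)) Z
    where α = fstₚ ∙ E

  entryValue : Val Entryᵗ → ℕ
  entryValue (α , ω , β , μ) = α * ω

  -- The price and `G` only occur in the subtracted part, so the bound `α * ω` is independent of
  -- them. This keeps all numbers polynomially long however many rounds are computed.
  entrySurplus≤ : ∀ z ν e G → entrySurplus z ν (e , G) ≤ entryValue e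
  entrySurplus≤ z ν (α , ω , β , μ) G = ≤-trans (quot-≤ (α * ω ∸ (α * (ν + G) + β * G)) z) (m∸n≤m (α * ω) (α * (ν + G) + β * G))

  entryValue< : ∀ e → entryValue e < 2 ^ ∥_∥ {Entryᵗ} e
  entryValue< (α , ω , β , μ) = <2^-mono (∥_∥ {ℕᵗ} α + ∥_∥ {ℕᵗ} ω) (∥_∥ {Entryᵗ} (α , ω , β , μ))
    (m≤n⇒m≤1+n (+-monoʳ-≤ (∥_∥ {ℕᵗ} α) (m≤n⇒m≤1+n (m≤m+n _ _))))
    (*-<2^ (∥_∥ {ℕᵗ} α) (∥_∥ {ℕᵗ} ω) (n<2^∥n∥ α) (n<2^∥n∥ ω))

  entryWeight : Val Entryᵗ → ℕ
  entryWeight (α , ω , β , μ) = μ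

  entryWeight< : ∀ e → entryWeight e < 2 ^ ∥_∥ {Entryᵗ} e
  entryWeight< (α , ω , β , μ) = <2^-mono (∥_∥ {ℕᵗ} μ) (∥_∥ {Entryᵗ} (α , ω , β , μ))
    (m≤n⇒m≤1+n (≤-trans (m≤n⇒m≤1+n (≤-trans (m≤n⇒m≤1+n (m≤n+m _ (∥_∥ {ℕᵗ} β))) (m≤n+m _ (∥_∥ {ℕᵗ} ω)))) (m≤n+m _ (∥_∥ {ℕᵗ} α))))
    (n<2^∥n∥ μ)

  All-∥∥ : ∀ {E K} (es : List (Val E)) → ∥_∥ {Listᵗ E} es ≤ K → All (λ e → ∥_∥ {E} e ≤ K) es
  All-∥∥ []           es≤ = []
  All-∥∥ {E} (e ∷ es) es≤ = ≤-trans (m≤n⇒m≤1+n (m≤m+n _ _)) es≤ ∷ All-∥∥ {E} es (≤-trans (m≤n⇒m≤1+n (m≤n+m _ _)) es≤)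

  All-zip : ∀ {X Y Z : Set} {P : X → Set} {Q : Y → Set} {R : Z → Set} {f : X × Y → Z} →
    (∀ x y → P x → Q y → R (f (x , y))) → ∀ {xs ys} → All P xs → All Q ys → All R (map f (zip xs ys))
  All-zip pqr []       qs       = []
  All-zip pqr (p ∷ ps) []       = []
  All-zip pqr (p ∷ ps) (q ∷ qs) = pqr _ _ p q ∷ All-zip pqr ps qs

  length-zip≤ : ∀ {X Y Z : Set} (f : X × Y → Z) xs ys → length (map f (zip xs ys)) ≤ length xs × length (map f (zip xs ys)) ≤ length ys
  length-zip≤ f []       ys       = z≤n , z≤n
  length-zip≤ f (x ∷ xs) []       = z≤n , z≤n
  length-zip≤ f (x ∷ xs) (y ∷ ys) = let ≤xs , ≤ys = length-zip≤ f xs ys in s≤s ≤xs , s≤s ≤ys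

  double-<2^ : ∀ {m n} K → m < 2 ^ K → n < 2 ^ K → m + n < 2 ^ suc K
  double-<2^ {m} {n} K m< n< = ≤-trans (+-mono-< m< n<) (≤-reflexive (cong (2 ^ K +_) (sym (+-identityʳ (2 ^ K)))))

  sum-<2^ : ∀ {K} ns → All (_< 2 ^ K) ns → sum ns < 2 ^ (length ns + K)
  sum-<2^ {K} []       []          = m^n>0 2 K
  sum-<2^ {K} (n ∷ ns) (n< ∷ ns<) = double-<2^ (length ns + K) (<2^-mono K (length ns + K) (m≤n+m K (length ns)) n<) (sum-<2^ ns ns<)

  ∥numbers∥ : ∀ {K} ns → All (_< 2 ^ K) ns → ∥_∥ {Listᵗ ℕᵗ} ns ≤ suc (length ns * (2 + K * 4))
  ∥numbers∥ []           []         = s≤s z≤n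
  ∥numbers∥ {K} (n ∷ ns) (n< ∷ ns<) = s≤s (≤-trans (+-mono-≤ (∥n∥≤ K n<) (∥numbers∥ {K} ns ns<)) (≤-reflexive (+-suc (1 + K * 4) _)))

  module _ (N z : ℕ) (Gs₀ : List ℕ) (Gs₀≤ : ∥_∥ {Listᵗ ℕᵗ} Gs₀ ≤ N) where

    surpluses< : ∀ it Gs → ∥_∥ {Itemᵗ} it ≤ N → All (_< 2 ^ N) (surpluses z it Gs)
    surpluses< (ν , row) Gs it≤ = All-zip
      (λ e G e≤ _ → ≤-trans (s≤s (entrySurplus≤ z ν e G)) (<2^-mono (∥_∥ {Entryᵗ} e) N e≤ (entryValue< e)))
      (All-∥∥ {Entryᵗ} row (≤-trans (m≤n⇒m≤1+n (m≤n+m _ _)) it≤)) (All.universal {P = λ _ → ⊤} (λ _ → tt) Gs)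

    passItem : ℕ
    passItem = suc ((1 + suc (N + (N + (N + N))) * 4) + N)

    ∥raiseItem∥ : ∀ it Gs → ∥_∥ {Itemᵗ} it ≤ N → ∥_∥ {Itemᵗ} (raiseItem z it (surpluses z it Gs)) ≤ passItem
    ∥raiseItem∥ it@(ν , row) Gs it≤ = s≤s (+-mono-≤
      (∥n∥≤ (suc (N + (N + (N + N)))) (+-<2^ N (N + (N + N)) ν< (≤-trans (s≤s (quot-≤ total z)) total<)))
      row≤)
      where
      gs = surpluses z it Gs
      total = sum (map weighted (zip row gs))
      row≤ : ∥_∥ {Rowᵗ} row ≤ N
      row≤ = ≤-trans (m≤n⇒m≤1+n (m≤n+m _ _)) it≤
      ν< : ν < 2 ^ N
      ν< = <2^-mono (∥_∥ {ℕᵗ} ν) N (≤-trans (m≤n⇒m≤1+n (m≤m+n _ _)) it≤) (n<2^∥n∥ ν)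
      total< : total < 2 ^ (N + (N + N))
      total< = <2^-mono (length (map weighted (zip row gs)) + (N + N)) (N + (N + N))
        (+-monoˡ-≤ (N + N) (≤-trans (proj₁ (length-zip≤ weighted row gs)) (≤-trans (length≤∥∥ {Entryᵗ} row) row≤)))
        (sum-<2^ (map weighted (zip row gs)) (All-zip {R = _< 2 ^ (N + N)}
          (λ e g e≤ g< → *-<2^ N N (<2^-mono (∥_∥ {Entryᵗ} e) N e≤ (entryWeight< e)) g<)
          (All-∥∥ {Entryᵗ} row row≤) (surpluses< it Gs it≤)))

    -- An excess is below `2 ^ N` regardless of the running sums, so these gain at most one bit per
    -- item.
    pass-bounds : ∀ its → ∥_∥ {Listᵗ Itemᵗ} its ≤ N → let (Gs , out) = pass its (z , Gs₀) in
      All (_< 2 ^ (length its + N)) Gs × length Gs ≤ N × ∥_∥ {Listᵗ Itemᵗ} out ≤ suc (length its * suc passItem)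
    pass-bounds [] its≤ =
      All.map (λ {n} n≤ → <2^-mono (∥_∥ {ℕᵗ} n) N n≤ (n<2^∥n∥ n)) (All-∥∥ {ℕᵗ} Gs₀ Gs₀≤) ,
      ≤-trans (length≤∥∥ {ℕᵗ} Gs₀) Gs₀≤ , s≤s z≤n
    pass-bounds (it ∷ its) its≤ with pass its (z , Gs₀) | pass-bounds its (≤-trans (m≤n⇒m≤1+n (m≤n+m _ _)) its≤)
    ... | Gs , out | Gs< , Gs≤ , out≤ =
      All-zip (λ g G g< G< → double-<2^ (length its + N) (<2^-mono N (length its + N) (m≤n+m N (length its)) g<) G<) (surpluses< it Gs it≤) Gs< ,
      ≤-trans (proj₂ (length-zip≤ (λ (g , G) → g + G) (surpluses z it Gs) Gs)) Gs≤ ,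
      s≤s (≤-trans (+-mono-≤ (∥raiseItem∥ it Gs it≤) out≤) (≤-reflexive (+-suc passItem _)))
      where
      it≤ : ∥_∥ {Itemᵗ} it ≤ N
      it≤ = ≤-trans (m≤n⇒m≤1+n (m≤m+n _ _)) its≤

  PassInᵗ : Type
  PassInᵗ = Listᵗ Itemᵗ ⊠ (ℕᵗ ⊠ Listᵗ ℕᵗ)

  opaque
    passₚ : Poly PassInᵗ (Listᵗ ℕᵗ ⊠ Listᵗ Itemᵗ) λ (its , c) → pass its c
    passₚ = listRecₚ {PassInᵗ} {Listᵗ ℕᵗ ⊠ Listᵗ Itemᵗ} {Itemᵗ} {proj₁} {λ its a → pass its (proj₂ a)}
        {λ (st , it , _ , z , _) → passStep z st it}
        fstₚ ⟨ sndₚ ∙ sndₚ , nilₚ ⟩ stepₚ (λ _ _ _ → refl) passBound bounded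
      where
      Ctx : Type
      Ctx = (Listᵗ ℕᵗ ⊠ Listᵗ Itemᵗ) ⊠ (Itemᵗ ⊠ PassInᵗ)
      Gsₚ : Poly Ctx (Listᵗ ℕᵗ) λ ((Gs , _) , _) → Gs
      Gsₚ = fstₚ ∙ fstₚ
      itₚ : Poly Ctx Itemᵗ λ (_ , it , _) → it
      itₚ = fstₚ ∙ sndₚ
      zₚ : Poly Ctx ℕᵗ λ (_ , _ , _ , z , _) → z
      zₚ = fstₚ ∙ sndₚ ∙ sndₚ ∙ sndₚ
      gsₚ : Poly Ctx (Listᵗ ℕᵗ) λ ((Gs , _) , it , _ , z , _) → surpluses z it Gs
      gsₚ = mapₚ (zipₚ (sndₚ ∙ itₚ) Gsₚ) (surplusₚ (zₚ ∙ sndₚ) (fstₚ ∙ itₚ ∙ sndₚ) (fstₚ ∙ fstₚ) (sndₚ ∙ fstₚ))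
      stepₚ : Poly Ctx (Listᵗ ℕᵗ ⊠ Listᵗ Itemᵗ) λ (st , it , _ , z , _) → passStep z st it
      stepₚ = ⟨ mapₚ (zipₚ gsₚ Gsₚ) (fstₚ ∙ fstₚ +ₚ sndₚ ∙ fstₚ)
              , consₚ ⟨ fstₚ ∙ itₚ +ₚ quotₚ (sumₚ (mapₚ (zipₚ (sndₚ ∙ itₚ) gsₚ) (sndₚ ∙ sndₚ ∙ sndₚ ∙ fstₚ ∙ fstₚ *ₚ sndₚ ∙ fstₚ))) zₚ , sndₚ ∙ itₚ ⟩ (sndₚ ∙ fstₚ) ⟩
      passBound : Bound
      passBound = con 1 ⊕ ((con 1 ⊕ ♯ ⊗ (con 2 ⊕ (♯ ⊕ ♯) ⊗ con 4))
        ⊕ (con 1 ⊕ ♯ ⊗ (con 2 ⊕ ((con 1 ⊕ (con 1 ⊕ (♯ ⊕ (♯ ⊕ (♯ ⊕ ♯)))) ⊗ con 4) ⊕ ♯))))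
      bounded : ∀ a ys zs → proj₁ a ≡ ys ++ zs → ∥_∥ {Listᵗ ℕᵗ ⊠ Listᵗ Itemᵗ} (pass zs (proj₂ a)) ≤ val passBound (∥_∥ {PassInᵗ} a)
      bounded (its , z , Gs₀) ys zs eq with pass zs (z , Gs₀) | pass-bounds N z Gs₀ Gs₀≤ zs zs≤
        where
        N : ℕ
        N = ∥_∥ {PassInᵗ} (its , z , Gs₀)
        Gs₀≤ : ∥_∥ {Listᵗ ℕᵗ} Gs₀ ≤ N
        Gs₀≤ = m≤n⇒m≤1+n (≤-trans (m≤n⇒m≤1+n (m≤n+m _ (∥_∥ {ℕᵗ} z))) (m≤n+m _ (∥_∥ {Listᵗ Itemᵗ} its)))
        zs≤ : ∥_∥ {Listᵗ Itemᵗ} zs ≤ N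
        zs≤ = ≤-trans (∥++∥ʳ {Itemᵗ} ys zs) (≤-trans (≤-reflexive (cong (∥_∥ {Listᵗ Itemᵗ}) (sym eq))) (m≤n⇒m≤1+n (m≤m+n _ _)))
      ... | Gs , out | Gs< , Gs≤ , out≤ = s≤s (+-mono-≤
          (≤-trans (∥numbers∥ {length zs + N} Gs Gs<) (s≤s (*-mono-≤ Gs≤ (s≤s (s≤s (*-monoˡ-≤ 4 (+-monoˡ-≤ N zs#)))))))
          (≤-trans out≤ (s≤s (*-monoˡ-≤ (suc (passItem N z Gs₀ Gs₀≤)) zs#))))
        where
        N : ℕ
        N = ∥_∥ {PassInᵗ} (its , z , Gs₀)
        Gs₀≤ : ∥_∥ {Listᵗ ℕᵗ} Gs₀ ≤ N
        Gs₀≤ = m≤n⇒m≤1+n (≤-trans (m≤n⇒m≤1+n (m≤n+m _ (∥_∥ {ℕᵗ} z))) (m≤n+m _ (∥_∥ {Listᵗ Itemᵗ} its)))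
        zs# : length zs ≤ N
        zs# = ≤-trans (length≤∥∥ {Itemᵗ} zs) (≤-trans (∥++∥ʳ {Itemᵗ} ys zs) (≤-trans (≤-reflexive (cong (∥_∥ {Listᵗ Itemᵗ}) (sym eq))) (m≤n⇒m≤1+n (m≤m+n _ _))))

  Treeᵗ : Type
  Treeᵗ = type Tree id

  headₚ : ∀ {A f} → Poly A Treeᵗ f → Poly A Treeᵗ λ a → head (f a)
  headₚ P = exprₚ {Treeᵗ} {Treeᵗ} {head} (hdᵉ (var zero)) ♯ (λ _ _ → refl) head≤ ∙ P
    where
    head≤ : ∀ t → size (head t) ≤ size t
    head≤ nil        = ≤-refl
    head≤ (cons s t) = m≤n⇒m≤1+n (m≤m+n _ _)

  tailₚ : ∀ {A f} → Poly A Treeᵗ f → Poly A Treeᵗ λ a → tail (f a)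
  tailₚ P = exprₚ {Treeᵗ} {Treeᵗ} {tail} (tlᵉ (var zero)) ♯ (λ _ _ → refl) tail≤ ∙ P
    where
    tail≤ : ∀ t → size (tail t) ≤ size t
    tail≤ nil        = ≤-refl
    tail≤ (cons s t) = m≤n⇒m≤1+n (m≤n+m _ _)

  treeₚ : ∀ {A} → Poly A Treeᵗ (enc A)
  treeₚ = coerceₚ λ _ → refl

  -- Only the reading of the output tree changes. It turns a component of the input, reached by
  -- `headₚ` and `tailₚ`, into typed data.
  retypeₚ : ∀ {A B t f} → (∀ a → t a ≡ enc B (f a)) → Poly A Treeᵗ t → Poly A B f
  retypeₚ {A} {B} {t} {f} eq P = record
    { code  = code P
    ; time  = time P
    ; out   = out P
    ; runs  = λ a s → subst (λ x → Runs (code P) (enc A a Vec.∷ s Vec.∷ Vec.[]) (x Vec.∷ s Vec.∷ Vec.[]) _) (eq a) (runs P a s)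
    ; small = λ a → subst (λ x → size x ≤ _) (eq a) (small P a)
    }

  listᵗ-map : ∀ {X Y : Set} (f : Y → Tree) (g : X → Y) (k : X → Tree) → (∀ x → k x ≡ f (g x)) → ∀ xs → listᵗ k xs ≡ listᵗ f (map g xs)
  listᵗ-map f g k eq []       = refl
  listᵗ-map f g k eq (x ∷ xs) = cong₂ cons (eq x) (listᵗ-map f g k eq xs)

  tableᵗ-map : ∀ {X Y : Set} {m} (f : Y → Tree) (g : X → Y) (k : X → Tree) → (∀ x → k x ≡ f (g x)) → (x : Fin m → X) →
    tableᵗ k x ≡ listᵗ f (map (λ i → g (x i)) (allFin m))
  tableᵗ-map f g k eq x = trans (listᵗ-map f g k eq (tabulate x))
    (cong (listᵗ f) (trans (map-tabulate x g) (sym (map-tabulate id (λ i → g (x i))))))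

  -- Reading the input and building the integer tables

  Inputᵗ : Type
  Inputᵗ = type (Σ[ I ∈ Instance ] (Vec Bool 0 × History I × Fin (Instance.types I))) λ (I , r , h , b) → inputᵗ I r h b

  module In (x : Val Inputᵗ) where
    I = proj₁ x
    h = proj₁ (proj₂ (proj₂ x))
    b = proj₂ (proj₂ (proj₂ x))
    open Instance I public
    open Analysis I public using (itemsL; typesL; p; w; free)
    open IntegerPrices I public

    entry : Fin items → Fin types → Val Entryᵗ
    entry a b = α a b , ω a b , β b , μ b

    entries : Fin items → Val Rowᵗ
    entries a = map (entry a) typesL

    table : (Fin items → ℕ) → List (Fin items) → List (Val Itemᵗ)
    table ν = map (λ a → ν a , entries a)

    remaining : ℕ
    remaining = rounds ∸ suc (length h)

  ratio : ℚ → ℕ × ℕ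
  ratio x = ℤ.∣ ↥ x ∣ , ↧ₙ x

  Ratiosᵗ : Type
  Ratiosᵗ = Listᵗ (ℕᵗ ⊠ ℕᵗ)

  opaque
    probsₚ : Poly Inputᵗ (Listᵗ Ratiosᵗ) λ x → let open In x in map (λ a → map (λ b → ratio (p a b)) typesL) itemsL
    probsₚ = retypeₚ (λ (I , _) → tableᵗ-map (enc Ratiosᵗ) (λ f → map (λ b → ratio (f b)) (allFin _)) (tableᵗ ratᵗ) (tableᵗ-map (enc (ℕᵗ ⊠ ℕᵗ)) ratio ratᵗ (λ _ → refl)) (Instance.prob I))
      (headₚ (headₚ treeₚ))

  opaque
    profitsₚ : Poly Inputᵗ (Listᵗ Ratiosᵗ) λ x → let open In x in map (λ a → map (λ b → ratio (w a b)) typesL) itemsL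
    profitsₚ = retypeₚ (λ (I , _) → tableᵗ-map (enc Ratiosᵗ) (λ f → map (λ b → ratio (f b)) (allFin _)) (tableᵗ ratᵗ) (tableᵗ-map (enc (ℕᵗ ⊠ ℕᵗ)) ratio ratᵗ (λ _ → refl)) (Instance.profit I))
      (headₚ (tailₚ (headₚ treeₚ)))

  opaque
    timeoutsₚ : Poly Inputᵗ (Listᵗ ℕᵗ) λ x → let open In x in map timeout typesL
    timeoutsₚ = retypeₚ (λ (I , _) → tableᵗ-map binaryᵗ id binaryᵗ (λ _ → refl) (Instance.timeout I)) (headₚ (tailₚ (tailₚ (headₚ treeₚ))))

  opaque
    unaryRoundsₚ : Poly Inputᵗ Unaryᵗ λ x → let open In x in rounds
    unaryRoundsₚ = retypeₚ (λ _ → refl) (headₚ (tailₚ (tailₚ (tailₚ (headₚ treeₚ)))))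

  opaque
    multiplicitiesₚ : Poly Inputᵗ (Listᵗ ℕᵗ) λ x → let open In x in map multiplicity typesL
    multiplicitiesₚ = retypeₚ (λ (I , _) → tableᵗ-map binaryᵗ id binaryᵗ (λ _ → refl) (Instance.multiplicity I)) (tailₚ (tailₚ (tailₚ (tailₚ (headₚ treeₚ)))))

  -- A `Type` has no parameter for the instance, so each event is bundled with its instance, which
  -- leaves no trace in the encoding.
  Eventᵗ : Type
  Eventᵗ = type (Σ[ I ∈ Instance ] Event I) λ (I , e) → eventᵗ I e

  opaque
    historyₚ : Poly Inputᵗ (Listᵗ Eventᵗ) λ x → let open In x in map (I ,_) h
    historyₚ = retypeₚ (λ (I , _ , h , _) → listᵗ-map (enc Eventᵗ) (I ,_) (eventᵗ I) (λ _ → refl) h) (headₚ (tailₚ (tailₚ treeₚ)))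

  opaque
    buyerₚ : Poly Inputᵗ Unaryᵗ λ x → toℕ (In.b x)
    buyerₚ = retypeₚ (λ _ → refl) (tailₚ (tailₚ (tailₚ treeₚ)))

  -- A Maybe of an index has the encoding of a unary number, 0 for nothing.
  matchCode : ∀ {m} → Maybe (Fin m) → ℕ
  matchCode nothing  = 0
  matchCode (just a) = suc (toℕ a)

  opaque
    matchedₚ : Poly Eventᵗ Unaryᵗ λ (I , e) → matchCode (Event.matched e)
    matchedₚ = retypeₚ (λ (I , e) → codes (Event.matched e)) (tailₚ (tailₚ treeₚ))
      where
      codes : ∀ {m} (x : Maybe (Fin m)) → maybeᵗ indexᵗ x ≡ unaryᵗ (matchCode x)
      codes nothing  = refl
      codes (just a) = refl

  opaque
    -- The input gives `rounds` in unary; its binary form is obtained as the sum of the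
    -- multiplicities.
    roundsₚ : Poly Inputᵗ ℕᵗ λ x → In.rounds x
    roundsₚ = castₚ (λ (I , _) → trans (cong sum (map-tabulate id (Instance.multiplicity I))) (Instance.multiplicity-sum I)) (sumₚ multiplicitiesₚ)

  denominatorsₚ : {f : (x : Val Inputᵗ) → Fin (In.items x) → Fin (In.types x) → ℚ} →
    Poly Inputᵗ (Listᵗ Ratiosᵗ) (λ x → map (λ a → map (λ b → ratio (f x a b)) (In.typesL x)) (In.itemsL x)) →
    Poly Inputᵗ ℕᵗ λ x → In.denominators x (f x)
  denominatorsₚ {f} P = productₚ (mapOverₚ {Inputᵗ} {Ratiosᵗ} {ℕᵗ} {xs = In.itemsL} P (productₚ (mapₚ fstₚ (sndₚ ∙ fstₚ)))
    (λ x a → cong product (sym (map-∘ {g = proj₂} {f = λ b → ratio (f x a b)} (In.typesL x)))))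

  opaque
    Zₚ : Poly Inputᵗ ℕᵗ In.Z
    Zₚ = denominatorsₚ {λ x → In.p x} probsₚ *ₚ (denominatorsₚ {λ x → In.w x} profitsₚ *ₚ (productₚ timeoutsₚ *ₚ roundsₚ))

  opaque
    -- The exponents are lengths of lists that are at hand: the table of probabilities for `items`,
    -- the unary notation for `rounds`.
    Qₚ : Poly Inputᵗ ℕᵗ In.Q
    Qₚ = castₚ (λ x → cong₂ (λ m n → ((In.Z x * In.Z x) ^ m) ^ n)
          (trans (length-map (λ a → map (λ b → ratio (In.p x a b)) (In.typesL x)) (In.itemsL x)) (length-tabulate {n = In.items x} id)) (length-replicate (In.rounds x)))
      (powₚ (powₚ (Zₚ *ₚ Zₚ) probsₚ) (ticksₚ unaryRoundsₚ))

  opaque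
    typeDataₚ : Poly Inputᵗ (Listᵗ (ℕᵗ ⊠ ℕᵗ)) λ x → let open In x in map (λ b → β b , μ b) typesL
    typeDataₚ = mapOverₚ {Inputᵗ} {ℕᵗ ⊠ ℕᵗ} {ℕᵗ ⊠ ℕᵗ} {xs = In.typesL} (zipOverₚ {xs = In.typesL} timeoutsₚ multiplicitiesₚ)
      ⟨ quotₚ (Zₚ ∙ sndₚ) (fstₚ ∙ fstₚ) , sndₚ ∙ fstₚ *ₚ quotₚ (Zₚ ∙ sndₚ) (roundsₚ ∙ sndₚ) ⟩ (λ _ _ → refl)

  opaque
    rowsₚ : Poly Inputᵗ (Listᵗ Rowᵗ) λ x → let open In x in map entries itemsL
    rowsₚ = mapOverₚ {Inputᵗ} {Ratiosᵗ ⊠ Ratiosᵗ} {Rowᵗ} {xs = In.itemsL} (zipOverₚ {xs = In.itemsL} probsₚ profitsₚ)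
      (mapₚ {(Ratiosᵗ ⊠ Ratiosᵗ) ⊠ Inputᵗ} {((ℕᵗ ⊠ ℕᵗ) ⊠ (ℕᵗ ⊠ ℕᵗ)) ⊠ (ℕᵗ ⊠ ℕᵗ)} {Entryᵗ} (zipₚ (zipₚ (fstₚ ∙ fstₚ) (sndₚ ∙ fstₚ)) (typeDataₚ ∙ sndₚ))
        ⟨ scaled (fstₚ ∙ fstₚ ∙ fstₚ) , ⟨ scaled (sndₚ ∙ fstₚ ∙ fstₚ) *ₚ Qₚ ∙ sndₚ ∙ sndₚ , sndₚ ∙ fstₚ ⟩ ⟩)
      eq
      where
      Ctx : Type
      Ctx = (((ℕᵗ ⊠ ℕᵗ) ⊠ (ℕᵗ ⊠ ℕᵗ)) ⊠ (ℕᵗ ⊠ ℕᵗ)) ⊠ ((Ratiosᵗ ⊠ Ratiosᵗ) ⊠ Inputᵗ)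
      scaled : ∀ {f} → Poly Ctx (ℕᵗ ⊠ ℕᵗ) f → Poly Ctx ℕᵗ λ c → proj₁ (f c) * quot (In.Z (proj₂ (proj₂ c))) (proj₂ (f c))
      scaled P = fstₚ ∙ P *ₚ quotₚ (Zₚ ∙ sndₚ ∙ sndₚ) (sndₚ ∙ P)
      build : Val Inputᵗ → ((ℕ × ℕ) × (ℕ × ℕ)) × (ℕ × ℕ) → Val Entryᵗ
      build x (((pn , pd) , wn , wd) , βμ) = pn * quot (In.Z x) pd , wn * quot (In.Z x) wd * In.Q x , βμ
      eq : ∀ x a → let open In x in
        map (build x) (zip (zip (map (λ b → ratio (p a b)) typesL) (map (λ b → ratio (w a b)) typesL)) (map (λ b → β b , μ b) typesL)) ≡ entries a
      eq x a = trans (cong (map (build x)) (trans (cong (λ l → zip l (map (λ b → β b , μ b) typesL)) (zip-map _ _ typesL)) (zip-map _ _ typesL)))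
        (sym (map-∘ typesL))
        where open In x

  -- Correctness and size of the price table

  module Correct (x : Val Inputᵗ) where
    open In x

    zeros : List ℕ
    zeros = map (λ _ → 0) typesL

    pass-table : ∀ ν ys zs → itemsL ≡ ys ++ zs → pass (table ν zs) (Z , zeros) ≡ (map (G ν zs) typesL , table (raise ν) zs)
    pass-table ν ys []       eq = refl
    pass-table ν ys (a ∷ zs) eq = trans
      (cong (λ st → passStep Z st (ν a , entries a)) (pass-table ν (ys ++ a ∷ []) zs (trans eq (sym (++-assoc ys (a ∷ []) zs)))))
      (trans (cong (λ gs → addAll gs (map (G ν zs) typesL) , raiseItem Z (ν a , entries a) gs ∷ table (raise ν) zs) gains)
        (cong₂ (λ Gs n → Gs , (ν a + quot (sum n) Z , entries a) ∷ table (raise ν) zs)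
          (trans (cong (map _) (zip-map (λ b → excess ν a b (G ν zs b)) (G ν zs) typesL)) (sym (map-∘ typesL)))
          (trans (cong (map weighted) (zip-map (entry a) (λ b → excess ν a b (G ν zs b)) typesL))
            (trans (sym (map-∘ typesL)) (map-cong (λ b → cong (μ b *_) (sym (excessIn-items ν ys a zs b eq))) typesL)))))
      where
      gains : surpluses Z (ν a , entries a) (map (G ν zs) typesL) ≡ map (λ b → excess ν a b (G ν zs b)) typesL
      gains = trans (cong (map (entrySurplus Z (ν a))) (zip-map (entry a) (G ν zs) typesL)) (sym (map-∘ typesL))

    passes-table : ∀ k (ts : List ⊤) →
      foldl (λ st _ → proj₂ (pass st (Z , zeros))) (table (prices k) itemsL) ts ≡ table (prices (length ts + k)) itemsL
    passes-table k []       = refl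
    passes-table k (t ∷ ts) = trans (cong (λ st → foldl _ (proj₂ st) ts) (pass-table (prices k) [] itemsL refl))
      (trans (passes-table (suc k) ts) (cong (λ j → table (prices j) itemsL) (+-suc (length ts) k)))

    module _ (N : ℕ) (rows≤ : ∥_∥ {Listᵗ Rowᵗ} (map entries itemsL) ≤ N) where

      entries≤ : ∀ a → ∥_∥ {Rowᵗ} (entries a) ≤ N
      entries≤ a = All.lookup (All-∥∥ {Rowᵗ} (map entries itemsL) rows≤) (∈-map⁺ entries (∈-allFin a))

      entry≤ : ∀ a b → ∥_∥ {Entryᵗ} (entry a b) ≤ N
      entry≤ a b = All.lookup (All-∥∥ {Entryᵗ} (entries a) (entries≤ a)) (∈-map⁺ (entry a) (∈-allFin b))

      excessIn≤ : ∀ ν as a b → excessIn ν as a b ≤ entryValue (entry a b)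
      excessIn≤ ν []       a b = z≤n
      excessIn≤ ν (y ∷ as) a b with y Fin.≟ a
      ... | yes refl = entrySurplus≤ Z (ν y) (entry y b) (G ν as b)
      ... | no _     = excessIn≤ ν as a b

      -- The increments of all rounds are below one fixed power of 2, so a round adds at most one
      -- bit. Applying `pass-bounds` round after round would give no polynomial bound, because its
      -- estimate for the new table is a multiple of the old size.
      prices< : ∀ k a → prices k a < 2 ^ (k + (N + (N + N)))
      prices< zero    a = m^n>0 2 (N + (N + N))
      prices< (suc k) a = double-<2^ (k + (N + (N + N))) (prices< k a) (≤-trans (s≤s (quot-≤ total Z))
        (<2^-mono (length terms + (N + N)) (k + (N + (N + N))) (≤-trans (+-monoˡ-≤ (N + N) terms≤) (m≤n+m _ k)) (sum-<2^ terms terms<)))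
        where
        terms : List ℕ
        terms = map (λ b → μ b * excessIn (prices k) itemsL a b) typesL
        total : ℕ
        total = sum terms
        terms≤ : length terms ≤ N
        terms≤ = ≤-trans (≤-reflexive (trans (length-map _ typesL) (sym (length-map (entry a) typesL))))
          (≤-trans (length≤∥∥ {Entryᵗ} (entries a)) (entries≤ a))
        terms< : All (_< 2 ^ (N + N)) terms
        terms< = All.map⁺ (All.universal (λ b → *-<2^ N N
          (<2^-mono (∥_∥ {Entryᵗ} (entry a b)) N (entry≤ a b) (entryWeight< (entry a b)))
          (≤-trans (s≤s (excessIn≤ (prices k) itemsL a b)) (<2^-mono (∥_∥ {Entryᵗ} (entry a b)) N (entry≤ a b) (entryValue< (entry a b))))) typesL)

      ∥table∥ : ∀ j → ∥_∥ {Listᵗ Itemᵗ} (table (prices j) itemsL) ≤ suc (N * (2 + ((1 + (j + (N + (N + N))) * 4) + N)))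
      ∥table∥ j = ≤-trans (go itemsL) (s≤s (*-monoˡ-≤ _ (≤-trans (≤-reflexive (sym (length-map entries itemsL)))
        (≤-trans (length≤∥∥ {Rowᵗ} (map entries itemsL)) rows≤))))
        where
        M = (1 + (j + (N + (N + N))) * 4) + N
        go : ∀ as → ∥_∥ {Listᵗ Itemᵗ} (table (prices j) as) ≤ suc (length as * (2 + M))
        go []       = s≤s z≤n
        go (a ∷ as) = s≤s (≤-trans (+-mono-≤ (s≤s (+-mono-≤ (∥n∥≤ (j + (N + (N + N))) (prices< j a)) (entries≤ a))) (go as))
          (≤-reflexive (+-suc (suc M) (length as * (2 + M)))))

  opaque
    remainingₚ : Poly Inputᵗ (Listᵗ Unitᵗ) λ x → replicate (In.remaining x) tt
    remainingₚ = castₚ (λ (I , _ , h , _) → eq (Instance.rounds I) I h) (dropsₚ (dropHeadₚ ∙ ticksₚ unaryRoundsₚ) historyₚ)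
      where
      drop-replicate : ∀ m n → drop m (replicate n tt) ≡ replicate (n ∸ m) tt
      drop-replicate zero    n       = refl
      drop-replicate (suc m) zero    = refl
      drop-replicate (suc m) (suc n) = drop-replicate m n
      eq : ∀ n I (h : History I) → drop (length {A = Val Eventᵗ} (map (I ,_) h)) (dropHead (replicate n tt)) ≡ replicate (n ∸ suc (length h)) tt
      eq zero    I h = trans (cong (λ m → drop m []) (length-map {A = Event I} {B = Val Eventᵗ} (I ,_) h)) (drop-[] (length h))
      eq (suc n) I h = trans (cong (λ m → drop m (replicate n tt)) (length-map {A = Event I} {B = Val Eventᵗ} (I ,_) h)) (drop-replicate (length h) n)

  opaque
    zerosₚ : Poly Inputᵗ (Listᵗ ℕᵗ) Correct.zeros
    zerosₚ = mapOverₚ {Inputᵗ} {ℕᵗ} {ℕᵗ} {xs = In.typesL} timeoutsₚ (constₚ 0) (λ _ _ → refl)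

  opaque
    tableₚ : Poly Inputᵗ (Listᵗ Itemᵗ) λ x → let open In x in table (prices remaining) itemsL
    tableₚ = castₚ (λ x → trans (Correct.passes-table x 0 (replicate (In.remaining x) tt))
          (cong (λ j → In.table x (In.prices x j) (In.itemsL x)) (trans (+-identityʳ _) (length-replicate (In.remaining x)))))
      (foldlₚ {Inputᵗ} {Listᵗ Itemᵗ} {Unitᵗ} {f = λ (st , _ , x) → proj₂ (pass st (In.Z x , Correct.zeros x))}
        (mapOverₚ {Inputᵗ} {Rowᵗ} {Itemᵗ} {xs = In.itemsL} rowsₚ ⟨ constₚ 0 , fstₚ ⟩ (λ _ _ → refl)) remainingₚ
        (sndₚ ∙ passₚ ∙ ⟨ fstₚ , ⟨ Zₚ ∙ sndₚ ∙ sndₚ , zerosₚ ∙ sndₚ ∙ sndₚ ⟩ ⟩)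
        tableBound bounded)
      where
      R tableBound : Bound
      R = out rowsₚ
      tableBound = con 1 ⊕ R ⊗ (con 2 ⊕ ((con 1 ⊕ (out remainingₚ ⊕ (R ⊕ (R ⊕ R))) ⊗ con 4) ⊕ R))
      bounded : ∀ x ys zs → replicate (In.remaining x) tt ≡ ys ++ zs →
        ∥_∥ {Listᵗ Itemᵗ} (foldl (λ st _ → proj₂ (pass st (In.Z x , Correct.zeros x))) (In.table x (λ _ → 0) (In.itemsL x)) ys) ≤ val tableBound (∥_∥ {Inputᵗ} x)
      bounded x ys zs eq = ≤-trans (≤-reflexive (cong (∥_∥ {Listᵗ Itemᵗ}) (Correct.passes-table x 0 ys)))
        (≤-trans (Correct.∥table∥ x (val R n) (small rowsₚ x) (length ys + 0))
          (s≤s (*-monoʳ-≤ (val R n) (s≤s (s≤s (+-monoˡ-≤ (val R n) (s≤s (*-monoˡ-≤ 4 (+-monoˡ-≤ (val R n + (val R n + val R n)) ys≤)))))))))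
        where
        n : ℕ
        n = ∥_∥ {Inputᵗ} x
        ys≤ : length ys + 0 ≤ val (out remainingₚ) n
        ys≤ = ≤-trans (≤-reflexive (+-identityʳ (length ys))) (≤-trans (length≤∥∥ {Unitᵗ} ys) (≤-trans (∥++∥ˡ {Unitᵗ} ys zs)
          (≤-trans (≤-reflexive (cong (∥_∥ {Listᵗ Unitᵗ}) (sym eq))) (small remainingₚ x))))

  nth : ∀ {X : Set} → X → ℕ → List X → X
  nth d n xs = headOr d (drop n xs)

  nth-tabulate : ∀ {X : Set} {m} d (f : Fin m → X) i → nth d (toℕ i) (map f (allFin m)) ≡ f i
  nth-tabulate {m = m} d f i = trans (cong (nth d (toℕ i)) (map-tabulate id f)) (go f i)
    where
    go : ∀ {m} (f : Fin m → _) i → nth d (toℕ i) (tabulate f) ≡ f i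
    go f zero    = refl
    go f (suc i) = go (f ∘ suc) i

  nthₚ : ∀ {A E n l} d → Poly A Unaryᵗ n → Poly A (Listᵗ E) l → Poly A E λ a → nth d (n a) (l a)
  nthₚ {n = n} {l} d P L = castₚ (λ a → cong (λ k → nth d k (l a)) (length-replicate (n a))) (headOrₚ d (dropsₚ L (ticksₚ P)))

  freeIn : List (Val Eventᵗ) → ℕ → Bool
  freeIn []             i = true
  freeIn ((I , e) ∷ es) i = not (matchCode (Event.matched e) ≡ᵇ suc i) ∧ freeIn es i

  opaque
    freeₚ : Poly (Unaryᵗ ⊠ Inputᵗ) Boolᵗ λ (i , x) → freeIn (map (In.I x ,_) (In.h x)) i
    freeₚ = listRecₚ {Unaryᵗ ⊠ Inputᵗ} {Boolᵗ} {Eventᵗ} {λ (_ , x) → map (In.I x ,_) (In.h x)} {λ es (i , _) → freeIn es i}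
      {λ (r , (I , e) , i , _) → not (matchCode (Event.matched e) ≡ᵇ suc i) ∧ r} (historyₚ ∙ sndₚ) (constₚ true)
      (notₚ (equalᵘₚ (matchedₚ ∙ fstₚ ∙ sndₚ) (sucᵘₚ (fstₚ ∙ sndₚ ∙ sndₚ))) ∧ₚ fstₚ) (λ _ _ _ → refl) (con 3)
      λ (i , _) ys zs eq → ∥bool∥≤3 (freeIn zs i)
  
  ≟≡ᵇ : ∀ {m} (a b : Fin m) → does (a Fin.≟ b) ≡ (toℕ a ≡ᵇ toℕ b)
  ≟≡ᵇ zero    zero    = refl
  ≟≡ᵇ zero    (suc b) = refl
  ≟≡ᵇ (suc a) zero    = refl
  ≟≡ᵇ (suc a) (suc b) = ≟≡ᵇ a b

  freeIn-free : ∀ I (h : History I) a → freeIn (map (I ,_) h) (toℕ a) ≡ Analysis.free I h a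
  freeIn-free I []                        a = refl
  freeIn-free I (event b as nothing ∷ h)  a = freeIn-free I h a
  freeIn-free I (event b as (just x) ∷ h) a = cong₂ (λ c f → not c ∧ f) (sym (≟≡ᵇ x a)) (freeIn-free I h a)

  -- Selection of the items to probe

  Candidateᵗ : Type
  Candidateᵗ = Itemᵗ ⊠ Unaryᵗ

  noEntry : Val Entryᵗ
  noEntry = 0 , 0 , 0 , 0

  candidateSurplus : Val Inputᵗ → Val Candidateᵗ → ℕ → ℕ
  candidateSurplus x ((ν , row) , i) G = entrySurplus (In.Z x) ν (nth noEntry (toℕ (In.b x)) row , G)

  -- The sweep is repeated with the final prices for the type of the buyer only. As the last item
  -- comes first, putting accepted indices in front leaves them in probing order.
  selectStep : Val Inputᵗ → ℕ × List ℕ → Val Candidateᵗ → ℕ × List ℕ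
  selectStep x (G , is) c@(_ , i) = candidateSurplus x c G + G ,
    (ifᵇ not (isZero (candidateSurplus x c G)) ∧ freeIn (map (In.I x ,_) (In.h x)) i then i ∷ is else is)

  select : List (Val Candidateᵗ) → Val Inputᵗ → ℕ × List ℕ
  select []       x = 0 , []
  select (c ∷ cs) x = selectStep x (select cs x) c

  opaque
    candidatesₚ : Poly Inputᵗ (Listᵗ Candidateᵗ) λ x → let open In x in map (λ a → (prices remaining a , entries a) , toℕ a) itemsL
    candidatesₚ = zipOverₚ {xs = In.itemsL} tableₚ
      (castₚ (λ x → trans (cong indices (map-tabulate {n = In.items x} id (In.entries x))) (indices-tabulate (In.items x) (In.entries x))) (indicesₚ rowsₚ))

  select-bounds : ∀ N x cs → ∥_∥ {Listᵗ Candidateᵗ} cs ≤ N → let (G , is) = select cs x in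
    G < 2 ^ (length cs + N) × ∥_∥ {Listᵗ Unaryᵗ} is ≤ ∥_∥ {Listᵗ Candidateᵗ} cs
  select-bounds N x []                       cs≤ = m^n>0 2 N , ≤-refl
  select-bounds N x (c@((ν , row) , i) ∷ cs) cs≤ with select cs x | select-bounds N x cs (≤-trans (m≤n⇒m≤1+n (m≤n+m _ _)) cs≤)
  ... | G , is | G< , is≤ =
    double-<2^ (length cs + N) (<2^-mono N (length cs + N) (m≤n+m N (length cs))
      (≤-trans (s≤s (entrySurplus≤ (In.Z x) ν (nth noEntry (toℕ (In.b x)) row) G)) (nth< (toℕ (In.b x)) row (All-∥∥ {Entryᵗ} row row≤)))) G< ,
    kept (not (isZero (candidateSurplus x c G)) ∧ freeIn (map (In.I x ,_) (In.h x)) i)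
    where
    row≤ : ∥_∥ {Rowᵗ} row ≤ N
    row≤ = ≤-trans (m≤n⇒m≤1+n (m≤n+m _ (∥_∥ {ℕᵗ} ν))) (≤-trans (m≤n⇒m≤1+n (m≤m+n _ (∥_∥ {Unaryᵗ} i))) (≤-trans (m≤n⇒m≤1+n (m≤m+n _ (∥_∥ {Listᵗ Candidateᵗ} cs))) cs≤))
    nth< : ∀ n row → All (λ e → ∥_∥ {Entryᵗ} e ≤ N) row → entryValue (nth noEntry n row) < 2 ^ N
    nth< zero    []        _        = m^n>0 2 N
    nth< (suc n) []        _        = m^n>0 2 N
    nth< zero    (e ∷ row) (e≤ ∷ _) = <2^-mono (∥_∥ {Entryᵗ} e) N e≤ (entryValue< e)
    nth< (suc n) (e ∷ row) (_ ∷ r≤) = nth< n row r≤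
    kept : ∀ k → ∥_∥ {Listᵗ Unaryᵗ} (ifᵇ k then i ∷ is else is) ≤ ∥_∥ {Listᵗ Candidateᵗ} (c ∷ cs)
    kept true  = s≤s (+-mono-≤ (m≤n⇒m≤1+n (m≤n+m _ _)) is≤)
    kept false = m≤n⇒m≤1+n (≤-trans is≤ (m≤n+m _ _))

  opaque
    selectₚ : Poly Inputᵗ (ℕᵗ ⊠ Listᵗ Unaryᵗ) λ x → let open In x in select (map (λ a → (prices remaining a , entries a) , toℕ a) itemsL) x
    selectₚ = listRecₚ {Inputᵗ} {ℕᵗ ⊠ Listᵗ Unaryᵗ} {Candidateᵗ} {h = select} {λ (st , c , x) → selectStep x st c} candidatesₚ (constₚ (0 , []))
      ⟨ gₚ +ₚ fstₚ ∙ fstₚ , ifₚ (notₚ (isZeroₚ gₚ) ∧ₚ freeₚ ∙ ⟨ iₚ , sndₚ ∙ sndₚ ⟩) (consₚ iₚ (sndₚ ∙ fstₚ)) (sndₚ ∙ fstₚ) ⟩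
      (λ _ _ _ → refl) (con 1 ⊕ (logBound (C ⊕ C) ⊕ C))
      λ x ys zs eq → let zs≤ = ≤-trans (∥++∥ʳ {Candidateᵗ} ys zs) (≤-trans (≤-reflexive (cong (∥_∥ {Listᵗ Candidateᵗ}) (sym eq))) (small candidatesₚ x))
                         N = val C (∥_∥ {Inputᵗ} x) in
        s≤s (+-mono-≤ (∥n∥≤ (N + N) (<2^-mono (length zs + N) (N + N) (+-monoˡ-≤ N (≤-trans (length≤∥∥ {Candidateᵗ} zs) zs≤)) (proj₁ (select-bounds N x zs zs≤))))
          (≤-trans (proj₂ (select-bounds N x zs zs≤)) zs≤))
      where
      C : Bound
      C = out candidatesₚ
      Ctx : Type
      Ctx = (ℕᵗ ⊠ Listᵗ Unaryᵗ) ⊠ (Candidateᵗ ⊠ Inputᵗ)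
      iₚ : Poly Ctx Unaryᵗ λ (_ , (_ , i) , _) → i
      iₚ = sndₚ ∙ fstₚ ∙ sndₚ
      gₚ : Poly Ctx ℕᵗ λ ((G , _) , c , x) → candidateSurplus x c G
      gₚ = surplusₚ (Zₚ ∙ sndₚ ∙ sndₚ) (fstₚ ∙ fstₚ ∙ fstₚ ∙ sndₚ) (nthₚ noEntry (buyerₚ ∙ sndₚ ∙ sndₚ) (sndₚ ∙ fstₚ ∙ fstₚ ∙ sndₚ)) (fstₚ ∙ fstₚ)

  select-correct : ∀ x → let open In x in ∀ ys zs → itemsL ≡ ys ++ zs →
    select (map (λ a → (prices remaining a , entries a) , toℕ a) zs) x ≡
      (G (prices remaining) zs b , map toℕ (Analysis.selection I integerPrices remaining h b zs))
  select-correct x ys []       eq = refl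
  select-correct x ys (a ∷ zs) eq = trans
    (cong (λ st → selectStep x st ((ν a , entries a) , toℕ a)) (select-correct x (ys ++ a ∷ []) zs (trans eq (sym (++-assoc ys (a ∷ []) zs)))))
    (trans (cong₂ (λ g f → g + G ν zs b , (ifᵇ not (isZero g) ∧ f then toℕ a ∷ map toℕ rest else map toℕ rest))
        (cong (λ e → entrySurplus Z (ν a) (e , G ν zs b)) (nth-tabulate noEntry (entry a) b)) (freeIn-free I h a))
      (cong (excess ν a b (G ν zs b) + G ν zs b ,_) (trans
        (cong (λ g → ifᵇ not (isZero g) ∧ free h a then toℕ a ∷ map toℕ rest else map toℕ rest) (sym (excessIn-items ν ys a zs b eq)))
        (filter-∷ (Analysis.wanted I integerPrices remaining h b) a zs))))
    where
    open In x
    ν = prices remaining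
    rest = Analysis.selection I integerPrices remaining h b zs
    filter-∷ : ∀ {m} (f : Fin m → Bool) a as →
      (ifᵇ f a then toℕ a ∷ map toℕ (filter (λ a → T? (f a)) as) else map toℕ (filter (λ a → T? (f a)) as)) ≡ map toℕ (filter (λ a → T? (f a)) (a ∷ as))
    filter-∷ f a as with f a
    ... | true  = refl
    ... | false = refl

  algorithm : (I : Instance) → OnlineAlgorithm I
  algorithm I = Analysis.priceAlgorithm I (IntegerPrices.integerPrices I)

  opaque
    chooseₚ : Poly Inputᵗ (Listᵗ Unaryᵗ) λ (I , r , h , b) → map toℕ (Policy.choose (OnlineAlgorithm.policy (algorithm I) r) h b)
    chooseₚ = castₚ (λ x → trans
        (cong₂ take (nth-tabulate 0 (In.timeout x) (In.b x)) (cong proj₂ (select-correct x [] (In.itemsL x) refl)))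
        (take-map (In.timeout x (In.b x)) _))
      (takeₚ (nthₚ 0 buyerₚ timeoutsₚ) (sndₚ ∙ selectₚ))

  algorithm-PolynomialTime : PolynomialTime algorithm
  algorithm-PolynomialTime = record
    -- The extra variable is the stack, nil at the start; the empty polynomial is 0, the number of
    -- coins.
    { program    = record { extra = 1 ; body = code chooseₚ }
    ; coinCount  = []
    ; timeBound  = toPolynomial (time chooseₚ)
    ; coins-poly = λ _ → refl
    ; computes   = λ I r h b → let (t , t≤ , run) = runs chooseₚ (I , r , h , b) nil in
        t , ≤-trans t≤ (≤-reflexive (sym (⟦toPolynomial⟧ (time chooseₚ) (size (inputᵗ I r h b))))) ,
        _ , run , sym (listᵗ-map unaryᵗ toℕ indexᵗ (λ _ → refl) (Policy.choose (OnlineAlgorithm.policy (algorithm I) r) h b))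
    }

open import Data.Integer.Base using (+_)
open import Data.Product.Base using (Σ-syntax; _×_; _,_)
open import Data.Rational.Base using (_/_; _*_; _≤_)

theorem3 : Σ[ alg ∈ ((I : Instance) → OnlineAlgorithm I) ]
    PolynomialTime alg
    × (∀ (I : Instance) (opt : OnlineAlgorithm I) →
    ((+ 245) / 1000) * expectedProfit I opt ≤ expectedProfit I (alg I))
theorem3 = algorithm , algorithm-PolynomialTime , λ I → Analysis.price-competitive I (IntegerPrices.integerPrices I)
  where
  open Competitiveness using (module Analysis)
  open Pricing using (module IntegerPrices)
  open Implementation using (algorithm; algorithm-PolynomialTime)
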